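{- For $k\in\mathbb{N}_0$ let \[ \alpha_q(k)=q^{ -4k}[8k+1]^2[8k+1]_{q^2}\frac{(q^2;q^8)_k^2\,(xq^2;q^8)_k\,(q^2/x;q^8)_k}{(q^8;q^8)_k^2\,(xq^8;q^8)_k\,(q^8/x;q^8)_k}, \] \[ s_q(k)=\sum_{j=0}^k\alpha_q(j)\alpha_q(k-j),\qquad t_q(k)=\sum_{j=0}^k\sum_{i=0}^{k-j}\alpha_q(j)\alpha_q(i)\alpha_q(k-j-i), \] \[ u_q(k)=\sum_{j=0}^k\sum_{i=0}^{k-j}\sum_{h=0}^{k-j-i}\alpha_q(j)\alpha_q(i)\alpha_q(h)\alpha_q(k-j-i-h). \] Let $E=1-\dfrac{(1-xq^2)(1-q^2/x)}{(1-q)^2(1+q^2)}$. Then for every positive integer $n$ all of whose prime factors are congruent to $1$ modulo $4$, modulo $[n]_{q^2}(1-xq^{2n})(x-q^{2n})$ we have \[ \sum_{k=0}^{n-1}s_q(k)\equiv[n]_{q^2}^2\frac{(q^4;q^8)_{(n-1)/4}^2}{(q^8;q^8)_{(n-1)/4}^2}q^{1-n}E^2,\qquad \sum_{k=0}^{n-1}t_q(k)\equiv[n]_{q^2}^3\frac{(q^4;q^8)_{(n-1)/4}^3}{(q^8;q^8)_{(n-1)/4}^3}q^{3(1-n)/2}E^3, \] \[ \sum_{k=0}^{n-1}u_q(k)\equiv[n]_{q^2}^4\frac{(q^4;q^8)_{(n-1)/4}^4}{(q^8;q^8)_{(n-1)/4}^4}q^{2(1-n)}E^4. \]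
   Context: $x$ is an indeterminate and $q$ a variable. $(a;q)_0=1$, $(a;q)_k=\prod_{j=0}^{k-1}(1-aq^j)$; $[m]=[m]_q=(1-q^m)/(1-q)$ and $[m]_{q^2}=(1-q^{2m})/(1-q^2)$. For rational functions $A,B$ and a polynomial $P$, $A\equiv B\pmod P$ means that, writing $A-B=A_1/A_2$ in lowest terms, $P$ divides $A_1$ and $\gcd(P,A_2)=1$. -}

module Defs where

open import Data.Integer as ℤ using (ℤ; 0ℤ; 1ℤ; -_)
open import Data.Nat as ℕ using (ℕ; zero; suc)
open import Data.List using (List; []; _∷_; map)
open import Data.List.Relation.Unary.All using (All)
open import Data.Product using (Σ; _×_; _,_)
open import Relation.Binary.PropositionalEquality using (_≡_)
open import Relation.Nullary using (¬_)

-- Univariate polynomials in q over ℤ (coefficient lists, low degree first)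

P1 : Set
P1 = List ℤ

add1 : P1 → P1 → P1
add1 [] b = b
add1 (a ∷ p) [] = a ∷ p
add1 (a ∷ p) (b ∷ r) = (a ℤ.+ b) ∷ add1 p r

scale1 : ℤ → P1 → P1
scale1 a = map (a ℤ.*_)

mul1 : P1 → P1 → P1
mul1 [] r = []
mul1 (a ∷ p) r = add1 (scale1 a r) (0ℤ ∷ mul1 p r)

neg1 : P1 → P1
neg1 = map -_

-- Bivariate polynomials in ℤ[x,q]: lists (in powers of x) of
-- polynomials in q.

Poly : Set
Poly = List P1

addP : Poly → Poly → Poly
addP [] b = b
addP (a ∷ p) [] = a ∷ p
addP (a ∷ p) (b ∷ r) = add1 a b ∷ addP p r

mulP : Poly → Poly → Poly
mulP [] r = []
mulP (a ∷ p) r = addP (map (mul1 a) r) ([] ∷ mulP p r)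

negP : Poly → Poly
negP = map neg1

subP : Poly → Poly → Poly
subP a b = addP a (negP b)

zeroP oneP xP qP : Poly
zeroP = []
oneP = (1ℤ ∷ []) ∷ []
xP = [] ∷ (1ℤ ∷ []) ∷ []
qP = (0ℤ ∷ 1ℤ ∷ []) ∷ []

powP : Poly → ℕ → Poly
powP p zero = oneP
powP p (suc n) = mulP p (powP p n)

IsZero : Poly → Set
IsZero p = All (All (_≡ 0ℤ)) p

_≈P_ : Poly → Poly → Set
a ≈P b = IsZero (subP a b)

_∣P_ : Poly → Poly → Set
d ∣P a = Σ Poly (λ c → mulP c d ≈P a)

IsUnit : Poly → Set
IsUnit u = Σ Poly (λ v → mulP u v ≈P oneP)

CoprimeP : Poly → Poly → Set
CoprimeP a b = ∀ d → d ∣P a → d ∣P b → IsUnit d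

infixl 6 _+F_ _-F_
infixl 7 _*F_ _/F_
infix 8 -F_
infix 4 _≈F_ _≈P_ _∣P_

record Frac : Set where
  constructor _//_
  field
    num : Poly
    den : Poly
open Frac public

fromP : Poly → Frac
fromP p = p // oneP

_+F_ : Frac → Frac → Frac
(a // b) +F (c // d) = addP (mulP a d) (mulP c b) // mulP b d

_*F_ : Frac → Frac → Frac
(a // b) *F (c // d) = mulP a c // mulP b d

-F_ : Frac → Frac
-F (a // b) = negP a // b

_-F_ : Frac → Frac → Frac
a -F b = a +F (-F b)

invF : Frac → Frac
invF (a // b) = b // a

_/F_ : Frac → Frac → Frac
a /F b = a *F invF b

oneF xF qF : Frac
oneF = fromP oneP
xF = fromP xP
qF = fromP qP

powF : Frac → ℕ → Frac
powF a zero = oneF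
powF a (suc n) = a *F powF a n

_≈F_ : Frac → Frac → Set
(a // b) ≈F (c // d) = mulP a d ≈P mulP c b

poch : Frac → Frac → ℕ → Frac
poch a b zero = oneF
poch a b (suc k) = poch a b k *F (oneF -F (a *F powF b k))

qint : ℕ → Frac
qint m = (oneF -F powF qF m) /F (oneF -F qF)

qint2 : ℕ → Frac
qint2 m = (oneF -F powF qF (2 ℕ.* m)) /F (oneF -F powF qF 2)

qint2P : ℕ → Poly
qint2P zero = zeroP
qint2P (suc n) = addP (qint2P n) (powP qP (2 ℕ.* n))

sumF : ℕ → (ℕ → Frac) → Frac
sumF zero f = fromP zeroP
sumF (suc n) f = sumF n f +F f n

CongMod : Frac → Frac → Poly → Set
CongMod A B P =
  Σ Poly λ A1 → Σ Poly λ A2 →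
    ¬ IsZero A2 × ((A -F B) ≈F (A1 // A2)) × CoprimeP A1 A2 ×
    P ∣P A1 × CoprimeP P A2

q2 q8 : Frac
q2 = powF qF 2
q8 = powF qF 8

α : ℕ → Frac
α k =
  (invF (powF qF (4 ℕ.* k)) *F powF (qint (8 ℕ.* k ℕ.+ 1)) 2
     *F qint2 (8 ℕ.* k ℕ.+ 1))
  *F ((powF (poch q2 q8 k) 2 *F poch (xF *F q2) q8 k *F poch (q2 /F xF) q8 k)
      /F (powF (poch q8 q8 k) 2 *F poch (xF *F q8) q8 k *F poch (q8 /F xF) q8 k))

s : ℕ → Frac
s k = sumF (suc k) λ j → α j *F α (k ℕ.∸ j)

t : ℕ → Frac
t k = sumF (suc k) λ j → sumF (suc (k ℕ.∸ j)) λ i →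
        α j *F α i *F α (k ℕ.∸ j ℕ.∸ i)

u : ℕ → Frac
u k = sumF (suc k) λ j → sumF (suc (k ℕ.∸ j)) λ i →
        sumF (suc (k ℕ.∸ j ℕ.∸ i)) λ h →
          α j *F α i *F α h *F α (k ℕ.∸ j ℕ.∸ i ℕ.∸ h)

E : Frac
E = oneF -F (((oneF -F (xF *F q2)) *F (oneF -F (q2 /F xF)))
             /F (powF (oneF -F qF) 2 *F (oneF +F q2)))

modulus : ℕ → Poly
modulus n = mulP (qint2P n)
  (mulP (subP oneP (mulP xP (powP qP (2 ℕ.* n))))
        (subP xP (powP qP (2 ℕ.* n))))

ratio : ℕ → Frac
ratio m = poch (powF qF 4) q8 m /F poch q8 q8 m

{-# OPTIONS --safe #-}

-- The factors 1 - x q^(2n), x - q^(2n) and Φ_d(q²) (d ∣ n, d > 1) of the modulus are pairwise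
-- coprime, so each may be treated separately; coprimality is used in the form "s is regular
-- modulo g": g ∣ s t implies g ∣ t. Modulo such a factor g one computes in the ring of fractions
-- with denominators regular modulo g. Lowest terms exist because ℤ[q][x] is a GCD domain.
--
-- Write n = 4M + 1, p = q⁸, a = q². If x or 1/x equals q^(2n) = a p^M, the series Σ α(k) stops at
-- k = M and its sum is a two-term case of Watson's transformation. As 4M < n, the truncated r-fold
-- convolutions (r ≤ 4) are the full r-th powers of that sum.
--
-- If q² is a primitive d-th root of unity, d = 4m + 1, then α(ld + k) is a constant (depending on l)
-- times α(k) for k < d, α(k) = 0 for m < k < d, and α(m - k) = -α(k). So a partial sum of α can be
-- nonzero only if its length is 1, …, m modulo d, and one of an r-fold convolution only if its length
-- is 1, …, rm modulo d. As 4m < d ∣ n, all these sums of length n vanish. The right-hand sides vanish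
-- because of [n].

module Submission where

open import Level using (0ℓ)
open import Algebra.Bundles using (CommutativeRing)
open import Data.Bool using (Bool; true; false; _∧_)
open import Data.Empty using (⊥-elim)
open import Data.Fin using (Fin; zero; suc)
open import Data.Integer as ℤ using (ℤ; +_; -[1+_]; 0ℤ; 1ℤ)
import Data.Integer.Divisibility as ℤᵘ
import Data.Integer.Divisibility.Signed as ℤᵈ
import Data.Integer.GCD as ℤᵍ
import Data.Integer.Properties as ℤₚ
open import Data.List using (List; []; _∷_; map; length)
import Data.List.Properties as Listₚ
open import Data.List.Relation.Unary.All using (All; []; _∷_)
open import Data.Nat as ℕ using (ℕ; zero; suc)
import Data.Nat.Divisibility as ℕᵈ
open import Data.Nat.Divisibility using () renaming (_∣_ to _∣ℕ_; _∣?_ to _∣ℕ?_)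
open import Data.Nat.DivMod as DivMod using (_%_; _/_)
import Data.Nat.GCD as GCD
import Data.Nat.Properties as ℕₚ
open import Data.Nat.Solver using (module +-*-Solver)
open import Data.Product using (Σ; ∃; _×_; _,_; proj₁; proj₂)
open import Data.Sum using (_⊎_; inj₁; inj₂; [_,_]′)
open import Data.Vec as Vec using (Vec; []; _∷_; lookup; replicate; zipWith; allFin)
open import Data.Vec.N-ary using (N-ary; curryⁿ; _$ⁿ_; ∀ⁿ)
open import Relation.Nullary using (¬_; Dec; yes; no)
open import Relation.Binary.PropositionalEquality as ≡ using (_≡_)

-- Equations in commutative rings

-- The obstacle lies modulo Φ_d(q²): as written, α(k) has denominators that vanish there as soon as
-- k reaches d, since (q⁸;q⁸)_k then contains 1 - q^(8d). Yet α(k) is integral. In each block of d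
-- indices the numerator acquires (1 - q^(8k+2))² at k = ld + m, before the denominator acquires (1
-- - q^(8k+8))² at k = ld + d - 1, and both are divisible by (1 - q^(2d))². So everything is formed
-- in the field of fractions, and the relation `_~_` records that an element has a representative
-- whose denominator is regular modulo g; the recurrence of the coefficients shows that each of them
-- has one. What remains after dividing by 1 - q^(2d) are sums 1 + u + ... + u^(s-1) with u =
-- q^(2d), congruent to s. Hence positive integers must be regular modulo Φ_d(q²). They are, because
-- it divides 1 - q^(2d), whose constant term is 1. The same fact allows halving when a sum equals
-- its own negative. The way back: if an element vanishes modulo g, then g divides its numerator in
-- every representation, in particular in lowest terms.

module Solver (R : CommutativeRing 0ℓ 0ℓ) where
  open CommutativeRing R
  open import Algebra.Properties.Ring ring
    using (-0#≈0#; -‿distribˡ-*; -‿distribʳ-*; -‿involutive; -‿+-comm; x∙y⁻¹≈ε⇒x≈y)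
  open import Relation.Binary.Reasoning.Setoid setoid

  ι : ℕ → Carrier
  ι zero = 0#
  ι (suc n) = 1# + ι n

  private
    +-interchange : ∀ a b c d → (a + b) + (c + d) ≈ (a + c) + (b + d)
    +-interchange a b c d = begin
      (a + b) + (c + d) ≈⟨ +-assoc a b (c + d) ⟩
      a + (b + (c + d)) ≈⟨ +-congˡ (+-assoc b c d) ⟨
      a + ((b + c) + d) ≈⟨ +-congˡ (+-congʳ (+-comm b c)) ⟩
      a + ((c + b) + d) ≈⟨ +-congˡ (+-assoc c b d) ⟩
      a + (c + (b + d)) ≈⟨ +-assoc a c (b + d) ⟨
      (a + c) + (b + d) ∎

    *-interchange : ∀ a b c d → (a * b) * (c * d) ≈ (a * c) * (b * d)
    *-interchange a b c d = begin
      (a * b) * (c * d) ≈⟨ *-assoc a b (c * d) ⟩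
      a * (b * (c * d)) ≈⟨ *-congˡ (*-assoc b c d) ⟨
      a * ((b * c) * d) ≈⟨ *-congˡ (*-congʳ (*-comm b c)) ⟩
      a * ((c * b) * d) ≈⟨ *-congˡ (*-assoc c b d) ⟩
      a * (c * (b * d)) ≈⟨ *-assoc a c (b * d) ⟨
      (a * c) * (b * d) ∎

  ι-+ : ∀ m n → ι (m ℕ.+ n) ≈ ι m + ι n
  ι-+ zero n = sym (+-identityˡ _)
  ι-+ (suc m) n = trans (+-congˡ (ι-+ m n)) (sym (+-assoc _ _ _))

  ι-* : ∀ m n → ι (m ℕ.* n) ≈ ι m * ι n
  ι-* zero n = sym (zeroˡ _)
  ι-* (suc m) n = begin
    ι (n ℕ.+ m ℕ.* n)      ≈⟨ ι-+ n (m ℕ.* n) ⟩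
    ι n + ι (m ℕ.* n)      ≈⟨ +-cong (sym (*-identityˡ _)) (ι-* m n) ⟩
    1# * ι n + ι m * ι n   ≈⟨ distribʳ _ _ _ ⟨
    (1# + ι m) * ι n ∎

  private
    κ : ℤ → Carrier
    κ (+ n) = ι n
    κ -[1+ n ] = - ι (suc n)

    κ-neg : ∀ i → κ (ℤ.- i) ≈ - κ i
    κ-neg (+ zero) = sym -0#≈0#
    κ-neg (+ suc n) = refl
    κ-neg -[1+ n ] = sym (-‿involutive _)

    κ-⊖ : ∀ m n → κ (m ℤ.⊖ n) ≈ ι m - ι n
    κ-⊖ zero zero = sym (-‿inverseʳ 0#)
    κ-⊖ zero (suc n) = sym (+-identityˡ _)
    κ-⊖ (suc m) zero = sym (trans (+-congˡ -0#≈0#) (+-identityʳ _))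
    κ-⊖ (suc m) (suc n) = begin
      κ (suc m ℤ.⊖ suc n)          ≡⟨ ≡.cong κ (ℤₚ.[1+m]⊖[1+n]≡m⊖n m n) ⟩
      κ (m ℤ.⊖ n)                  ≈⟨ κ-⊖ m n ⟩
      ι m - ι n                    ≈⟨ +-identityˡ _ ⟨
      0# + (ι m - ι n)             ≈⟨ +-congʳ (-‿inverseʳ 1#) ⟨
      (1# - 1#) + (ι m - ι n)      ≈⟨ +-interchange _ _ _ _ ⟩
      (1# + ι m) + (- 1# - ι n)    ≈⟨ +-congˡ (-‿+-comm 1# (ι n)) ⟩
      (1# + ι m) - (1# + ι n) ∎

    κ-+ : ∀ i j → κ (i ℤ.+ j) ≈ κ i + κ j
    κ-+ (+ m) (+ n) = ι-+ m n
    κ-+ (+ m) -[1+ n ] = κ-⊖ m (suc n)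
    κ-+ -[1+ m ] (+ n) = trans (κ-⊖ n (suc m)) (+-comm _ _)
    κ-+ -[1+ m ] -[1+ n ] = begin
      - ι (suc (suc (m ℕ.+ n)))    ≡⟨ ≡.cong (λ z → - ι (suc z)) (ℕₚ.+-suc m n) ⟨
      - ι (suc m ℕ.+ suc n)        ≈⟨ -‿cong (ι-+ (suc m) (suc n)) ⟩
      - (ι (suc m) + ι (suc n))    ≈⟨ -‿+-comm _ _ ⟨
      - ι (suc m) - ι (suc n) ∎

    κ-* : ∀ i j → κ (i ℤ.* j) ≈ κ i * κ j
    κ-* (+ m) (+ n) = trans (reflexive (≡.cong κ (≡.sym (ℤₚ.pos-* m n)))) (ι-* m n)
    κ-* (+ m) -[1+ n ] = begin
      κ (+ m ℤ.* (ℤ.- (+ suc n)))      ≡⟨ ≡.cong κ (ℤₚ.neg-distribʳ-* (+ m) (+ suc n)) ⟨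
      κ (ℤ.- (+ m ℤ.* + suc n))        ≈⟨ κ-neg (+ m ℤ.* + suc n) ⟩
      - κ (+ m ℤ.* + suc n)            ≈⟨ -‿cong (κ-* (+ m) (+ suc n)) ⟩
      - (ι m * ι (suc n))              ≈⟨ -‿distribʳ-* _ _ ⟩
      ι m * - ι (suc n) ∎
    κ-* -[1+ m ] (+ n) = begin
      κ ((ℤ.- (+ suc m)) ℤ.* + n)      ≡⟨ ≡.cong κ (ℤₚ.neg-distribˡ-* (+ suc m) (+ n)) ⟨
      κ (ℤ.- (+ suc m ℤ.* + n))        ≈⟨ κ-neg (+ suc m ℤ.* + n) ⟩
      - κ (+ suc m ℤ.* + n)            ≈⟨ -‿cong (κ-* (+ suc m) (+ n)) ⟩
      - (ι (suc m) * ι n)              ≈⟨ -‿distribˡ-* _ _ ⟩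
      - ι (suc m) * ι n ∎
    κ-* -[1+ m ] -[1+ n ] = begin
      ι (suc m ℕ.* suc n)              ≈⟨ ι-* (suc m) (suc n) ⟩
      ι (suc m) * ι (suc n)            ≈⟨ -‿involutive _ ⟨
      - - (ι (suc m) * ι (suc n))      ≈⟨ -‿cong (-‿distribʳ-* _ _) ⟩
      - (ι (suc m) * - ι (suc n))      ≈⟨ -‿distribˡ-* _ _ ⟩
      - ι (suc m) * - ι (suc n) ∎

    Mono : ℕ → Set
    Mono n = Vec ℕ n

    NF : ℕ → Set
    NF n = List (Mono n × ℤ)

    Env : ℕ → Set
    Env n = Vec Carrier n

    pow : Carrier → ℕ → Carrier
    pow x zero = 1#
    pow x (suc e) = x * pow x e

    pow-+ : ∀ x d e → pow x (d ℕ.+ e) ≈ pow x d * pow x e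
    pow-+ x zero e = sym (*-identityˡ _)
    pow-+ x (suc d) e = trans (*-congˡ (pow-+ x d e)) (sym (*-assoc _ _ _))

    evalM : ∀ {n} → Mono n → Env n → Carrier
    evalM [] [] = 1#
    evalM (e ∷ m) (x ∷ ρ) = pow x e * evalM m ρ

    evalM-* : ∀ {n} (m m′ : Mono n) ρ → evalM (zipWith ℕ._+_ m m′) ρ ≈ evalM m ρ * evalM m′ ρ
    evalM-* [] [] [] = sym (*-identityˡ _)
    evalM-* (d ∷ m) (e ∷ m′) (x ∷ ρ) =
      trans (*-cong (pow-+ x d e) (evalM-* m m′ ρ)) (*-interchange _ _ _ _)

    evalM-1 : ∀ {n} (ρ : Env n) → evalM (replicate n 0) ρ ≈ 1#
    evalM-1 [] = refl
    evalM-1 (x ∷ ρ) = trans (*-identityˡ _) (evalM-1 ρ)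

    unit : ∀ {n} → Fin n → Mono n
    unit {suc n} zero = 1 ∷ replicate n 0
    unit (suc i) = 0 ∷ unit i

    evalM-unit : ∀ {n} (i : Fin n) ρ → evalM (unit i) ρ ≈ lookup ρ i
    evalM-unit zero (x ∷ ρ) = trans (*-cong (*-identityʳ x) (evalM-1 ρ)) (*-identityʳ x)
    evalM-unit (suc i) (x ∷ ρ) = trans (*-identityˡ _) (evalM-unit i ρ)

    eval : ∀ {n} → NF n → Env n → Carrier
    eval [] ρ = 0#
    eval ((m , c) ∷ t) ρ = κ c * evalM m ρ + eval t ρ

    -- Only equality carries evidence: a wrong order could at worst leave like monomials apart, so
    -- that `solve` fails, but could never spoil `eval-insert`.
    data Cmp {n} (m m′ : Mono n) : Set where
      lt gt : Cmp m m′
      eq : m ≡ m′ → Cmp m m′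

    cmp : ∀ {n} (m m′ : Mono n) → Cmp m m′
    cmp [] [] = eq ≡.refl
    cmp (d ∷ m) (e ∷ m′) with d ℕ.≟ e
    ... | no _ with d ℕ.<ᵇ e
    ... | true = lt
    ... | false = gt
    cmp (d ∷ m) (e ∷ m′) | yes ≡.refl with cmp m m′
    ... | lt = lt
    ... | gt = gt
    ... | eq ≡.refl = eq ≡.refl

    insert : ∀ {n} → Mono n → ℤ → NF n → NF n
    insert m c [] = (m , c) ∷ []
    insert m c ((m′ , c′) ∷ t) with cmp m m′
    ... | lt = (m , c) ∷ (m′ , c′) ∷ t
    ... | gt = (m′ , c′) ∷ insert m c t
    ... | eq _ = (m , c ℤ.+ c′) ∷ t

    eval-insert : ∀ {n} (m : Mono n) c t ρ → eval (insert m c t) ρ ≈ κ c * evalM m ρ + eval t ρ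
    eval-insert m c [] ρ = refl
    eval-insert m c ((m′ , c′) ∷ t) ρ with cmp m m′
    ... | lt = refl
    ... | gt = begin
      κ c′ * evalM m′ ρ + eval (insert m c t) ρ          ≈⟨ +-congˡ (eval-insert m c t ρ) ⟩
      κ c′ * evalM m′ ρ + (κ c * evalM m ρ + eval t ρ)   ≈⟨ +-assoc _ _ _ ⟨
      κ c′ * evalM m′ ρ + κ c * evalM m ρ + eval t ρ     ≈⟨ +-congʳ (+-comm _ _) ⟩
      κ c * evalM m ρ + κ c′ * evalM m′ ρ + eval t ρ     ≈⟨ +-assoc _ _ _ ⟩
      κ c * evalM m ρ + (κ c′ * evalM m′ ρ + eval t ρ) ∎
    ... | eq ≡.refl = begin
      κ (c ℤ.+ c′) * evalM m ρ + eval t ρ                ≈⟨ +-congʳ (*-congʳ (κ-+ c c′)) ⟩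
      (κ c + κ c′) * evalM m ρ + eval t ρ                ≈⟨ +-congʳ (distribʳ _ _ _) ⟩
      κ c * evalM m ρ + κ c′ * evalM m ρ + eval t ρ      ≈⟨ +-assoc _ _ _ ⟩
      κ c * evalM m ρ + (κ c′ * evalM m ρ + eval t ρ) ∎

    _⊕_ : ∀ {n} → NF n → NF n → NF n
    [] ⊕ u = u
    ((m , c) ∷ t) ⊕ u = insert m c (t ⊕ u)

    eval-⊕ : ∀ {n} (t u : NF n) ρ → eval (t ⊕ u) ρ ≈ eval t ρ + eval u ρ
    eval-⊕ [] u ρ = sym (+-identityˡ _)
    eval-⊕ ((m , c) ∷ t) u ρ = begin
      eval (insert m c (t ⊕ u)) ρ                        ≈⟨ eval-insert m c (t ⊕ u) ρ ⟩
      κ c * evalM m ρ + eval (t ⊕ u) ρ                   ≈⟨ +-congˡ (eval-⊕ t u ρ) ⟩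
      κ c * evalM m ρ + (eval t ρ + eval u ρ)            ≈⟨ +-assoc _ _ _ ⟨
      κ c * evalM m ρ + eval t ρ + eval u ρ ∎

    scale : ∀ {n} → Mono n → ℤ → NF n → NF n
    scale m c [] = []
    scale m c ((m′ , c′) ∷ t) = (zipWith ℕ._+_ m m′ , c ℤ.* c′) ∷ scale m c t

    eval-scale : ∀ {n} (m : Mono n) c t ρ → eval (scale m c t) ρ ≈ (κ c * evalM m ρ) * eval t ρ
    eval-scale m c [] ρ = sym (zeroʳ _)
    eval-scale m c ((m′ , c′) ∷ t) ρ = begin
      κ (c ℤ.* c′) * evalM (zipWith ℕ._+_ m m′) ρ + eval (scale m c t) ρ
        ≈⟨ +-cong (*-cong (κ-* c c′) (evalM-* m m′ ρ)) (eval-scale m c t ρ) ⟩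
      (κ c * κ c′) * (evalM m ρ * evalM m′ ρ) + (κ c * evalM m ρ) * eval t ρ
        ≈⟨ +-congʳ (*-interchange _ _ _ _) ⟩
      (κ c * evalM m ρ) * (κ c′ * evalM m′ ρ) + (κ c * evalM m ρ) * eval t ρ
        ≈⟨ distribˡ _ _ _ ⟨
      (κ c * evalM m ρ) * (κ c′ * evalM m′ ρ + eval t ρ) ∎

    _⊗_ : ∀ {n} → NF n → NF n → NF n
    [] ⊗ u = []
    ((m , c) ∷ t) ⊗ u = scale m c u ⊕ (t ⊗ u)

    eval-⊗ : ∀ {n} (t u : NF n) ρ → eval (t ⊗ u) ρ ≈ eval t ρ * eval u ρ
    eval-⊗ [] u ρ = sym (zeroˡ _)
    eval-⊗ ((m , c) ∷ t) u ρ = begin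
      eval (scale m c u ⊕ (t ⊗ u)) ρ                     ≈⟨ eval-⊕ (scale m c u) (t ⊗ u) ρ ⟩
      eval (scale m c u) ρ + eval (t ⊗ u) ρ              ≈⟨ +-cong (eval-scale m c u ρ) (eval-⊗ t u ρ) ⟩
      (κ c * evalM m ρ) * eval u ρ + eval t ρ * eval u ρ ≈⟨ distribʳ _ _ _ ⟨
      (κ c * evalM m ρ + eval t ρ) * eval u ρ ∎

    κ1 : κ 1ℤ ≈ 1#
    κ1 = +-identityʳ 1#

    ⊖1 : ∀ {n} → NF n
    ⊖1 {n} = (replicate n 0 , -[1+ 0 ]) ∷ []

    eval-neg : ∀ {n} (t : NF n) ρ → eval (⊖1 ⊗ t) ρ ≈ - eval t ρ
    eval-neg {n} t ρ = begin
      eval (⊖1 ⊗ t) ρ                                ≈⟨ eval-⊗ ⊖1 t ρ ⟩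
      (- κ 1ℤ * evalM (replicate n 0) ρ + 0#) * eval t ρ
        ≈⟨ *-congʳ (trans (+-identityʳ _) (trans (*-cong (-‿cong κ1) (evalM-1 ρ)) (*-identityʳ _))) ⟩
      - 1# * eval t ρ                                ≈⟨ -‿distribˡ-* _ _ ⟨
      - (1# * eval t ρ)                              ≈⟨ -‿cong (*-identityˡ _) ⟩
      - eval t ρ ∎

  infix 8 :-_
  infixl 7 _:*_
  infixl 6 _:+_ _:-_
  infix 4 _:=_

  data Expr (n : ℕ) : Set where
    var : Fin n → Expr n
    :0 :1 : Expr n
    _:+_ _:*_ _:-_ : Expr n → Expr n → Expr n
    :-_ : Expr n → Expr n

  _:=_ : ∀ {n} → Expr n → Expr n → Expr n × Expr n
  _:=_ = _,_

  private
    ⟦_⟧ : ∀ {n} → Expr n → Env n → Carrier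
    ⟦ var i ⟧ ρ = lookup ρ i
    ⟦ :0 ⟧ ρ = 0#
    ⟦ :1 ⟧ ρ = 1#
    ⟦ e :+ f ⟧ ρ = ⟦ e ⟧ ρ + ⟦ f ⟧ ρ
    ⟦ e :* f ⟧ ρ = ⟦ e ⟧ ρ * ⟦ f ⟧ ρ
    ⟦ e :- f ⟧ ρ = ⟦ e ⟧ ρ - ⟦ f ⟧ ρ
    ⟦ :- e ⟧ ρ = - ⟦ e ⟧ ρ

    norm : ∀ {n} → Expr n → NF n
    norm (var i) = (unit i , 1ℤ) ∷ []
    norm :0 = []
    norm {n} :1 = (replicate n 0 , 1ℤ) ∷ []
    norm (e :+ f) = norm e ⊕ norm f
    norm (e :* f) = norm e ⊗ norm f
    norm (e :- f) = norm e ⊕ (⊖1 ⊗ norm f)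
    norm (:- e) = ⊖1 ⊗ norm e

    norm-sound : ∀ {n} (e : Expr n) ρ → eval (norm e) ρ ≈ ⟦ e ⟧ ρ
    norm-sound (var i) ρ =
      trans (+-identityʳ _) (trans (*-cong κ1 (evalM-unit i ρ)) (*-identityˡ _))
    norm-sound :0 ρ = refl
    norm-sound :1 ρ =
      trans (+-identityʳ _) (trans (*-cong κ1 (evalM-1 ρ)) (*-identityˡ _))
    norm-sound (e :+ f) ρ =
      trans (eval-⊕ (norm e) (norm f) ρ) (+-cong (norm-sound e ρ) (norm-sound f ρ))
    norm-sound (e :* f) ρ =
      trans (eval-⊗ (norm e) (norm f) ρ) (*-cong (norm-sound e ρ) (norm-sound f ρ))
    norm-sound (e :- f) ρ =
      trans (eval-⊕ (norm e) (⊖1 ⊗ norm f) ρ)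
        (+-cong (norm-sound e ρ) (trans (eval-neg (norm f) ρ) (-‿cong (norm-sound f ρ))))
    norm-sound (:- e) ρ = trans (eval-neg (norm e) ρ) (-‿cong (norm-sound e ρ))

    isZero : ℤ → Bool
    isZero (+ zero) = true
    isZero _ = false

    allZero : ∀ {n} → NF n → Bool
    allZero [] = true
    allZero ((m , c) ∷ t) = isZero c ∧ allZero t

    allZero-sound : ∀ {n} (t : NF n) ρ → allZero t ≡ true → eval t ρ ≈ 0#
    allZero-sound [] ρ _ = refl
    allZero-sound ((m , + zero) ∷ t) ρ z =
      trans (+-cong (zeroˡ _) (allZero-sound t ρ z)) (+-identityʳ 0#)

    curry∀ : ∀ n (P : Vec Carrier n → Set) → (∀ ρ → P ρ) → ∀ⁿ n (curryⁿ P)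
    curry∀ zero P f = f []
    curry∀ (suc n) P f x = curry∀ n (λ ρ → P (x ∷ ρ)) (λ ρ → f (x ∷ ρ))

    vars : ∀ n → Vec (Expr n) n
    vars n = Vec.map var (allFin n)

  -- Proof by reflection: the equation is discharged by `≡.refl` once the normal form of the
  -- difference has only zero coefficients. Cancelled monomials stay in the list with coefficient
  -- zero, hence `allZero` instead of a comparison with the empty list.
  solve : ∀ n (f : N-ary n (Expr n) (Expr n × Expr n)) →
    let e = f $ⁿ vars n in
    allZero (norm (proj₁ e :- proj₂ e)) ≡ true →
    ∀ⁿ n (curryⁿ λ ρ → ⟦ proj₁ e ⟧ ρ ≈ ⟦ proj₂ e ⟧ ρ)
  solve n f z = curry∀ n _ λ ρ →
    x∙y⁻¹≈ε⇒x≈y _ _ (trans (sym (norm-sound (proj₁ e :- proj₂ e) ρ)) (allZero-sound (norm (proj₁ e :- proj₂ e)) ρ z))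
    where e = f $ⁿ vars n

-- Polynomials over a commutative ring

-- The operations are characterised by their recursion equations, so that one theory applies
-- literally both to `add1`, `mul1` over ℤ and to `addP`, `mulP` over ℤ[q]; there all equations hold
-- by `≡.refl`.
record PolyOps (R : CommutativeRing 0ℓ 0ℓ) : Set where
  open CommutativeRing R hiding (_-_)
  field
    add mul : List Carrier → List Carrier → List Carrier
    add-[]ˡ : ∀ q → add [] q ≡ q
    add-[]ʳ : ∀ a p → add (a ∷ p) [] ≡ a ∷ p
    add-∷ : ∀ a p b q → add (a ∷ p) (b ∷ q) ≡ (a + b) ∷ add p q
    mul-[]ˡ : ∀ q → mul [] q ≡ []
    mul-∷ : ∀ a p q → mul (a ∷ p) q ≡ add (map (a *_) q) (0# ∷ mul p q)

module PolyRing (R : CommutativeRing 0ℓ 0ℓ) (ops : PolyOps R) where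
  open CommutativeRing R hiding (_-_)
  open PolyOps ops
  open Solver R
  open import Algebra.Properties.Ring ring using (-0#≈0#)
  open import Relation.Binary.Reasoning.Setoid setoid

  coeff : List Carrier → ℕ → Carrier
  coeff [] i = 0#
  coeff (a ∷ p) zero = a
  coeff (a ∷ p) (suc i) = coeff p i

  infix 4 _≋_
  -- Trailing zeros must not matter, so lists are compared through their coefficients. Being a
  -- record, the relation lets `p` and `q` be inferred from the type of an equation.
  record _≋_ (p q : List Carrier) : Set where
    constructor mk≋
    field at : ∀ i → coeff p i ≈ coeff q i
  open _≋_ public

  neg : List Carrier → List Carrier
  neg = map (λ a → - a)

  infixr 7 _·_
  _·_ : Carrier → List Carrier → List Carrier
  a · p = map (a *_) p

  ≋-refl : ∀ {p} → p ≋ p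
  ≋-refl = mk≋ λ _ → refl

  ≋-sym : ∀ {p q} → p ≋ q → q ≋ p
  ≋-sym e = mk≋ λ i → sym (at e i)

  ≋-trans : ∀ {p q r} → p ≋ q → q ≋ r → p ≋ r
  ≋-trans e f = mk≋ λ i → trans (at e i) (at f i)

  ≡⇒≋ : ∀ {p q} → p ≡ q → p ≋ q
  ≡⇒≋ ≡.refl = ≋-refl

  coeff-add : ∀ p q i → coeff (add p q) i ≈ coeff p i + coeff q i
  coeff-add [] q i rewrite add-[]ˡ q = sym (+-identityˡ _)
  coeff-add (a ∷ p) [] i rewrite add-[]ʳ a p = sym (+-identityʳ _)
  coeff-add (a ∷ p) (b ∷ q) i rewrite add-∷ a p b q with i
  ... | zero = refl
  ... | suc j = coeff-add p q j

  coeff-· : ∀ a p i → coeff (a · p) i ≈ a * coeff p i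
  coeff-· a [] i = sym (zeroʳ a)
  coeff-· a (b ∷ p) zero = refl
  coeff-· a (b ∷ p) (suc i) = coeff-· a p i

  coeff-neg : ∀ p i → coeff (neg p) i ≈ - coeff p i
  coeff-neg [] i = sym -0#≈0#
  coeff-neg (b ∷ p) zero = refl
  coeff-neg (b ∷ p) (suc i) = coeff-neg p i

  ∷-cong : ∀ {a b p q} → a ≈ b → p ≋ q → (a ∷ p) ≋ (b ∷ q)
  ∷-cong e f = mk≋ λ { zero → e ; (suc i) → at f i }

  0∷[] : 0# ∷ [] ≋ []
  0∷[] = mk≋ λ { zero → refl ; (suc i) → refl }

  add-cong : ∀ {p p′ q q′} → p ≋ p′ → q ≋ q′ → add p q ≋ add p′ q′
  add-cong {p} {p′} {q} {q′} e f = mk≋ λ i →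
    trans (coeff-add p q i) (trans (+-cong (at e i) (at f i)) (sym (coeff-add p′ q′ i)))

  add-assoc : ∀ p q r → add (add p q) r ≋ add p (add q r)
  add-assoc p q r = mk≋ λ i → begin
    coeff (add (add p q) r) i              ≈⟨ coeff-add (add p q) r i ⟩
    coeff (add p q) i + coeff r i          ≈⟨ +-congʳ (coeff-add p q i) ⟩
    coeff p i + coeff q i + coeff r i      ≈⟨ +-assoc _ _ _ ⟩
    coeff p i + (coeff q i + coeff r i)    ≈⟨ +-congˡ (coeff-add q r i) ⟨
    coeff p i + coeff (add q r) i          ≈⟨ coeff-add p (add q r) i ⟨
    coeff (add p (add q r)) i ∎

  add-comm : ∀ p q → add p q ≋ add q p
  add-comm p q = mk≋ λ i →
    trans (coeff-add p q i) (trans (+-comm _ _) (sym (coeff-add q p i)))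

  add-idˡ : ∀ p → add [] p ≋ p
  add-idˡ p = ≡⇒≋ (add-[]ˡ p)

  add-idʳ : ∀ p → add p [] ≋ p
  add-idʳ p = ≋-trans (add-comm p []) (add-idˡ p)

  neg-cong : ∀ {p q} → p ≋ q → neg p ≋ neg q
  neg-cong {p} {q} e = mk≋ λ i →
    trans (coeff-neg p i) (trans (-‿cong (at e i)) (sym (coeff-neg q i)))

  add-negʳ : ∀ p → add p (neg p) ≋ []
  add-negʳ p = mk≋ λ i →
    trans (coeff-add p (neg p) i) (trans (+-congˡ (coeff-neg p i)) (-‿inverseʳ _))

  add-negˡ : ∀ p → add (neg p) p ≋ []
  add-negˡ p = ≋-trans (add-comm (neg p) p) (add-negʳ p)

  ·-cong : ∀ {a b p q} → a ≈ b → p ≋ q → a · p ≋ b · q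
  ·-cong {a} {b} {p} {q} e f = mk≋ λ i →
    trans (coeff-· a p i) (trans (*-cong e (at f i)) (sym (coeff-· b q i)))

  ·-add : ∀ a p q → a · add p q ≋ add (a · p) (a · q)
  ·-add a p q = mk≋ λ i → begin
    coeff (a · add p q) i                  ≈⟨ coeff-· a (add p q) i ⟩
    a * coeff (add p q) i                  ≈⟨ *-congˡ (coeff-add p q i) ⟩
    a * (coeff p i + coeff q i)            ≈⟨ distribˡ _ _ _ ⟩
    a * coeff p i + a * coeff q i          ≈⟨ +-cong (coeff-· a p i) (coeff-· a q i) ⟨
    coeff (a · p) i + coeff (a · q) i      ≈⟨ coeff-add (a · p) (a · q) i ⟨
    coeff (add (a · p) (a · q)) i ∎

  ·-· : ∀ a b p → a · b · p ≋ (a * b) · p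
  ·-· a b p = mk≋ λ i → begin
    coeff (a · b · p) i        ≈⟨ coeff-· a (b · p) i ⟩
    a * coeff (b · p) i        ≈⟨ *-congˡ (coeff-· b p i) ⟩
    a * (b * coeff p i)        ≈⟨ *-assoc _ _ _ ⟨
    a * b * coeff p i          ≈⟨ coeff-· (a * b) p i ⟨
    coeff ((a * b) · p) i ∎

  0· : ∀ p → 0# · p ≋ []
  0· p = mk≋ λ i → trans (coeff-· 0# p i) (zeroˡ _)

  1· : ∀ p → 1# · p ≋ p
  1· p = mk≋ λ i → trans (coeff-· 1# p i) (*-identityˡ _)

  mul-∷ˡ : ∀ a p q → mul (a ∷ p) q ≋ add (a · q) (0# ∷ mul p q)
  mul-∷ˡ a p q = ≡⇒≋ (mul-∷ a p q)

  coeff-mul-0 : ∀ a p b q → coeff (mul (a ∷ p) (b ∷ q)) 0 ≈ a * b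
  coeff-mul-0 a p b q =
    trans (at (mul-∷ˡ a p (b ∷ q)) 0) (trans (coeff-add (a · (b ∷ q)) _ 0) (+-identityʳ _))

  mul-[]ʳ : ∀ p → mul p [] ≋ []
  mul-[]ʳ [] = ≡⇒≋ (mul-[]ˡ [])
  mul-[]ʳ (a ∷ p) = ≋-trans (mul-∷ˡ a p [])
    (≋-trans (add-idˡ _) (≋-trans (∷-cong refl (mul-[]ʳ p)) 0∷[]))

  -- The mirror image of the recursion `mul-∷`; commutativity, and with it congruence in the left
  -- factor, rest on it.
  mul-∷ʳ : ∀ p b q → mul p (b ∷ q) ≋ add (b · p) (0# ∷ mul p q)
  mul-∷ʳ [] b q = ≋-trans (≡⇒≋ (mul-[]ˡ _)) (≋-sym (≋-trans (add-idˡ _)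
    (≋-trans (∷-cong refl (≡⇒≋ (mul-[]ˡ q))) 0∷[])))
  mul-∷ʳ (a ∷ p) b q = ≋-trans (mul-∷ˡ a p (b ∷ q)) (mk≋ eq)
    where
    eq : ∀ i → coeff (add (a · (b ∷ q)) (0# ∷ mul p (b ∷ q))) i
             ≈ coeff (add (b · (a ∷ p)) (0# ∷ mul (a ∷ p) q)) i
    eq zero = begin
      coeff (add (a · (b ∷ q)) (0# ∷ mul p (b ∷ q))) 0 ≈⟨ coeff-add (a · (b ∷ q)) _ 0 ⟩
      a * b + 0#                                       ≈⟨ +-congʳ (*-comm a b) ⟩
      b * a + 0#                                       ≈⟨ coeff-add (b · (a ∷ p)) _ 0 ⟨
      coeff (add (b · (a ∷ p)) (0# ∷ mul (a ∷ p) q)) 0 ∎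
    eq (suc i) = begin
      coeff (add (a · (b ∷ q)) (0# ∷ mul p (b ∷ q))) (suc i)
        ≈⟨ coeff-add (a · (b ∷ q)) _ (suc i) ⟩
      coeff (a · q) i + coeff (mul p (b ∷ q)) i
        ≈⟨ +-congˡ (trans (at (mul-∷ʳ p b q) i) (coeff-add (b · p) _ i)) ⟩
      coeff (a · q) i + (coeff (b · p) i + coeff (0# ∷ mul p q) i)
        ≈⟨ solve 3 (λ u v w → u :+ (v :+ w) := v :+ (u :+ w)) ≡.refl _ _ _ ⟩
      coeff (b · p) i + (coeff (a · q) i + coeff (0# ∷ mul p q) i)
        ≈⟨ +-congˡ (trans (at (mul-∷ˡ a p q) i) (coeff-add (a · q) _ i)) ⟨
      coeff (b · p) i + coeff (mul (a ∷ p) q) i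
        ≈⟨ coeff-add (b · (a ∷ p)) _ (suc i) ⟨
      coeff (add (b · (a ∷ p)) (0# ∷ mul (a ∷ p) q)) (suc i) ∎

  mul-comm : ∀ p q → mul p q ≋ mul q p
  mul-comm [] q = ≋-trans (≡⇒≋ (mul-[]ˡ q)) (≋-sym (mul-[]ʳ q))
  mul-comm (a ∷ p) q = ≋-trans (mul-∷ˡ a p q)
    (≋-trans (add-cong ≋-refl (∷-cong refl (mul-comm p q))) (≋-sym (mul-∷ʳ q a p)))

  mul-congˡ : ∀ p {q q′} → q ≋ q′ → mul p q ≋ mul p q′
  mul-congˡ [] e = ≡⇒≋ (≡.trans (mul-[]ˡ _) (≡.sym (mul-[]ˡ _)))
  mul-congˡ (a ∷ p) e = ≋-trans (mul-∷ˡ a p _)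
    (≋-trans (add-cong (·-cong refl e) (∷-cong refl (mul-congˡ p e))) (≋-sym (mul-∷ˡ a p _)))

  mul-cong : ∀ {p p′ q q′} → p ≋ p′ → q ≋ q′ → mul p q ≋ mul p′ q′
  mul-cong {p} {p′} {q} {q′} e f = ≋-trans (mul-congˡ p f)
    (≋-trans (mul-comm p q′) (≋-trans (mul-congˡ q′ e) (mul-comm q′ p′)))

  add-interchange : ∀ p q r s → add (add p q) (add r s) ≋ add (add p r) (add q s)
  add-interchange p q r s = mk≋ λ i → begin
    coeff (add (add p q) (add r s)) i
      ≈⟨ trans (coeff-add (add p q) _ i) (+-cong (coeff-add p q i) (coeff-add r s i)) ⟩
    (coeff p i + coeff q i) + (coeff r i + coeff s i)
      ≈⟨ solve 4 (λ a b c d → (a :+ b) :+ (c :+ d) := (a :+ c) :+ (b :+ d)) ≡.refl _ _ _ _ ⟩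
    (coeff p i + coeff r i) + (coeff q i + coeff s i)
      ≈⟨ trans (coeff-add (add p r) _ i) (+-cong (coeff-add p r i) (coeff-add q s i)) ⟨
    coeff (add (add p r) (add q s)) i ∎

  add-shift : ∀ p q → add (0# ∷ p) (0# ∷ q) ≋ 0# ∷ add p q
  add-shift p q = ≋-trans (≡⇒≋ (add-∷ 0# p 0# q)) (∷-cong (+-identityʳ 0#) ≋-refl)

  mul-distribˡ : ∀ p q r → mul p (add q r) ≋ add (mul p q) (mul p r)
  mul-distribˡ [] q r = ≋-trans (≡⇒≋ (mul-[]ˡ _)) (≋-sym
    (≋-trans (add-cong (≡⇒≋ (mul-[]ˡ q)) (≡⇒≋ (mul-[]ˡ r))) (add-idˡ [])))
  mul-distribˡ (a ∷ p) q r =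
    ≋-trans (mul-∷ˡ a p (add q r))
    (≋-trans (add-cong (·-add a q r)
                (≋-trans (∷-cong refl (mul-distribˡ p q r)) (≋-sym (add-shift _ _))))
    (≋-trans (add-interchange (a · q) (a · r) _ _)
      (≋-sym (add-cong (mul-∷ˡ a p q) (mul-∷ˡ a p r)))))

  mul-distribʳ : ∀ p q r → mul (add q r) p ≋ add (mul q p) (mul r p)
  mul-distribʳ p q r = ≋-trans (mul-comm _ p)
    (≋-trans (mul-distribˡ p q r) (add-cong (mul-comm p q) (mul-comm p r)))

  mul-0∷ : ∀ p q → mul (0# ∷ p) q ≋ 0# ∷ mul p q
  mul-0∷ p q = ≋-trans (mul-∷ˡ 0# p q) (≋-trans (add-cong (0· q) ≋-refl) (add-idˡ _))

  mul-const : ∀ a q → mul (a ∷ []) q ≋ a · q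
  mul-const a q = ≋-trans (mul-∷ˡ a [] q)
    (≋-trans (add-cong ≋-refl (≋-trans (∷-cong refl (≡⇒≋ (mul-[]ˡ q))) 0∷[])) (add-idʳ _))

  mul-· : ∀ a p q → mul (a · p) q ≋ a · mul p q
  mul-· a [] q = ≋-trans (≡⇒≋ (mul-[]ˡ q)) (·-cong refl (≋-sym (≡⇒≋ (mul-[]ˡ q))))
  mul-· a (b ∷ p) q =
    ≋-trans (mul-∷ˡ (a * b) (a · p) q)
    (≋-trans (add-cong (≋-sym (·-· a b q)) (∷-cong (sym (zeroʳ a)) (mul-· a p q)))
    (≋-trans (≋-sym (·-add a (b · q) _)) (·-cong refl (≋-sym (mul-∷ˡ b p q)))))

  mul-assoc : ∀ p q r → mul (mul p q) r ≋ mul p (mul q r)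
  mul-assoc [] q r = ≋-trans (mul-cong (≡⇒≋ (mul-[]ˡ q)) ≋-refl)
    (≡⇒≋ (≡.trans (mul-[]ˡ r) (≡.sym (mul-[]ˡ _))))
  mul-assoc (a ∷ p) q r =
    ≋-trans (mul-cong (mul-∷ˡ a p q) ≋-refl)
    (≋-trans (mul-distribʳ r (a · q) _)
    (≋-trans (add-cong (mul-· a q r) (≋-trans (mul-0∷ _ r) (∷-cong refl (mul-assoc p q r))))
      (≋-sym (mul-∷ˡ a p (mul q r)))))

  mul-idˡ : ∀ p → mul (1# ∷ []) p ≋ p
  mul-idˡ p = ≋-trans (mul-const 1# p) (1· p)

  polyRing : CommutativeRing 0ℓ 0ℓ
  polyRing = record
    { Carrier = List Carrier
    ; _≈_ = _≋_
    ; _+_ = add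
    ; _*_ = mul
    ; -_ = neg
    ; 0# = []
    ; 1# = 1# ∷ []
    ; isCommutativeRing = record
      { isRing = record
        { +-isAbelianGroup = record
          { isGroup = record
            { isMonoid = record
              { isSemigroup = record
                { isMagma = record
                  { isEquivalence = record { refl = ≋-refl ; sym = ≋-sym ; trans = ≋-trans }
                  ; ∙-cong = add-cong }
                ; assoc = add-assoc }
              ; identity = add-idˡ , add-idʳ }
            ; inverse = add-negˡ , add-negʳ
            ; ⁻¹-cong = neg-cong }
          ; comm = add-comm }
        ; *-cong = mul-cong
        ; *-assoc = mul-assoc
        ; *-identity = mul-idˡ , λ p → ≋-trans (mul-comm p _) (mul-idˡ p)
        ; distrib = mul-distribˡ , mul-distribʳ }
      ; *-comm = mul-comm }
    }

-- Greatest common divisors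

module Divisibility (R : CommutativeRing 0ℓ 0ℓ) where
  open CommutativeRing R
  open Solver R

  infix 4 _∣_
  record _∣_ (d a : Carrier) : Set where
    constructor div
    field
      quot : Carrier
      eq : quot * d ≈ a

  ∣-refl : ∀ {a} → a ∣ a
  ∣-refl = div 1# (*-identityˡ _)

  ∣-trans : ∀ {a b c} → a ∣ b → b ∣ c → a ∣ c
  ∣-trans (div u e) (div v f) =
    div (v * u) (trans (*-assoc _ _ _) (trans (*-congˡ e) f))

  ∣-resp : ∀ {d a b} → a ≈ b → d ∣ a → d ∣ b
  ∣-resp e (div u f) = div u (trans f e)

  ∣-respˡ : ∀ {d d′ a} → d ≈ d′ → d ∣ a → d′ ∣ a
  ∣-respˡ e (div u f) = div u (trans (*-congˡ (sym e)) f)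

  ∣0 : ∀ {d} → d ∣ 0#
  ∣0 = div 0# (zeroˡ _)

  1∣ : ∀ {a} → 1# ∣ a
  1∣ = div _ (*-identityʳ _)

  ∣-+ : ∀ {d a b} → d ∣ a → d ∣ b → d ∣ a + b
  ∣-+ (div u e) (div v f) = div (u + v) (trans (distribʳ _ _ _) (+-cong e f))

  ∣-neg : ∀ {d a} → d ∣ a → d ∣ - a
  ∣-neg {d} (div u e) =
    div (- u) (trans (solve 2 (λ u d → :- u :* d := :- (u :* d)) ≡.refl u d) (-‿cong e))

  ∣-- : ∀ {d a b} → d ∣ a → d ∣ b → d ∣ a - b
  ∣-- p q = ∣-+ p (∣-neg q)

  ∣-*ˡ : ∀ {d a} c → d ∣ a → d ∣ c * a
  ∣-*ˡ c (div u e) = div (c * u) (trans (*-assoc _ _ _) (*-congˡ e))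

  ∣-*ʳ : ∀ {d a} c → d ∣ a → d ∣ a * c
  ∣-*ʳ c p = ∣-resp (*-comm _ _) (∣-*ˡ c p)

  ∣-*-mono : ∀ {a b c d} → a ∣ b → c ∣ d → a * c ∣ b * d
  ∣-*-mono {a} {b} {c} {d} (div u e) (div v f) = div (u * v)
    (trans (solve 4 (λ u v a c → (u :* v) :* (a :* c) := (u :* a) :* (v :* c)) ≡.refl u v a c)
      (*-cong e f))

  Reg : Carrier → Carrier → Set
  Reg g s = ∀ t → g ∣ s * t → g ∣ t

  reg-1 : ∀ {g} → Reg g 1#
  reg-1 t = ∣-resp (*-identityˡ t)

  reg-* : ∀ {g s s′} → Reg g s → Reg g s′ → Reg g (s * s′)
  reg-* r r′ t p = r′ t (r _ (∣-resp (*-assoc _ _ _) p))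

  reg-∣ : ∀ {g s s′} → s ∣ s′ → Reg g s′ → Reg g s
  reg-∣ {g} {s} {s′} (div u e) r t p =
    r t (∣-resp (trans (sym (*-assoc _ _ _)) (*-congʳ e)) (∣-*ˡ u p))

  reg-mod : ∀ {g s s′} → g ∣ s - s′ → Reg g s′ → Reg g s
  reg-mod {g} {s} {s′} d r t p = r t (∣-resp
    (solve 3 (λ s s′ t → s :* t :- (s :- s′) :* t := s′ :* t) ≡.refl s s′ t)
    (∣-- p (∣-*ʳ t d)))

  reg-resp : ∀ {g s s′} → s ≈ s′ → Reg g s → Reg g s′
  reg-resp e r t p = r t (∣-resp (*-congʳ (sym e)) p)

  reg-respˡ : ∀ {g g′ s} → g ≈ g′ → Reg g s → Reg g′ s
  reg-respˡ e r t p = ∣-respˡ e (r t (∣-respˡ (sym e) p))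

record IsDomain (R : CommutativeRing 0ℓ 0ℓ) : Set where
  open CommutativeRing R
  field
    zero? : ∀ a → Dec (a ≈ 0#)
    1≉0 : ¬ 1# ≈ 0#
    integral : ∀ a b → a * b ≈ 0# → ¬ a ≈ 0# → b ≈ 0#

module DomainProperties (R : CommutativeRing 0ℓ 0ℓ) (dom : IsDomain R) where
  open CommutativeRing R
  open IsDomain dom public
  open Solver R
  open Divisibility R
  open import Algebra.Properties.Ring ring using (x∙y⁻¹≈ε⇒x≈y)

  *-cancelˡ : ∀ c {a b} → ¬ c ≈ 0# → c * a ≈ c * b → a ≈ b
  *-cancelˡ c {a} {b} nz e = x∙y⁻¹≈ε⇒x≈y a b (integral c (a - b)
    (trans (solve 3 (λ c a b → c :* (a :- b) := c :* a :- c :* b) ≡.refl c a b)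
      (trans (+-congʳ e) (-‿inverseʳ _))) nz)

  *-nonzero : ∀ {a b} → ¬ a ≈ 0# → ¬ b ≈ 0# → ¬ a * b ≈ 0#
  *-nonzero na nb e = nb (integral _ _ e na)

  ∣-cancelˡ : ∀ c {a b} → ¬ c ≈ 0# → c * a ∣ c * b → a ∣ b
  ∣-cancelˡ c {a} nz (div u e) = div u (*-cancelˡ c nz
    (trans (solve 3 (λ c u a → c :* (u :* a) := u :* (c :* a)) ≡.refl c u a) e))

  ∣-nonzero : ∀ {a b} → a ∣ b → ¬ b ≈ 0# → ¬ a ≈ 0#
  ∣-nonzero (div u e) nb z = nb (trans (sym e) (trans (*-congˡ z) (zeroʳ u)))

  -- From `w * s ≈ g * t` regularity gives `w ≈ v * g`, and cancelling `g` leaves `v * s ≈ t`.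
  reg-sym : ∀ {g s} → ¬ g ≈ 0# → Reg g s → Reg s g
  reg-sym {g} {s} nz r t (div w e) with r w (div t (trans (*-comm _ _) (trans (sym e) (*-comm _ _))))
  ... | div v f = div v (*-cancelˡ g nz
    (trans (solve 3 (λ g v s → g :* (v :* s) := (v :* g) :* s) ≡.refl g v s)
      (trans (*-congʳ f) e)))

  reg-0 : ∀ {s} → ¬ s ≈ 0# → Reg 0# s
  reg-0 nz t (div w e) = div 0# (trans (zeroˡ _)
    (sym (integral _ _ (trans (sym e) (zeroʳ w)) nz)))

record HasGCD (R : CommutativeRing 0ℓ 0ℓ) : Set where
  open CommutativeRing R
  open Divisibility R
  field
    gcd : Carrier → Carrier → Carrier
    gcd-∣ˡ : ∀ a b → gcd a b ∣ a
    gcd-∣ʳ : ∀ a b → gcd a b ∣ b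
    gcd-greatest : ∀ {a b d} → d ∣ a → d ∣ b → d ∣ gcd a b

module GCDProperties (R : CommutativeRing 0ℓ 0ℓ) (dom : IsDomain R) (hasGCD : HasGCD R) where
  open CommutativeRing R
  open DomainProperties R dom
  open HasGCD hasGCD public
  open Solver R
  open Divisibility R

  -- The gcd of `c * a` and `c * b` is a multiple `c * k` of `c`; after cancelling `c`, the cofactor
  -- `k` divides `a` and `b`, hence their gcd.
  gcd-*ˡ : ∀ c {a b d} → d ∣ c * a → d ∣ c * b → d ∣ c * gcd a b
  gcd-*ˡ c {a} {b} p q with zero? c
  ... | yes z = ∣-resp (trans (sym (zeroˡ _)) (*-congʳ (sym z))) ∣0
  ... | no nz with gcd-greatest {c * a} {c * b} {c} (∣-*ʳ a ∣-refl) (∣-*ʳ b ∣-refl)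
  ... | div k e = ∣-trans (gcd-greatest p q) (∣-respˡ ck≈h (∣-*-mono ∣-refl
          (gcd-greatest (below (gcd-∣ˡ (c * a) (c * b))) (below (gcd-∣ʳ (c * a) (c * b))))))
    where
    ck≈h : c * k ≈ gcd (c * a) (c * b)
    ck≈h = trans (*-comm c k) e
    below : ∀ {z} → gcd (c * a) (c * b) ∣ c * z → k ∣ z
    below p = ∣-cancelˡ c nz (∣-respˡ (sym ck≈h) p)

  -- Since `d` divides `b * a` and `b * d`, it divides `b * gcd a d`.
  euclid : ∀ {d a b} → d ∣ a * b → gcd a d ∣ 1# → d ∣ b
  euclid {d} {a} {b} p u =
    ∣-trans (gcd-*ˡ b (∣-resp (*-comm a b) p) (∣-*ˡ b ∣-refl))
      (∣-resp (*-identityʳ b) (∣-*-mono ∣-refl u))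

  -- A common divisor `d` of the two cofactors makes `g * d` a common divisor of `a` and `b`, so
  -- `g * d` divides `g`, and `g` cancels because `b` is nonzero.
  lowest-terms : ∀ a b → ¬ b ≈ 0# →
    Σ Carrier λ a′ → Σ Carrier λ b′ →
      a * b′ ≈ a′ * b × ¬ b′ ≈ 0# × (∀ d → d ∣ a′ → d ∣ b′ → d ∣ 1#)
  lowest-terms a b nz with gcd-∣ˡ a b | gcd-∣ʳ a b
  ... | div a′ ea | div b′ eb = a′ , b′
      , trans (*-congʳ (sym ea))
          (trans (solve 3 (λ a′ g b′ → a′ :* g :* b′ := a′ :* (b′ :* g)) ≡.refl a′ g b′) (*-congˡ eb))
      , (λ z → nz (trans (sym eb) (trans (*-congʳ z) (zeroˡ g))))
      , λ d p q → ∣-cancelˡ g (∣-nonzero (gcd-∣ʳ a b) nz)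
          (∣-resp (sym (*-identityʳ g)) (gcd-greatest (under ea p) (under eb q)))
    where
    g = gcd a b
    under : ∀ {c c′ d} → c′ * g ≈ c → d ∣ c′ → g * d ∣ c
    under {c} {c′} {d} e (div u f) = div u
      (trans (solve 3 (λ u g d → u :* (g :* d) := (u :* d) :* g) ≡.refl u g d)
        (trans (*-congʳ f) e))

module PolyDomain (R : CommutativeRing 0ℓ 0ℓ) (ops : PolyOps R) (dom : IsDomain R) where
  open CommutativeRing R
  open PolyOps ops
  open PolyRing R ops
  open DomainProperties R dom
  open Divisibility R
  module P = Divisibility polyRing

  infix 4 _∣ᶜ_
  _∣ᶜ_ : Carrier → List Carrier → Set
  e ∣ᶜ p = ∀ i → e ∣ coeff p i

  ∣ᶜ-resp : ∀ {e p q} → p ≋ q → e ∣ᶜ p → e ∣ᶜ q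
  ∣ᶜ-resp f d i = ∣-resp (at f i) (d i)

  ∣ᶜ-[] : ∀ {e} → e ∣ᶜ []
  ∣ᶜ-[] i = ∣0

  ∣ᶜ-∷ : ∀ {e a p} → e ∣ a → e ∣ᶜ p → e ∣ᶜ (a ∷ p)
  ∣ᶜ-∷ d f zero = d
  ∣ᶜ-∷ d f (suc i) = f i

  ∣ᶜ-·ˡ : ∀ {e} a p → e ∣ a → e ∣ᶜ (a · p)
  ∣ᶜ-·ˡ a p d i = ∣-resp (sym (coeff-· a p i)) (∣-*ʳ _ d)

  ∣ᶜ⇒∃ : ∀ {e} p → e ∣ᶜ p → ∃ λ q → p ≋ e · q
  ∣ᶜ⇒∃ [] d = [] , ≋-refl
  ∣ᶜ⇒∃ (a ∷ p) d with ∣ᶜ⇒∃ p (λ i → d (suc i)) | d 0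
  ... | q , f | div u g = u ∷ q , ∷-cong (trans (sym g) (*-comm _ _)) f

  const∣⇒∣ᶜ : ∀ {e p} → (e ∷ []) P.∣ p → e ∣ᶜ p
  const∣⇒∣ᶜ {e} (P.div u f) = ∣ᶜ-resp
    (≋-trans (≋-sym (mul-const e u)) (≋-trans (mul-comm _ u) f)) (∣ᶜ-·ˡ e u ∣-refl)

  ∣ᶜ⇒const∣ : ∀ {e p} → e ∣ᶜ p → (e ∷ []) P.∣ p
  ∣ᶜ⇒const∣ {e} {p} d with ∣ᶜ⇒∃ p d
  ... | q , f = P.div q (≋-trans (mul-comm q _) (≋-trans (mul-const e q) (≋-sym f)))

  ∣ᶜ-mulʳ : ∀ {e} p q → e ∣ᶜ q → e ∣ᶜ mul p q
  ∣ᶜ-mulʳ p q d = const∣⇒∣ᶜ (P.∣-*ˡ p (∣ᶜ⇒const∣ d))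

  -- The lowest coefficient alone decides: peel the coefficients of t off from the bottom.
  reg-∣ᶜ : ∀ {e} a s → Reg e a → ∀ t → e ∣ᶜ mul (a ∷ s) t → e ∣ᶜ t
  reg-∣ᶜ a s r [] d = ∣ᶜ-[]
  reg-∣ᶜ {e} a s r (b ∷ t) d = ∣ᶜ-∷ e∣b (reg-∣ᶜ a s r t e∣rest)
    where
    e∣b : e ∣ b
    e∣b = r b (∣-resp (coeff-mul-0 a s b t) (d 0))
    open Solver R
    e∣rest : ∀ i → e ∣ coeff (mul (a ∷ s) t) i
    e∣rest i = ∣-resp
      (trans (+-congʳ (trans (at (mul-∷ʳ (a ∷ s) b t) (suc i)) (coeff-add (b · (a ∷ s)) _ (suc i))))
        (solve 2 (λ u v → (u :+ v) :- u := v) ≡.refl _ _))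
      (∣-- (d (suc i)) (∣ᶜ-·ˡ b (a ∷ s) e∣b (suc i)))

  reg-const : ∀ {e} a s → Reg e a → P.Reg (e ∷ []) (a ∷ s)
  reg-const a s r t d = ∣ᶜ⇒const∣ (reg-∣ᶜ a s r t (const∣⇒∣ᶜ d))

  ≋[]? : ∀ p → Dec (p ≋ [])
  ≋[]? [] = yes ≋-refl
  ≋[]? (a ∷ p) with zero? a | ≋[]? p
  ... | yes z | yes f = yes (≋-trans (∷-cong z f) 0∷[])
  ... | no nz | _ = no λ f → nz (at f 0)
  ... | yes _ | no nf = no λ f → nf (mk≋ λ i → at f (suc i))

  0∷-injective : ∀ {p q} → (0# ∷ p) ≋ (0# ∷ q) → p ≋ q
  0∷-injective f = mk≋ λ i → at f (suc i)

  -- To be divisible by 0 is to be 0. So for a nonzero lowest coefficient this is `reg-∣ᶜ` at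
  -- `e = 0`; a vanishing one is shifted away.
  poly-integral : ∀ p q → mul p q ≋ [] → ¬ p ≋ [] → q ≋ []
  poly-integral [] q f np = ⊥-elim (np ≋-refl)
  poly-integral (a ∷ p) q f np with zero? a
  ... | yes z = poly-integral p q
          (0∷-injective (≋-trans (≋-sym (≋-trans (mul-cong (∷-cong z ≋-refl) ≋-refl) (mul-0∷ p q)))
            (≋-trans f (≋-sym 0∷[]))))
          (λ g → np (≋-trans (∷-cong z g) 0∷[]))
  ... | no nz = mk≋ λ i → 0∣⇒≈0 (reg-∣ᶜ a p (reg-0 nz) q
          (λ j → ∣-resp (sym (at f j)) ∣0) i)
    where
    0∣⇒≈0 : ∀ {b} → 0# ∣ b → b ≈ 0#
    0∣⇒≈0 (div u g) = trans (sym g) (zeroʳ u)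

  polyDomain : IsDomain polyRing
  polyDomain = record
    { zero? = ≋[]?
    ; 1≉0 = λ f → 1≉0 (at f 0)
    ; integral = poly-integral }

-- Contents, Gauss's lemma and gcds of polynomials

module PolyGCD (R : CommutativeRing 0ℓ 0ℓ) (ops : PolyOps R) (dom : IsDomain R) (hasGCD : HasGCD R) where
  open CommutativeRing R hiding (_-_)
  open PolyOps ops
  open PolyRing R ops
  open DomainProperties R dom
  open GCDProperties R dom hasGCD
  open Divisibility R
  open PolyDomain R ops dom
  open Solver R
  private module PD = DomainProperties polyRing polyDomain

  cont : List Carrier → Carrier
  cont [] = 0#
  cont (a ∷ p) = gcd a (cont p)

  cont-∣ᶜ : ∀ p → cont p ∣ᶜ p
  cont-∣ᶜ [] = ∣ᶜ-[]
  cont-∣ᶜ (a ∷ p) = ∣ᶜ-∷ (gcd-∣ˡ a _) λ i → ∣-trans (gcd-∣ʳ a _) (cont-∣ᶜ p i)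

  cont-greatest : ∀ {e} p → e ∣ᶜ p → e ∣ cont p
  cont-greatest [] d = ∣0
  cont-greatest (a ∷ p) d = gcd-greatest (d 0) (cont-greatest p λ i → d (suc i))

  ∣cont⇒∣ᶜ : ∀ {e} p → e ∣ cont p → e ∣ᶜ p
  ∣cont⇒∣ᶜ p d i = ∣-trans d (cont-∣ᶜ p i)

  cont-· : ∀ {e} c p → e ∣ᶜ (c · p) → e ∣ c * cont p
  cont-· c [] d = ∣-*ˡ c ∣0
  cont-· c (a ∷ p) d = gcd-*ˡ c (d 0) (cont-· c p λ i → d (suc i))

  Primitive : List Carrier → Set
  Primitive p = ∀ e → e ∣ᶜ p → e ∣ 1#

  length-∣ᶜ⇒∃ : ∀ {e} p (d : e ∣ᶜ p) → length (proj₁ (∣ᶜ⇒∃ p d)) ≡ length p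
  length-∣ᶜ⇒∃ [] d = ≡.refl
  length-∣ᶜ⇒∃ (a ∷ p) d = ≡.cong suc (length-∣ᶜ⇒∃ p λ i → d (suc i))

  record PrimitivePart (p : List Carrier) : Set where
    constructor pp
    field
      part : List Carrier
      part-eq : p ≋ cont p · part
      part-length : length part ≡ length p
      part-primitive : Primitive part

  primitivePart : ∀ p → ¬ cont p ≈ 0# → PrimitivePart p
  primitivePart p nz with ∣ᶜ⇒∃ p (cont-∣ᶜ p) | length-∣ᶜ⇒∃ p (cont-∣ᶜ p)
  ... | q , f | l = pp q f l λ e d → ∣-cancelˡ (cont p) nz
    (∣-resp (sym (*-identityʳ _)) (cont-greatest p (∣ᶜ-resp (≋-sym f)
      λ i → ∣-resp (sym (coeff-· (cont p) q i)) (∣-*-mono ∣-refl (d i)))))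

  cont-nonzero : ∀ p → ¬ p ≋ [] → ¬ cont p ≈ 0#
  cont-nonzero p np z = np (mk≋ λ i → below (cont-∣ᶜ p i))
    where
    below : ∀ {b} → cont p ∣ b → b ≈ 0#
    below (div u f) = trans (sym f) (trans (*-congˡ z) (zeroʳ u))

  peel : ∀ {e} x p q → e ∣ x → e ∣ᶜ mul (x ∷ p) q → e ∣ᶜ mul p q
  peel x p q d m i = ∣-resp
    (trans (+-congʳ (trans (at (mul-∷ˡ x p q) (suc i)) (coeff-add (x · q) _ (suc i))))
      (solve 2 (λ u v → (u :+ v) :- u := v) ≡.refl _ _))
    (∣-- (m (suc i)) (∣ᶜ-·ˡ x q d (suc i)))

  primitive⇒cont∣1 : ∀ p → Primitive p → cont p ∣ 1#
  primitive⇒cont∣1 p h = h _ (cont-∣ᶜ p)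

  *-∣1 : ∀ {a b d} → b ∣ 1# → d ∣ a * b → d ∣ a
  *-∣1 u p = ∣-trans p (∣-resp (*-identityʳ _) (∣-*-mono ∣-refl u))

  private
    GaussBelow : ℕ → Set
    GaussBelow n = ∀ p q → length p ℕ.+ length q ℕ.≤ n → ∀ c → c ∣ᶜ mul p q → c ∣ cont p * cont q

  primitive-unit : ∀ {n} → GaussBelow n → ∀ x p q {g} → Primitive (x ∷ p) → Primitive q →
    length p ℕ.+ length q ℕ.≤ n → g ∣ x → g ∣ᶜ mul (x ∷ p) q → g ∣ 1#
  primitive-unit rec x p q {g} hp hq l gx gm = hp g (∣ᶜ-∷ gx (∣cont⇒∣ᶜ p
    (*-∣1 (primitive⇒cont∣1 q hq) (rec p q l g (peel x p q gx gm)))))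

  -- Let `c` be the content of the product. The element `gcd x c` divides `x`, hence the product of
  -- `p` and `y ∷ q`, hence by induction the content of `p`; so it is a unit. As `c` divides the
  -- lowest coefficient `x * y`, it now divides `y`, and the same argument from the other side makes
  -- `c` a unit.
  primitive-mul : ∀ {n} → GaussBelow n → ∀ x p y q → Primitive (x ∷ p) → Primitive (y ∷ q) →
    length p ℕ.+ suc (length q) ℕ.≤ n → cont (mul (x ∷ p) (y ∷ q)) ∣ 1#
  primitive-mul rec x p y q hp hq l =
    primitive-unit rec y q (x ∷ p) hq hp
      (ℕₚ.≤-trans (ℕₚ.≤-reflexive (≡.trans (ℕₚ.+-comm (length q) (suc (length p)))
        (≡.sym (ℕₚ.+-suc (length p) (length q))))) l)
      (euclid (∣-resp (coeff-mul-0 x p y q) (cont-∣ᶜ m 0))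
        (primitive-unit rec x p (y ∷ q) hp hq l
          (gcd-∣ˡ x (cont m)) (λ i → ∣-trans (gcd-∣ʳ x (cont m)) (cont-∣ᶜ m i))))
      (∣ᶜ-resp (mul-comm (x ∷ p) (y ∷ q)) (cont-∣ᶜ m))
    where
    m = mul (x ∷ p) (y ∷ q)

  mul-·-· : ∀ a b p q → mul (a · p) (b · q) ≋ (a * b) · mul p q
  mul-·-· a b p q =
    ≋-trans (mul-· a p (b · q))
    (≋-trans (·-cong refl (≋-trans (mul-comm p (b · q)) (≋-trans (mul-· b q p)
      (·-cong refl (mul-comm q p)))))
    (·-· a b (mul p q)))

  gauss-step : ∀ {n} → GaussBelow n → ∀ p q → length p ℕ.+ length q ℕ.≤ suc n →
    PrimitivePart p → PrimitivePart q → ∀ c → c ∣ᶜ mul p q → c ∣ cont p * cont q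
  gauss-step rec p q l (pp [] fp lp hp) _ c d =
    ∣-*ʳ (cont q) (cont-greatest p (∣ᶜ-resp (≋-sym fp) ∣ᶜ-[]))
  gauss-step rec p q l (pp (x ∷ p₁) fp lp hp) (pp [] fq lq hq) c d =
    ∣-*ˡ (cont p) (cont-greatest q (∣ᶜ-resp (≋-sym fq) ∣ᶜ-[]))
  gauss-step {n} rec p q l (pp (x ∷ p₁) fp lp hp) (pp (y ∷ q₁) fq lq hq) c d =
    *-∣1 (primitive-mul rec x p₁ y q₁ hp hq
        (ℕ.s≤s⁻¹ (≡.subst (ℕ._≤ suc n) (≡.cong₂ ℕ._+_ (≡.sym lp) (≡.sym lq)) l)))
      (cont-· (cont p * cont q) (mul (x ∷ p₁) (y ∷ q₁)) (∣ᶜ-resp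
        (≋-trans (mul-cong fp fq) (mul-·-· (cont p) (cont q) (x ∷ p₁) (y ∷ q₁))) d))

  gauss-bounded : ∀ n → GaussBelow n
  gauss-bounded n [] q l c d = ∣-*ʳ (cont q) ∣0
  gauss-bounded (suc n) (x ∷ p) q l c d with zero? (cont (x ∷ p)) | zero? (cont q)
  ... | yes z | _ = ∣-*ʳ (cont q) (∣-resp (sym z) ∣0)
  ... | no _ | yes z = ∣-*ˡ (cont (x ∷ p)) (∣-resp (sym z) ∣0)
  ... | no np | no nq = gauss-step (gauss-bounded n) (x ∷ p) q l
          (primitivePart (x ∷ p) np) (primitivePart q nq) c d

  gauss : ∀ {d} → Primitive d → ∀ {u c} → c ∣ᶜ mul u d → c ∣ᶜ u
  gauss {d} h {u} m = ∣cont⇒∣ᶜ u (*-∣1 (primitive⇒cont∣1 d h)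
    (gauss-bounded _ u d ℕₚ.≤-refl _ m))

  ·-cancel : ∀ {c p q} → ¬ c ≈ 0# → c · p ≋ c · q → p ≋ q
  ·-cancel {c} {p} {q} nz f = mk≋ λ i → *-cancelˡ c nz
    (trans (sym (coeff-· c p i)) (trans (at f i) (coeff-· c q i)))

  -- In `mul u d ≋ c · f` Gauss's lemma shows that `c` divides the coefficients of `u`, where it
  -- cancels.
  primitive-∣-· : ∀ {d c f} → Primitive d → ¬ c ≈ 0# → d P.∣ c · f → d P.∣ f
  primitive-∣-· {d} {c} {f} h nz (P.div u e)
    with ∣ᶜ⇒∃ u (gauss h {u} (∣ᶜ-resp (≋-sym e) (∣ᶜ-·ˡ c f ∣-refl)))
  ... | v , g = P.div v (·-cancel nz (≋-trans (≋-sym (mul-· c v d))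
                  (≋-trans (mul-cong (≋-sym g) ≋-refl) e)))

  -- This is the gcd up to constants: maximality is tested on primitive divisors only. `polyGCD`
  -- multiplies it by the gcd of the contents.
  record PrimitiveGCD (f g : List Carrier) : Set where
    constructor pgcd
    field
      h : List Carrier
      h-primitive : Primitive h
      h∣ˡ : h P.∣ f
      h∣ʳ : h P.∣ g
      h-greatest : ∀ {d} → Primitive d → d P.∣ f → d P.∣ g → d P.∣ h

  pgcd-sym : ∀ {f g} → PrimitiveGCD f g → PrimitiveGCD g f
  pgcd-sym (pgcd h hp l r m) = pgcd h hp r l λ pd a b → m pd b a

  pgcd-zeroˡ : ∀ {f g} → f ≋ [] → ¬ g ≋ [] → PrimitiveGCD f g
  pgcd-zeroˡ {f} {g} z nz = build (primitivePart g ng)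
    where
    ng = cont-nonzero g nz
    build : PrimitivePart g → PrimitiveGCD f g
    build (pp h e _ hp) = pgcd h hp (P.∣-resp (≋-sym z) P.∣0)
      (P.div (cont g ∷ []) (≋-trans (mul-const (cont g) h) (≋-sym e)))
      λ pd _ dg → primitive-∣-· pd ng (P.∣-resp e dg)

  ∣-0∷ : ∀ {d f} → d P.∣ f → d P.∣ (0# ∷ f)
  ∣-0∷ (P.div u e) = P.div (0# ∷ u) (≋-trans (mul-0∷ u _) (∷-cong refl e))

  ∣-0∷-cancel : ∀ {d₀ d f} → ¬ d₀ ≈ 0# → (d₀ ∷ d) P.∣ (0# ∷ f) → (d₀ ∷ d) P.∣ f
  ∣-0∷-cancel {d₀} {d} {f} nz (P.div [] e) = P.∣-resp
    (0∷-injective (≋-trans 0∷[] (≋-trans (≡⇒≋ (≡.sym (mul-[]ˡ _))) e))) P.∣0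
  ∣-0∷-cancel {d₀} {d} {f} nz (P.div (u₀ ∷ u) e) = P.div u (0∷-injective
    (≋-trans (≋-sym (mul-0∷ u _)) (≋-trans (mul-cong (∷-cong (sym u₀≈0) ≋-refl) ≋-refl) e)))
    where
    u₀≈0 : u₀ ≈ 0#
    u₀≈0 = integral d₀ u₀ (trans (*-comm _ _) (trans (sym (coeff-mul-0 u₀ u d₀ d)) (at e 0))) nz

  -- A divisor of a polynomial with nonzero constant term has a nonzero constant term itself, so the
  -- indeterminate can be cancelled from its multiples.
  ∣-constant-nonzero : ∀ {d f₀ f} → ¬ f₀ ≈ 0# → d P.∣ (f₀ ∷ f) →
    ∀ {k} → d P.∣ (0# ∷ k) → d P.∣ k
  ∣-constant-nonzero {[]} nz (P.div u e) =
    ⊥-elim (nz (trans (sym (at e 0)) (at (mul-[]ʳ u) 0)))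
  ∣-constant-nonzero {d₀ ∷ d} nz (P.div [] e) =
    ⊥-elim (nz (trans (sym (at e 0)) (at (≡⇒≋ (mul-[]ˡ _)) 0)))
  ∣-constant-nonzero {d₀ ∷ d} nz (P.div (u₀ ∷ u) e) = ∣-0∷-cancel λ z → nz
    (trans (sym (at e 0)) (trans (coeff-mul-0 u₀ u d₀ d) (trans (*-congˡ z) (zeroʳ u₀))))

  ∣-head-zero : ∀ {f₀ f d} → f₀ ≈ 0# → d P.∣ (f₀ ∷ f) → d P.∣ (0# ∷ f)
  ∣-head-zero z = P.∣-resp (∷-cong z ≋-refl)

  ∣-head-zero⁻¹ : ∀ {f₀ f d} → f₀ ≈ 0# → d P.∣ (0# ∷ f) → d P.∣ (f₀ ∷ f)
  ∣-head-zero⁻¹ z = P.∣-resp (∷-cong (sym z) ≋-refl)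

  0∷-∣-0∷ : ∀ {d f} → (0# ∷ d) P.∣ (0# ∷ f) → d P.∣ f
  0∷-∣-0∷ {d} {f} (P.div u e) = P.div u
    (0∷-injective (≋-trans (≋-sym (≋-trans (mul-comm u _) (≋-trans (mul-0∷ d u)
      (∷-cong refl (mul-comm d u))))) e))

  comb : Carrier → List Carrier → Carrier → List Carrier → List Carrier
  comb a [] b q = b · q
  comb a (x ∷ p) b [] = a · (x ∷ p)
  comb a (x ∷ p) b (y ∷ q) = (a * x + b * y) ∷ comb a p b q

  coeff-comb : ∀ a p b q i → coeff (comb a p b q) i ≈ a * coeff p i + b * coeff q i
  coeff-comb a [] b q i = trans (coeff-· b q i)
    (trans (sym (+-identityˡ _)) (+-congʳ (sym (zeroʳ a))))
  coeff-comb a (x ∷ p) b [] i = trans (coeff-· a (x ∷ p) i)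
    (trans (sym (+-identityʳ _)) (+-congˡ (sym (zeroʳ b))))
  coeff-comb a (x ∷ p) b (y ∷ q) zero = refl
  coeff-comb a (x ∷ p) b (y ∷ q) (suc i) = coeff-comb a p b q i

  length-comb : ∀ a p b q → length q ℕ.≤ length p → length (comb a p b q) ℕ.≤ length p
  length-comb a [] b [] l = ℕ.z≤n
  length-comb a (x ∷ p) b [] l = ℕₚ.≤-reflexive (Listₚ.length-map (a *_) (x ∷ p))
  length-comb a (x ∷ p) b (y ∷ q) (ℕ.s≤s l) = ℕ.s≤s (length-comb a p b q l)

  -- Euclid's algorithm cancelling constant terms instead of leading ones, so that no
  -- normalisation of leading zeros is needed: x g − y f is divisible by the indeterminate.
  cross-step : ∀ {n x f y g} →
    (∀ f g → length f ℕ.+ length g ℕ.≤ n → ¬ (f ≋ [] × g ≋ []) → PrimitiveGCD f g) →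
    ¬ x ≈ 0# → ¬ y ≈ 0# → length f ℕ.≤ length g →
    suc (length f) ℕ.+ length g ℕ.≤ n → PrimitiveGCD (x ∷ f) (y ∷ g)
  cross-step {n} {x} {f} {y} {g} rec nx ny f≤g l
    with rec (x ∷ f) (comb x g (- y) f)
           (ℕₚ.≤-trans (ℕₚ.+-monoʳ-≤ (suc (length f)) (length-comb x g (- y) f f≤g)) l)
           (λ { (a , _) → nx (at a 0) })
  ... | pgcd h hp hf hk hm = pgcd h hp hf
        (primitive-∣-· hp nx (P.∣-resp (≋-sym eq) (P.∣-+ (∣-scale hf) (∣-0∷ hk))))
        λ pd df dg → hm pd df (∣-constant-nonzero nx df
          (P.∣-resp eq′ (P.∣-- (∣-scale dg) (∣-scale df))))
    where
    k = comb x g (- y) f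
    ∣-scale : ∀ {c d p} → d P.∣ p → d P.∣ c · p
    ∣-scale {c} d∣p = P.∣-resp (mul-const c _) (P.∣-*ˡ (c ∷ []) d∣p)
    eq : x · (y ∷ g) ≋ add (y · (x ∷ f)) (0# ∷ k)
    eq = mk≋ λ
      { zero → trans (solve 2 (λ x y → x :* y := y :* x :+ :0) ≡.refl x y)
                 (sym (coeff-add (y · (x ∷ f)) (0# ∷ k) 0))
      ; (suc i) → trans (coeff-· x g i)
          (trans (solve 4 (λ x y a b → x :* a := y :* b :+ (x :* a :+ (:- y) :* b)) ≡.refl
                   x y (coeff g i) (coeff f i))
          (sym (trans (coeff-add (y · (x ∷ f)) (0# ∷ k) (suc i))
            (+-cong (coeff-· y f i) (coeff-comb x g (- y) f i))))) }
    eq′ : add (x · (y ∷ g)) (neg (y · (x ∷ f))) ≋ 0# ∷ k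
    eq′ = ≋-trans (add-cong eq ≋-refl) (mk≋ λ i →
      trans (coeff-add (add (y · (x ∷ f)) (0# ∷ k)) _ i)
      (trans (+-cong (coeff-add (y · (x ∷ f)) (0# ∷ k) i) (coeff-neg (y · (x ∷ f)) i))
      (solve 2 (λ u v → (u :+ v) :+ :- u := v) ≡.refl _ _)))

  primitiveGCD : ∀ n f g → length f ℕ.+ length g ℕ.≤ n → ¬ (f ≋ [] × g ≋ []) → PrimitiveGCD f g
  primitiveGCD n [] g l nz = pgcd-zeroˡ ≋-refl λ z → nz (≋-refl , z)
  primitiveGCD n f@(_ ∷ _) [] l nz = pgcd-sym (pgcd-zeroˡ ≋-refl λ z → nz (z , ≋-refl))
  primitiveGCD (suc n) (x ∷ f) (y ∷ g) (ℕ.s≤s l) nz with zero? x | zero? y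
  ... | yes zx | yes zy with primitiveGCD n f g (ℕₚ.≤-trans (ℕₚ.+-monoʳ-≤ (length f) (ℕₚ.n≤1+n _)) l)
            (λ { (a , b) → nz (≋-trans (∷-cong zx a) 0∷[] , ≋-trans (∷-cong zy b) 0∷[]) })
  ... | pgcd h hp hf hg hm = pgcd (0# ∷ h) (λ e d → hp e λ i → d (suc i))
          (∣-head-zero⁻¹ zx (shift hf)) (∣-head-zero⁻¹ zy (shift hg))
          λ {d} pd df dg → greatest d pd (∣-head-zero zx df) (∣-head-zero zy dg)
    where
    shift : ∀ {k} → h P.∣ k → (0# ∷ h) P.∣ (0# ∷ k)
    shift (P.div u e) = P.div u (≋-trans (mul-comm u _) (≋-trans (mul-0∷ h u)
      (∷-cong refl (≋-trans (mul-comm h u) e))))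
    greatest : ∀ d → Primitive d → d P.∣ (0# ∷ f) → d P.∣ (0# ∷ g) → d P.∣ (0# ∷ h)
    greatest [] pd df dg = ⊥-elim (1≉0 (below (pd 0# ∣ᶜ-[])))
      where
      below : ∀ {b} → 0# ∣ b → b ≈ 0#
      below (div u f) = trans (sym f) (zeroʳ u)
    -- Either `d₀ ∷ d` is prime to the indeterminate and divides `f` and `g` themselves, or it
    -- contains the indeterminate, which is then cancelled on both sides.
    greatest (d₀ ∷ d) pd df dg with zero? d₀
    ... | no nd = ∣-0∷ (hm pd (∣-0∷-cancel nd df) (∣-0∷-cancel nd dg))
    ... | yes zd = P.∣-respˡ (∷-cong (sym zd) ≋-refl) (shift′ (hm
            (λ e m → pd e (∣ᶜ-∷ (∣-resp (sym zd) ∣0) m))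
            (0∷-∣-0∷ (P.∣-respˡ (∷-cong zd ≋-refl) df))
            (0∷-∣-0∷ (P.∣-respˡ (∷-cong zd ≋-refl) dg))))
      where
      shift′ : d P.∣ h → (0# ∷ d) P.∣ (0# ∷ h)
      shift′ (P.div u e) = P.div u (≋-trans (mul-comm u _) (≋-trans (mul-0∷ d u)
        (∷-cong refl (≋-trans (mul-comm d u) e))))
  primitiveGCD (suc n) (x ∷ f) (y ∷ g) (ℕ.s≤s l) nz | yes zx | no ny
    with primitiveGCD n f (y ∷ g) l (λ { (_ , b) → ny (at b 0) })
  ... | pgcd h hp hf hg hm = pgcd h hp (∣-head-zero⁻¹ zx (∣-0∷ hf)) hg
    λ pd df dg → hm pd (∣-constant-nonzero ny dg (∣-head-zero zx df)) dg
  primitiveGCD (suc n) (x ∷ f) (y ∷ g) (ℕ.s≤s l) nz | no nx | yes zy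
    with primitiveGCD n (x ∷ f) g (ℕₚ.≤-trans (ℕₚ.≤-reflexive (≡.sym (ℕₚ.+-suc _ _))) l)
           (λ { (a , _) → nx (at a 0) })
  ... | pgcd h hp hf hg hm = pgcd h hp hf (∣-head-zero⁻¹ zy (∣-0∷ hg))
    λ pd df dg → hm pd df (∣-constant-nonzero nx df (∣-head-zero zy dg))
  primitiveGCD (suc n) (x ∷ f) (y ∷ g) (ℕ.s≤s l) nz | no nx | no ny
    with ℕₚ.≤-total (length f) (length g)
  ... | inj₁ f≤g = cross-step (primitiveGCD n) nx ny f≤g
          (ℕₚ.≤-trans (ℕₚ.≤-reflexive (≡.sym (ℕₚ.+-suc _ _))) l)
  ... | inj₂ g≤f = pgcd-sym (cross-step (primitiveGCD n) ny nx g≤f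
          (ℕₚ.≤-trans (ℕₚ.≤-reflexive (≡.trans (≡.cong suc (ℕₚ.+-comm (length g) (length f)))
            (≡.sym (ℕₚ.+-suc _ _)))) l))

  polyGCD : HasGCD polyRing
  polyGCD = record
    { gcd = λ f g → proj₁ (gcd′ f g)
    ; gcd-∣ˡ = λ f g → proj₁ (proj₂ (gcd′ f g))
    ; gcd-∣ʳ = λ f g → proj₁ (proj₂ (proj₂ (gcd′ f g)))
    ; gcd-greatest = λ {f} {g} → proj₂ (proj₂ (proj₂ (gcd′ f g))) }
    where
    GCD : List Carrier → List Carrier → Set
    GCD f g = Σ (List Carrier) λ h → h P.∣ f × h P.∣ g × (∀ {d} → d P.∣ f → d P.∣ g → d P.∣ h)

    scaled : ∀ {c h} f → c ∣ cont f → PrimitivePart f → (∀ {g} → f ≋ cont f · g → h P.∣ g) → c · h P.∣ f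
    scaled {c} {h} f (div k m) (pp f₁ e _ _) below = compose (below e)
      where
      compose : h P.∣ f₁ → c · h P.∣ f
      compose (P.div u g) = P.div (k · u)
        (≋-trans (mul-·-· k c u h)
        (≋-trans (·-cong m g) (≋-sym e)))

    ·h∣ : ∀ {c h} f → c ∣ cont f → Primitive h → h P.∣ f → c · h P.∣ f
    ·h∣ {c} {h} f c∣ hp h∣f with ≋[]? f
    ... | yes z = P.∣-resp (≋-sym z) P.∣0
    ... | no nz = scaled f c∣ (primitivePart f (cont-nonzero f nz))
      λ e → primitive-∣-· hp (cont-nonzero f nz) (P.∣-resp e h∣f)

    build : ∀ f g → ¬ (f ≋ [] × g ≋ []) → GCD f g
    build f g nz with primitiveGCD _ f g ℕₚ.≤-refl nz
    ... | pgcd h hp hf hg hm = c · h , ·h∣ f (gcd-∣ˡ _ _) hp hf , ·h∣ g (gcd-∣ʳ _ _) hp hg , greatest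
      where
      c = gcd (cont f) (cont g)
      greatest : ∀ {d} → d P.∣ f → d P.∣ g → d P.∣ c · h
      -- `d` is split into its content, which divides both contents, and its primitive part, which
      -- divides `h`.
      greatest {d} df dg = P.∣-respˡ (≋-sym e) (P.∣-resp (mul-const c h)
          (P.∣-respˡ (mul-const _ d₁) (P.∣-*-mono (∣ᶜ⇒const∣ (∣ᶜ-∷ cd∣c ∣ᶜ-[])) (hm dp (below df) (below dg)))))
        where
        nd : ¬ d ≋ []
        nd zd = nz (zero∣ df , zero∣ dg)
          where
          zero∣ : ∀ {k} → d P.∣ k → k ≋ []
          zero∣ (P.div u m) = ≋-trans (≋-sym m) (≋-trans (mul-cong ≋-refl zd) (mul-[]ʳ u))
        open PrimitivePart (primitivePart d (cont-nonzero d nd))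
          renaming (part to d₁; part-eq to e; part-primitive to dp)
        below : ∀ {k} → d P.∣ k → d₁ P.∣ k
        below = P.∣-trans (P.div (cont d ∷ []) (≋-trans (mul-const _ d₁) (≋-sym e)))
        cont∣ : ∀ {k} → d P.∣ k → cont d ∣ cont k
        cont∣ {k} (P.div u m) = cont-greatest k (∣ᶜ-resp m (∣ᶜ-mulʳ u d (cont-∣ᶜ d)))
        cd∣c : cont d ∣ c
        cd∣c = gcd-greatest (cont∣ df) (cont∣ dg)

    gcd′ : ∀ f g → GCD f g
    gcd′ f g with ≋[]? f | ≋[]? g
    ... | yes zf | yes zg = [] , P.∣-resp (≋-sym zf) P.∣0 , P.∣-resp (≋-sym zg) P.∣0 , λ _ _ → P.∣0
    ... | no nf | _ = build f g λ z → nf (proj₁ z)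
    ... | yes _ | no ng = build f g λ z → ng (proj₂ z)

-- The terminating sum

module Kit (R : CommutativeRing 0ℓ 0ℓ) where
  open CommutativeRing R
  open Solver R
  open import Relation.Binary.Reasoning.Setoid setoid

  pow : Carrier → ℕ → Carrier
  pow a zero = 1#
  pow a (suc n) = a * pow a n

  pow-cong : ∀ {a b} n → a ≈ b → pow a n ≈ pow b n
  pow-cong zero e = refl
  pow-cong (suc n) e = *-cong e (pow-cong n e)

  pow-+ : ∀ a m n → pow a (m ℕ.+ n) ≈ pow a m * pow a n
  pow-+ a zero n = sym (*-identityˡ _)
  pow-+ a (suc m) n = trans (*-congˡ (pow-+ a m n)) (sym (*-assoc _ _ _))

  pow-1 : ∀ n → pow 1# n ≈ 1#
  pow-1 zero = refl
  pow-1 (suc n) = trans (*-identityˡ _) (pow-1 n)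

  pow-* : ∀ a m n → pow a (m ℕ.* n) ≈ pow (pow a m) n
  pow-* a m zero rewrite ℕₚ.*-zeroʳ m = refl
  pow-* a m (suc n) rewrite ℕₚ.*-suc m n = trans (pow-+ a m (m ℕ.* n)) (*-congˡ (pow-* a m n))

  pow-distrib : ∀ a b n → pow (a * b) n ≈ pow a n * pow b n
  pow-distrib a b zero = sym (*-identityˡ _)
  pow-distrib a b (suc n) = trans (*-congˡ (pow-distrib a b n))
    (solve 4 (λ a b c d → (a :* b) :* (c :* d) := (a :* c) :* (b :* d)) ≡.refl a b _ _)

  sum : ℕ → (ℕ → Carrier) → Carrier
  sum zero f = 0#
  sum (suc n) f = sum n f + f n

  sum-cong : ∀ n {f g} → (∀ i → i ℕ.< n → f i ≈ g i) → sum n f ≈ sum n g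
  sum-cong zero e = refl
  sum-cong (suc n) e = +-cong (sum-cong n λ i l → e i (ℕₚ.m<n⇒m<1+n l)) (e n ℕₚ.≤-refl)

  sum-+ : ∀ n f g → sum n (λ i → f i + g i) ≈ sum n f + sum n g
  sum-+ zero f g = sym (+-identityˡ _)
  sum-+ (suc n) f g = trans (+-congʳ (sum-+ n f g))
    (solve 4 (λ a b c d → (a :+ b) :+ (c :+ d) := (a :+ c) :+ (b :+ d)) ≡.refl _ _ _ _)

  sum-*ˡ : ∀ n c f → sum n (λ i → c * f i) ≈ c * sum n f
  sum-*ˡ zero c f = sym (zeroʳ c)
  sum-*ˡ (suc n) c f = trans (+-congʳ (sum-*ˡ n c f)) (sym (distribˡ _ _ _))

  sum-head : ∀ n f → sum (suc n) f ≈ f 0 + sum n (λ i → f (suc i))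
  sum-head zero f = +-comm _ _
  sum-head (suc n) f = trans (+-congʳ (sum-head n f)) (+-assoc _ _ _)

  sum-zero : ∀ n {f} → (∀ i → i ℕ.< n → f i ≈ 0#) → sum n f ≈ 0#
  sum-zero zero e = refl
  sum-zero (suc n) e = trans (+-cong (sum-zero n λ i l → e i (ℕₚ.m<n⇒m<1+n l)) (e n ℕₚ.≤-refl))
    (+-identityˡ 0#)

  poch : Carrier → Carrier → ℕ → Carrier
  poch a b zero = 1#
  poch a b (suc k) = poch a b k * (1# - a * pow b k)

  poch-cong : ∀ {a a′} b k → a ≈ a′ → poch a b k ≈ poch a′ b k
  poch-cong b zero e = refl
  poch-cong b (suc k) e = *-cong (poch-cong b k e) (+-congˡ (-‿cong (*-congʳ e)))

  poch-head : ∀ a b k → poch a b (suc k) ≈ (1# - a) * poch (a * b) b k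
  poch-head a b zero = solve 1 (λ a → :1 :* (:1 :- a :* :1) := (:1 :- a) :* :1) ≡.refl a
  poch-head a b (suc k) = trans (*-congʳ (poch-head a b k))
    (solve 4 (λ a b P X → (:1 :- a) :* X :* (:1 :- a :* (b :* P)) := (:1 :- a) :* (X :* (:1 :- a :* b :* P)))
      ≡.refl a b (pow b k) _)

  record Unit (u : Carrier) : Set where
    constructor mkUnit
    field
      inv : Carrier
      inverse : u * inv ≈ 1#
  open Unit public

  unit-* : ∀ {u v} → Unit u → Unit v → Unit (u * v)
  unit-* {u} {v} (mkUnit i e) (mkUnit j f) = mkUnit (i * j)
    (trans (solve 4 (λ u v i j → u :* v :* (i :* j) := (u :* i) :* (v :* j)) ≡.refl u v i j)
      (trans (*-cong e f) (*-identityˡ 1#)))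

  unit-factor : ∀ {u v} → Unit (u * v) → Unit u
  unit-factor {u} {v} (mkUnit i e) = mkUnit (v * i) (trans (sym (*-assoc u v i)) e)

  unit-resp : ∀ {u v} → u ≈ v → Unit u → Unit v
  unit-resp e (mkUnit i f) = mkUnit i (trans (*-congʳ (sym e)) f)

  unit-1 : Unit 1#
  unit-1 = mkUnit 1# (*-identityˡ 1#)

  unit-neg : ∀ {u} → Unit u → Unit (- u)
  unit-neg {u} (mkUnit i e) = mkUnit (- i)
    (trans (solve 2 (λ u i → (:- u) :* (:- i) := u :* i) ≡.refl u i) e)

  unit-pow : ∀ {u} n → Unit u → Unit (pow u n)
  unit-pow zero h = unit-1
  unit-pow (suc n) h = unit-* h (unit-pow n h)

  unit-poch : ∀ {a b} k → (∀ j → Unit (1# - a * pow b j)) → Unit (poch a b k)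
  unit-poch zero h = unit-1
  unit-poch (suc k) h = unit-* (unit-poch k h) (h k)

  cancelˡ : ∀ {u a b} → Unit u → u * a ≈ u * b → a ≈ b
  cancelˡ {u} {a} {b} (mkUnit i e) f = begin
    a             ≈⟨ expand a ⟩
    i * (u * a)   ≈⟨ *-congˡ f ⟩
    i * (u * b)   ≈⟨ expand b ⟨
    b ∎
    where
    expand : ∀ z → z ≈ i * (u * z)
    expand z = trans (sym (*-identityˡ z)) (trans (*-congʳ (sym e))
      (solve 3 (λ u i z → u :* i :* z := i :* (u :* z)) ≡.refl u i z))

  quotient-eq : ∀ {u n} (U : Unit u) → (n * inv U) * u ≈ n
  quotient-eq {u} {n} (mkUnit i e) =
    trans (*-assoc _ _ _) (trans (*-congˡ (trans (*-comm _ _) e)) (*-identityʳ n))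

-- A terminating very-well-poised ₈φ₇ with two parameters equal to p h, where a = h²: by Watson's
-- transformation it collapses to two terms. Raising M changes the k-th term by a constant times
-- the (k-1)-st term for the parameters (h p, b p, c p), which gives the sum by induction on M.
module Watson (R : CommutativeRing 0ℓ 0ℓ) (p : CommutativeRing.Carrier R) where
  open CommutativeRing R
  open Solver R
  open Kit R
  open import Relation.Binary.Reasoning.Setoid setoid

  P : ℕ → Carrier
  P = pow p

  -- `y` stands for `a / (b c)` with `a = h²`, so that `y c p` and `y b p` are the well-poised
  -- partners `a p / b` and `a p / c`; keeping it as a parameter avoids dividing by `b` and `c`.
  record Parameters : Set where
    field
      h b c y : Carrier
      h²≈ybc : h * h ≈ y * (b * c)
      unit-p : ∀ j → Unit (1# - P (suc j))
      unit-a : ∀ j → Unit (1# - h * h * P (suc j))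
      unit-b : ∀ j → Unit (1# - y * c * P (suc j))
      unit-c : ∀ j → Unit (1# - y * b * P (suc j))

  shift : Parameters → Parameters
  shift par = record
    { h = h * p ; b = b * p ; c = c * p ; y = y
    ; h²≈ybc = trans (solve 2 (λ h p → h :* p :* (h :* p) := h :* h :* (p :* p)) ≡.refl h p)
        (trans (*-congʳ h²≈ybc)
          (solve 4 (λ y b c p → y :* (b :* c) :* (p :* p) := y :* (b :* p :* (c :* p))) ≡.refl y b c p))
    ; unit-p = unit-p
    ; unit-a = λ j → unit-resp (solve 3 (λ h p Z →
        :1 :- h :* h :* (p :* (p :* (p :* Z))) := :1 :- h :* p :* (h :* p) :* (p :* Z)) ≡.refl h p (P j))
        (unit-a (suc (suc j)))
    ; unit-b = λ j → unit-resp (solve 4 (λ y c p Z →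
        :1 :- y :* c :* (p :* (p :* Z)) := :1 :- y :* (c :* p) :* (p :* Z)) ≡.refl y c p (P j))
        (unit-b (suc j))
    ; unit-c = λ j → unit-resp (solve 4 (λ y c p Z →
        :1 :- y :* c :* (p :* (p :* Z)) := :1 :- y :* (c :* p) :* (p :* Z)) ≡.refl y b p (P j))
        (unit-c (suc j)) }
    where open Parameters par

  module Series (par : Parameters) where
    open Parameters par public

    W : ℕ → Carrier
    W k = (1# - h * P k) * (1# - h * P k) * (1# - h * h * (P k * P k))

    -- The last factor is `1 - p^(-M) p^k` times the argument `y p^M` of the series; multiplied out,
    -- it contains no negative power.
    N : ℕ → ℕ → Carrier
    N M k = (1# - h * h * P k) * ((1# - b * P k) * (1# - c * P k)) * ((P M - P k) * y)

    D : ℕ → ℕ → Carrier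
    D M k = (1# - p * P k) * ((1# - y * c * (p * P k)) * (1# - y * b * (p * P k)))
            * (1# - h * h * (p * (P M * P k)))

    unit-D : ∀ M k → Unit (D M k)
    unit-D M k = unit-* (unit-* (unit-p k) (unit-* (unit-b k) (unit-c k)))
      (unit-resp (+-congˡ (-‿cong (*-congˡ (*-congˡ (pow-+ p M k))))) (unit-a (M ℕ.+ k)))

    f : ℕ → ℕ → Carrier
    f M zero = 1#
    f M (suc k) = f M k * N M k * inv (unit-D M k)

    f-step : ∀ M k → f M (suc k) * D M k ≈ f M k * N M k
    f-step M k = quotient-eq (unit-D M k)

    S : ℕ → Carrier
    S M = sum (suc M) (λ k → W k * f M k)

    f-vanish : ∀ M → f M (suc M) ≈ 0#
    f-vanish M = trans (*-congʳ (trans (*-congˡ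
      (solve 3 (λ u P y → u :* ((P :- P) :* y) := :0) ≡.refl _ (P M) y)) (zeroʳ _))) (zeroˡ _)

    -- For two parameters `p h` the quotient `a p / (p h)²` is `p^(-1)`, which stops the ₄φ₃ of
    -- Watson's transformation after two terms. These are the two terms, multiplied by
    -- `(1 - h)² (1 - y p^M)`.
    bracket : ℕ → Carrier
    bracket M = (1# - h) * (1# - h) * (1# - y * P M) - y * (1# - b) * (1# - c) * (1# - P M)

  module Contiguity (par : Parameters) (M : ℕ) where
    open Series par
    module ′ = Series (shift par)

    U V : Carrier
    U = (1# - y * c * p) * (1# - y * b * p) * (1# - h * h * (p * (p * P M)))
    V = y * (1# - h * h) * (1# - h * h * p) * ((1# - b) * (1# - c))

    s t e : ℕ → Carrier
    s k = 1# - p * P k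
    t k = 1# - h * h * (p * P k)
    e k = 1# - h * h * (p * (p * (P M * P k)))

    A K : Carrier
    A = 1# - h * h * (p * P M)
    K = U * A

    unit-e : ∀ k → Unit (e k)
    unit-e k = unit-resp (+-congˡ (-‿cong (*-congˡ (*-congˡ (*-congˡ (pow-+ p M k))))))
      (unit-a (suc (M ℕ.+ k)))

    unit-K : Unit K
    unit-K = unit-* (unit-* (unit-* (strip (unit-b 0)) (strip (unit-c 0))) (unit-a (suc M))) (unit-a M)
      where
      strip : ∀ {z} → Unit (1# - z * (p * 1#)) → Unit (1# - z * p)
      strip = unit-resp (+-congˡ (-‿cong (*-congˡ (*-identityʳ p))))

    -- By induction on `k`: at index `suc k` the factors `N` and `D` agree with those of the shifted
    -- series at `k` up to neighbouring values of `s` and `t` and a power of `p`, and these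
    -- telescope. In `unraised` the factor `e` takes part as well.
    raised : ∀ k → f (suc M) (suc k) * t k * s k * U ≈ ′.f M k * V * ((p * P M - 1#) * P k)
    raised zero = begin
      F * t 0 * s 0 * U
        ≈⟨ solve 7 (λ F h b c y p N →
             F :* (:1 :- h :* h :* (p :* :1)) :* (:1 :- p :* :1)
               :* ((:1 :- y :* c :* p) :* (:1 :- y :* b :* p) :* (:1 :- h :* h :* (p :* (p :* N))))
             := (:1 :- h :* h :* p) :* (F :* ((:1 :- p :* :1) :* ((:1 :- y :* c :* (p :* :1)) :* (:1 :- y :* b :* (p :* :1)))
               :* (:1 :- h :* h :* (p :* (p :* N :* :1))))))
             ≡.refl F h b c y p (P M) ⟩
      (1# - h * h * p) * (F * D (suc M) 0)   ≈⟨ *-congˡ (f-step (suc M) 0) ⟩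
      (1# - h * h * p) * (1# * N (suc M) 0)
        ≈⟨ solve 6 (λ h b c y p N →
             (:1 :- h :* h :* p) :* (:1 :* ((:1 :- h :* h :* :1) :* ((:1 :- b :* :1) :* (:1 :- c :* :1)) :* ((p :* N :- :1) :* y)))
             := :1 :* (y :* (:1 :- h :* h) :* (:1 :- h :* h :* p) :* ((:1 :- b) :* (:1 :- c))) :* ((p :* N :- :1) :* :1))
             ≡.refl h b c y p (P M) ⟩
      1# * V * ((p * P M - 1#) * 1#) ∎
      where F = f (suc M) 1
    raised (suc k) = cancelˡ (′.unit-D M k) (begin
      D′ * (F₂ * t (suc k) * s (suc k) * U)
        ≈⟨ solve 5 (λ D′ F t s U → D′ :* (F :* t :* s :* U) := F :* t :* U :* (D′ :* s)) ≡.refl D′ F₂ (t (suc k)) (s (suc k)) U ⟩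
      F₂ * t (suc k) * U * (D′ * s (suc k))   ≈⟨ *-congˡ D-shift ⟩
      F₂ * t (suc k) * U * (D₁ * s k)
        ≈⟨ solve 5 (λ D F t s U → F :* t :* U :* (D :* s) := (F :* D) :* (t :* U :* s)) ≡.refl D₁ F₂ (t (suc k)) (s k) U ⟩
      (F₂ * D₁) * (t (suc k) * U * s k)       ≈⟨ *-congʳ (f-step (suc M) (suc k)) ⟩
      (F₁ * N₁) * (t (suc k) * U * s k)
        ≈⟨ solve 5 (λ F N t s U → F :* N :* (t :* U :* s) := (N :* t) :* (F :* s :* U)) ≡.refl F₁ N₁ (t (suc k)) (s k) U ⟩
      (N₁ * t (suc k)) * (F₁ * s k * U)       ≈⟨ *-congʳ N-shift ⟩
      (N′ * (p * t k)) * (F₁ * s k * U)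
        ≈⟨ solve 6 (λ F N t s U p → (N :* (p :* t)) :* (F :* s :* U) := N :* p :* (F :* t :* s :* U)) ≡.refl F₁ N′ (t k) (s k) U p ⟩
      N′ * p * (F₁ * t k * s k * U)           ≈⟨ *-congˡ (raised k) ⟩
      N′ * p * (G₁ * V * ((p * P M - 1#) * P k))
        ≈⟨ solve 6 (λ G N V Z P p → N :* p :* (G :* V :* (Z :* P)) := G :* N :* (V :* (Z :* (p :* P)))) ≡.refl G₁ N′ V (p * P M - 1#) (P k) p ⟩
      G₁ * N′ * (V * ((p * P M - 1#) * (p * P k)))  ≈⟨ *-congʳ (′.f-step M k) ⟨
      G₂ * D′ * (V * ((p * P M - 1#) * (p * P k)))
        ≈⟨ solve 4 (λ G D V Z → G :* D :* (V :* Z) := D :* (G :* V :* Z)) ≡.refl G₂ D′ V _ ⟩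
      D′ * (G₂ * V * ((p * P M - 1#) * (p * P k))) ∎)
      where
      F₁ = f (suc M) (suc k)
      F₂ = f (suc M) (suc (suc k))
      G₁ = ′.f M k
      G₂ = ′.f M (suc k)
      D₁ = D (suc M) (suc k)
      N₁ = N (suc M) (suc k)
      D′ = ′.D M k
      N′ = ′.N M k
      D-shift : D′ * s (suc k) ≈ D₁ * s k
      D-shift = solve 7 (λ h b c y p N P →
        ((:1 :- p :* P) :* ((:1 :- y :* (c :* p) :* (p :* P)) :* (:1 :- y :* (b :* p) :* (p :* P)))
            :* (:1 :- h :* p :* (h :* p) :* (p :* (N :* P)))) :* (:1 :- p :* (p :* P))
        := ((:1 :- p :* (p :* P)) :* ((:1 :- y :* c :* (p :* (p :* P))) :* (:1 :- y :* b :* (p :* (p :* P))))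
            :* (:1 :- h :* h :* (p :* (p :* N :* (p :* P))))) :* (:1 :- p :* P))
        ≡.refl h b c y p (P M) (P k)
      N-shift : N₁ * t (suc k) ≈ N′ * (p * t k)
      N-shift = solve 7 (λ h b c y p N P →
        ((:1 :- h :* h :* (p :* P)) :* ((:1 :- b :* (p :* P)) :* (:1 :- c :* (p :* P))) :* ((p :* N :- p :* P) :* y))
            :* (:1 :- h :* h :* (p :* (p :* P)))
        := ((:1 :- h :* p :* (h :* p) :* P) :* ((:1 :- b :* p :* P) :* (:1 :- c :* p :* P)) :* ((N :- P) :* y))
            :* (p :* (:1 :- h :* h :* (p :* P))))
        ≡.refl h b c y p (P M) (P k)

    unraised : ∀ k → f M (suc k) * t k * s k * K ≈ ′.f M k * V * ((P M - P k) * e k)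
    unraised zero = begin
      F * t 0 * s 0 * K
        ≈⟨ solve 7 (λ F h b c y p N →
             F :* (:1 :- h :* h :* (p :* :1)) :* (:1 :- p :* :1)
               :* ((:1 :- y :* c :* p) :* (:1 :- y :* b :* p) :* (:1 :- h :* h :* (p :* (p :* N)))
                 :* (:1 :- h :* h :* (p :* N)))
             := (:1 :- h :* h :* p) :* (:1 :- h :* h :* (p :* (p :* N)))
               :* (F :* ((:1 :- p :* :1) :* ((:1 :- y :* c :* (p :* :1)) :* (:1 :- y :* b :* (p :* :1)))
               :* (:1 :- h :* h :* (p :* (N :* :1))))))
             ≡.refl F h b c y p (P M) ⟩
      Z * (F * D M 0)   ≈⟨ *-congˡ (f-step M 0) ⟩
      Z * (1# * N M 0)
        ≈⟨ solve 6 (λ h b c y p N →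
             (:1 :- h :* h :* p) :* (:1 :- h :* h :* (p :* (p :* N)))
               :* (:1 :* ((:1 :- h :* h :* :1) :* ((:1 :- b :* :1) :* (:1 :- c :* :1)) :* ((N :- :1) :* y)))
             := :1 :* (y :* (:1 :- h :* h) :* (:1 :- h :* h :* p) :* ((:1 :- b) :* (:1 :- c)))
               :* ((N :- :1) :* (:1 :- h :* h :* (p :* (p :* (N :* :1))))))
             ≡.refl h b c y p (P M) ⟩
      1# * V * ((P M - 1#) * e 0) ∎
      where
      F = f M 1
      Z = (1# - h * h * p) * (1# - h * h * (p * (p * P M)))
    unraised (suc k) = cancelˡ (unit-* (′.unit-D M k) (unit-e k)) (begin
      D′ * e k * (F₂ * t (suc k) * s (suc k) * K)
        ≈⟨ solve 6 (λ D e F t s K → D :* e :* (F :* t :* s :* K) := F :* t :* K :* (D :* s :* e)) ≡.refl D′ (e k) F₂ (t (suc k)) (s (suc k)) K ⟩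
      F₂ * t (suc k) * K * (D′ * s (suc k) * e k)   ≈⟨ *-congˡ D-shift ⟩
      F₂ * t (suc k) * K * (D₁ * s k * e (suc k))
        ≈⟨ solve 6 (λ D e F t s K → F :* t :* K :* (D :* s :* e) := (F :* D) :* (t :* K :* s :* e)) ≡.refl D₁ (e (suc k)) F₂ (t (suc k)) (s k) K ⟩
      (F₂ * D₁) * (t (suc k) * K * s k * e (suc k))       ≈⟨ *-congʳ (f-step M (suc k)) ⟩
      (F₁ * (t k * B * ((P M - P (suc k)) * y))) * (t (suc k) * K * s k * e (suc k))
        ≈⟨ solve 9 (λ F t B n y t′ K s e → (F :* (t :* B :* (n :* y))) :* (t′ :* K :* s :* e)
             := (F :* t :* s :* K) :* (B :* t′ :* y :* (n :* e))) ≡.refl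
             F₁ (t k) B (P M - P (suc k)) y (t (suc k)) K (s k) (e (suc k)) ⟩
      (F₁ * t k * s k * K) * (B * t (suc k) * y * ((P M - P (suc k)) * e (suc k)))
        ≈⟨ *-congʳ (unraised k) ⟩
      (G₁ * V * ((P M - P k) * e k)) * (B * t (suc k) * y * ((P M - P (suc k)) * e (suc k)))
        ≈⟨ solve 8 (λ G V n e B t y X → (G :* V :* (n :* e)) :* (B :* t :* y :* X)
             := G :* (t :* B :* (n :* y)) :* (e :* V :* X)) ≡.refl
             G₁ V (P M - P k) (e k) B (t (suc k)) y ((P M - P (suc k)) * e (suc k)) ⟩
      G₁ * (t (suc k) * B * ((P M - P k) * y)) * (e k * V * ((P M - P (suc k)) * e (suc k)))
        ≈⟨ *-congʳ (*-congˡ N-shift) ⟨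
      G₁ * ′.N M k * (e k * V * ((P M - P (suc k)) * e (suc k)))  ≈⟨ *-congʳ (′.f-step M k) ⟨
      G₂ * D′ * (e k * V * ((P M - P (suc k)) * e (suc k)))
        ≈⟨ solve 5 (λ G D e V X → G :* D :* (e :* V :* X) := D :* e :* (G :* V :* X)) ≡.refl G₂ D′ (e k) V _ ⟩
      D′ * e k * (G₂ * V * ((P M - P (suc k)) * e (suc k))) ∎)
      where
      F₁ = f M (suc k)
      F₂ = f M (suc (suc k))
      G₁ = ′.f M k
      G₂ = ′.f M (suc k)
      D₁ = D M (suc k)
      D′ = ′.D M k
      B = (1# - b * (p * P k)) * (1# - c * (p * P k))
      D-shift : D′ * s (suc k) * e k ≈ D₁ * s k * e (suc k)
      D-shift = solve 7 (λ h b c y p N P →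
        ((:1 :- p :* P) :* ((:1 :- y :* (c :* p) :* (p :* P)) :* (:1 :- y :* (b :* p) :* (p :* P)))
            :* (:1 :- h :* p :* (h :* p) :* (p :* (N :* P)))) :* (:1 :- p :* (p :* P))
            :* (:1 :- h :* h :* (p :* (p :* (N :* P))))
        := ((:1 :- p :* (p :* P)) :* ((:1 :- y :* c :* (p :* (p :* P))) :* (:1 :- y :* b :* (p :* (p :* P))))
            :* (:1 :- h :* h :* (p :* (N :* (p :* P))))) :* (:1 :- p :* P)
            :* (:1 :- h :* h :* (p :* (p :* (N :* (p :* P))))))
        ≡.refl h b c y p (P M) (P k)
      N-shift : ′.N M k ≈ t (suc k) * B * ((P M - P k) * y)
      N-shift = solve 7 (λ h b c y p N P →
        (:1 :- h :* p :* (h :* p) :* P) :* ((:1 :- b :* p :* P) :* (:1 :- c :* p :* P)) :* ((N :- P) :* y)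
        := (:1 :- h :* h :* (p :* (p :* P))) :* ((:1 :- b :* (p :* P)) :* (:1 :- c :* (p :* P))) :* ((N :- P) :* y))
        ≡.refl h b c y p (P M) (P k)

    -- By `raised` and `unraised` both terms are multiples of the same shifted term. The cofactors
    -- `(p P_M - 1) P_k A` and `(P_M - P_k) e_k` differ by `t_k s_k P_M`, so that `t` and `s`
    -- cancel.
    difference : ∀ k → f (suc M) (suc k) * K ≈ f M (suc k) * K - P M * V * ′.f M k
    difference k = cancelˡ (unit-* (unit-a k) (unit-p k)) (begin
      t k * s k * (F * (U * A))
        ≈⟨ solve 5 (λ t s F U A → t :* s :* (F :* (U :* A)) := F :* t :* s :* U :* A) ≡.refl (t k) (s k) F U A ⟩
      F * t k * s k * U * A   ≈⟨ *-congʳ (raised k) ⟩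
      G * V * ((p * P M - 1#) * P k) * A
        ≈⟨ solve 6 (λ G V h p N P → G :* V :* ((p :* N :- :1) :* P) :* (:1 :- h :* h :* (p :* N))
             := G :* V :* ((N :- P) :* (:1 :- h :* h :* (p :* (p :* (N :* P)))))
              :- (:1 :- h :* h :* (p :* P)) :* (:1 :- p :* P) :* (N :* V :* G)) ≡.refl G V h p (P M) (P k) ⟩
      G * V * ((P M - P k) * e k) - t k * s k * (P M * V * G)
        ≈⟨ +-congʳ (unraised k) ⟨
      F₀ * t k * s k * K - t k * s k * (P M * V * G)
        ≈⟨ solve 5 (λ F t s K X → F :* t :* s :* K :- t :* s :* X := t :* s :* (F :* K :- X)) ≡.refl F₀ (t k) (s k) K _ ⟩
      t k * s k * (F₀ * K - P M * V * G) ∎)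
      where
      F = f (suc M) (suc k)
      F₀ = f M (suc k)
      G = ′.f M k

    S-step : S (suc M) * K ≈ S M * K - P M * V * ′.S M
    S-step = begin
      S (suc M) * K
        ≈⟨ *-congʳ (sum-head (suc M) (λ k → W k * f (suc M) k)) ⟩
      (W 0 * 1# + sum (suc M) (λ k → W (suc k) * f (suc M) (suc k))) * K
        ≈⟨ distribʳ _ _ _ ⟩
      W 0 * 1# * K + sum (suc M) (λ k → W (suc k) * f (suc M) (suc k)) * K
        ≈⟨ +-congˡ (trans (*-comm _ _) (sym (sum-*ˡ (suc M) K _))) ⟩
      W 0 * 1# * K + sum (suc M) (λ k → K * (W (suc k) * f (suc M) (suc k)))
        ≈⟨ +-congˡ (trans (sum-cong (suc M) λ k _ → term k) (sum-+ (suc M) _ _)) ⟩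
      W 0 * 1# * K + (sum (suc M) (λ k → K * (W (suc k) * f M (suc k)))
                    + sum (suc M) (λ k → - (P M * V) * (′.W k * ′.f M k)))
        ≈⟨ +-congˡ (+-cong (sum-*ˡ (suc M) K _) (sum-*ˡ (suc M) (- (P M * V)) _)) ⟩
      W 0 * 1# * K + (K * tail + - (P M * V) * ′.S M)
        ≈⟨ solve 5 (λ w K T X S → w :* K :+ (K :* T :+ (:- X) :* S) := (w :+ T) :* K :- X :* S)
             ≡.refl (W 0 * 1#) K tail (P M * V) (′.S M) ⟩
      (W 0 * 1# + tail) * K - P M * V * ′.S M
        -- `S M` is extended by the index `suc M`, where `f M` vanishes, to match the range of
        -- `S (suc M)`.
        ≈⟨ +-congʳ (*-congʳ (sum-head (suc M) (λ k → W k * f M k))) ⟨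
      (S M + W (suc M) * f M (suc M)) * K - P M * V * ′.S M
        ≈⟨ +-congʳ (*-congʳ (trans (+-congˡ (trans (*-congˡ (f-vanish M)) (zeroʳ _))) (+-identityʳ _))) ⟩
      S M * K - P M * V * ′.S M ∎
      where
      tail = sum (suc M) (λ k → W (suc k) * f M (suc k))
      term : ∀ k → K * (W (suc k) * f (suc M) (suc k))
                 ≈ K * (W (suc k) * f M (suc k)) + - (P M * V) * (′.W k * ′.f M k)
      term k = begin
        K * (W (suc k) * f (suc M) (suc k))
          ≈⟨ solve 3 (λ K W F → K :* (W :* F) := W :* (F :* K)) ≡.refl K _ _ ⟩
        W (suc k) * (f (suc M) (suc k) * K)   ≈⟨ *-congˡ (difference k) ⟩
        W (suc k) * (f M (suc k) * K - P M * V * ′.f M k)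
          ≈⟨ solve 7 (λ h p P F K X G →
               (:1 :- h :* (p :* P)) :* (:1 :- h :* (p :* P)) :* (:1 :- h :* h :* (p :* P :* (p :* P))) :* (F :* K :- X :* G)
               := K :* ((:1 :- h :* (p :* P)) :* (:1 :- h :* (p :* P)) :* (:1 :- h :* h :* (p :* P :* (p :* P))) :* F)
                 :+ (:- X) :* ((:1 :- h :* p :* P) :* (:1 :- h :* p :* P) :* (:1 :- h :* p :* (h :* p) :* (P :* P)) :* G))
               ≡.refl h p (P k) (f M (suc k)) K (P M * V) (′.f M k) ⟩
        K * (W (suc k) * f M (suc k)) + - (P M * V) * (′.W k * ′.f M k) ∎

    bracket-step :
      bracket M * ((1# - y * c * p * P M) * (1# - y * b * p * P M))
        - P M * (y * (1# - b) * (1# - c)) * ′.bracket M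
      ≈ (1# - h * h * p * P M) * (1# - y * P M) * bracket (suc M)
    bracket-step = trans
      (solve 6 (λ h b c y p N →
        let B = y :* (:1 :- b) :* (:1 :- c)
            β = (:1 :- y :* c :* p :* N) :* (:1 :- y :* b :* p :* N)
            a = y :* (b :* c)
            -- The identity holds only under `h²≈ybc`; `Q` is the cofactor of `h * h - y * (b * c)`
            -- in the difference of the two sides.
            Q = (:1 :- y :* N) :* (β :- N :* B :* p :* p :- (:1 :- y :* p :* N)
                  :+ p :* N :* ((:1 :- h :- h) :* (:1 :- y :* p :* N) :- B :* (:1 :- p :* N))
                  :+ p :* N :* (:1 :- y :* p :* N) :* (h :* h :+ a))
        in ((:1 :- h) :* (:1 :- h) :* (:1 :- y :* N) :- B :* (:1 :- N)) :* β
            :- N :* B :* ((:1 :- h :* p) :* (:1 :- h :* p) :* (:1 :- y :* N)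
               :- y :* (:1 :- b :* p) :* (:1 :- c :* p) :* (:1 :- N))
          := (:1 :- h :* h :* p :* N) :* (:1 :- y :* N)
              :* ((:1 :- h) :* (:1 :- h) :* (:1 :- y :* (p :* N)) :- B :* (:1 :- p :* N))
            :+ (h :* h :- a) :* Q) ≡.refl h b c y p (P M))
      (trans (+-congˡ (trans (*-congʳ (trans (+-congʳ h²≈ybc) (-‿inverseʳ _))) (zeroˡ _))) (+-identityʳ _))

  -- The product in Watson's transformation contains `(y p; p)_M`, that is
  -- `(y; p)_M (1 - y p^M) / (1 - y)`. Hence the `1 - y` on the left; the factor `1 - y p^M` is
  -- absorbed in `bracket`. The induction runs over all parameters at once, since `S-step` leads to
  -- the shifted ones.
  watson : ∀ (par : Parameters) M → let open Series par in
    (1# - y) * S M * (poch (y * c * p) p M * poch (y * b * p) p M)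
      ≈ (1# - h * h) * (poch (h * h * p) p M * poch y p M) * bracket M
  watson par zero = solve 4 (λ h b c y →
      (:1 :- y) :* (:0 :+ (:1 :- h :* :1) :* (:1 :- h :* :1) :* (:1 :- h :* h :* (:1 :* :1)) :* :1) :* (:1 :* :1)
      := (:1 :- h :* h) :* (:1 :* :1) :* ((:1 :- h) :* (:1 :- h) :* (:1 :- y :* :1)
         :- y :* (:1 :- b) :* (:1 :- c) :* (:1 :- :1))) ≡.refl h b c y
    where open Series par
  watson par (suc M) = cancelˡ unit-K (begin
    K * ((1# - y) * S (suc M) * (pc * wc * (pb * wb)))
      ≈⟨ solve 4 (λ K y S X → K :* (y :* S :* X) := y :* X :* (S :* K)) ≡.refl K (1# - y) (S (suc M)) _ ⟩
    (1# - y) * (pc * wc * (pb * wb)) * (S (suc M) * K)   ≈⟨ *-congˡ S-step ⟩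
    (1# - y) * (pc * wc * (pb * wb)) * (S M * K - P M * V * ′.S M)
      ≈⟨ solve 9 (λ y pc wc pb wb S K X S′ →
           y :* (pc :* wc :* (pb :* wb)) :* (S :* K :- X :* S′)
           := (y :* S :* (pc :* pb)) :* (K :* (wc :* wb)) :- X :* (y :* S′ :* (pc :* wc :* (pb :* wb))))
           ≡.refl (1# - y) pc wc pb wb (S M) K (P M * V) (′.S M) ⟩
    ((1# - y) * S M * (pc * pb)) * (K * (wc * wb))
      - P M * V * ((1# - y) * ′.S M * (pc * wc * (pb * wb)))
      ≈⟨ +-cong (*-congʳ (watson par M)) (-‿cong (trans (*-congˡ (trans
           (*-congˡ (*-cong (head′ (y * c) (y * (c * p)) (solve 3 (λ y c p → y :* c :* p :* p := y :* (c :* p) :* p) ≡.refl y c p))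
                            (head′ (y * b) (y * (b * p)) (solve 3 (λ y c p → y :* c :* p :* p := y :* (c :* p) :* p) ≡.refl y b p))))
           (solve 6 (λ y S u v w z → y :* S :* (u :* v :* (w :* z)) := (y :* S :* (v :* z)) :* (u :* w))
             ≡.refl (1# - y) (′.S M) _ _ _ _)))
           (*-congˡ (*-congʳ (watson (shift par) M))))) ⟩
    ((1# - h * h) * (pa * py) * bracket M) * (K * (wc * wb))
      - P M * V * ((1# - h * p * (h * p)) * (pa′ * py) * ′.bracket M * ((1# - y * c * p) * (1# - y * b * p)))
      ≈⟨ +-congˡ (-‿cong (trans (solve 11 (λ N h p y b c pa py br uc ub →
           N :* (y :* (:1 :- h :* h) :* (:1 :- h :* h :* p) :* ((:1 :- b) :* (:1 :- c)))
             :* ((:1 :- h :* p :* (h :* p)) :* (pa :* py) :* br :* (uc :* ub))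
           := ((:1 :- h :* h :* p) :* ((:1 :- h :* h :* p :* p) :* pa))
             :* ((:1 :- h :* h) :* py :* (uc :* ub) :* (N :* (y :* (:1 :- b) :* (:1 :- c)) :* br)))
             ≡.refl (P M) h p y b c pa′ py (′.bracket M) (1# - y * c * p) (1# - y * b * p))
           (*-congʳ head-a))) ⟩
    ((1# - h * h) * (pa * py) * bracket M) * (K * (wc * wb))
      - (pa * (1# - h * h * p * P M) * (1# - h * h * p * (p * P M)))
         * ((1# - h * h) * py * ((1# - y * c * p) * (1# - y * b * p)) * (P M * (y * (1# - b) * (1# - c)) * ′.bracket M))
      ≈⟨ solve 12 (λ a₀ pa py br wc wb uc ub h p N X →
           (a₀ :* (pa :* py) :* br) :* (uc :* ub :* (:1 :- h :* h :* (p :* (p :* N))) :* (:1 :- h :* h :* (p :* N)) :* (wc :* wb))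
             :- (pa :* (:1 :- h :* h :* p :* N) :* (:1 :- h :* h :* p :* (p :* N))) :* (a₀ :* py :* (uc :* ub) :* X)
           := (uc :* ub :* (:1 :- h :* h :* (p :* (p :* N))) :* (:1 :- h :* h :* (p :* N)))
             :* (a₀ :* (pa :* py) :* (br :* (wc :* wb) :- X)))
           ≡.refl (1# - h * h) pa py (bracket M) wc wb (1# - y * c * p) (1# - y * b * p) h p (P M)
             (P M * (y * (1# - b) * (1# - c)) * ′.bracket M) ⟩
    K * ((1# - h * h) * (pa * py) * (bracket M * (wc * wb) - P M * (y * (1# - b) * (1# - c)) * ′.bracket M))
      ≈⟨ *-congˡ (*-congˡ bracket-step) ⟩
    K * ((1# - h * h) * (pa * py) * ((1# - h * h * p * P M) * (1# - y * P M) * bracket (suc M)))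
      ≈⟨ *-congˡ (solve 6 (λ a pa py u v br → a :* (pa :* py) :* (u :* v :* br) := a :* (pa :* u :* (py :* v)) :* br)
           ≡.refl (1# - h * h) pa py (1# - h * h * p * P M) (1# - y * P M) (bracket (suc M))) ⟩
    K * ((1# - h * h) * (pa * (1# - h * h * p * P M) * (py * (1# - y * P M))) * bracket (suc M)) ∎)
    where
    open Series par
    open Contiguity par M
    pc = poch (y * c * p) p M
    pb = poch (y * b * p) p M
    pa = poch (h * h * p) p M
    pa′ = poch (h * p * (h * p) * p) p M
    py = poch y p M
    wc = 1# - y * c * p * P M
    wb = 1# - y * b * p * P M
    head′ : ∀ u v → u * p * p ≈ v * p → poch (u * p) p (suc M) ≈ (1# - u * p) * poch (v * p) p M
    head′ u v e = trans (poch-head (u * p) p M) (*-congˡ (poch-cong p M e))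
    head-a : (1# - h * h * p) * ((1# - h * h * p * p) * pa′)
           ≈ pa * (1# - h * h * p * P M) * (1# - h * h * p * (p * P M))
    head-a = sym (trans (poch-head (h * h * p) p (suc M)) (*-congˡ (trans (poch-head (h * h * p * p) p M)
      (*-congˡ (poch-cong p M (solve 2 (λ h p → h :* h :* p :* p :* p := h :* p :* (h :* p) :* p) ≡.refl h p))))))

module Reversal (R : CommutativeRing 0ℓ 0ℓ) (p : CommutativeRing.Carrier R) where
  open CommutativeRing R
  open Solver R
  open Kit R

  -- This is the product of `- v p^j` over `j < M`, the factor that appears when `(v; p)_M` is read
  -- backwards.
  σ : ℕ → Carrier → Carrier
  σ zero v = 1#
  σ (suc M) v = - v * σ M (v * p)

  σ-cong : ∀ M {v w} → v ≈ w → σ M v ≈ σ M w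
  σ-cong zero e = refl
  σ-cong (suc M) e = *-cong (-‿cong e) (σ-cong M (*-congʳ e))

  σ-* : ∀ M v m → σ M (v * m) ≈ pow m M * σ M v
  σ-* zero v m = sym (*-identityˡ 1#)
  σ-* (suc M) v m = trans (*-congˡ (trans (σ-cong M (solve 3 (λ v m p → v :* m :* p := v :* p :* m) ≡.refl v m p))
                      (σ-* M (v * p) m)))
    (solve 4 (λ v m a b → :- (v :* m) :* (a :* b) := m :* a :* (:- v :* b)) ≡.refl v m _ _)

  unit-σ : ∀ M {v} → Unit p → Unit v → Unit (σ M v)
  unit-σ zero up uv = unit-1
  unit-σ (suc M) up uv = unit-* (unit-neg uv) (unit-σ M up (unit-* uv up))

  -- If `v w p^(M-1) = 1`, then `1 - v p^j = - v p^j (1 - w p^(M-1-j))`. The hypothesis is this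
  -- equation times `p`, which avoids the exponent `M - 1`.
  poch-reverse : Unit p → ∀ M {v w} → v * w * pow p M ≈ p → poch v p M ≈ σ M v * poch w p M
  poch-reverse up zero e = sym (*-identityˡ 1#)
  poch-reverse up (suc M) {v} {w} e =
    trans (poch-head v p M)
    (trans (*-cong head (poch-reverse up M
        (trans (solve 4 (λ v w p P → v :* p :* w :* P := v :* w :* (p :* P)) ≡.refl v w p (pow p M)) e)))
    (solve 4 (λ v u s W → :- v :* u :* (s :* W) := :- v :* s :* (W :* u)) ≡.refl v (1# - w * pow p M) _ _))
    where
    vwP≈1 : v * w * pow p M ≈ 1#
    vwP≈1 = cancelˡ up (trans (solve 4 (λ v w p P → p :* (v :* w :* P) := v :* w :* (p :* P)) ≡.refl v w p (pow p M))
      (trans e (sym (*-identityʳ p))))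
    head : 1# - v ≈ - v * (1# - w * pow p M)
    head = trans (+-congʳ (sym vwP≈1))
      (solve 3 (λ v w P → v :* w :* P :- v := :- v :* (:1 :- w :* P)) ≡.refl v w (pow p M))

-- With p = q⁸, x̄ = 1/x and z = q⁻⁴, the paper's (1 - q)² (1 - q²) α(k) is weight k * (z^k * c k).
module LinearSum (R : CommutativeRing 0ℓ 0ℓ) (p q x x̄ z : CommutativeRing.Carrier R) where
  open CommutativeRing R
  open Solver R
  open Kit R
  open Reversal R p
  open Watson R p
  open import Relation.Binary.Reasoning.Setoid setoid

  a : Carrier
  a = q * q

  num den : ℕ → Carrier
  num k = (1# - a * P k) * (1# - a * P k) * ((1# - x * a * P k) * (1# - x̄ * a * P k))
  den k = (1# - p * P k) * (1# - p * P k) * ((1# - x * (p * P k)) * (1# - x̄ * (p * P k)))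

  weight : ℕ → Carrier
  weight k = (1# - q * P k) * (1# - q * P k) * (1# - a * (P k * P k))

  numeratorE : Carrier
  numeratorE = (1# - q) * (1# - q) * (1# + a) - (1# - x * a) * (1# - x̄ * a)

  module _
    (xx̄≈1 : x * x̄ ≈ 1#) (za²≈1 : z * (a * a) ≈ 1#) (M : ℕ) (x≈ : x ≈ a * P M)
    (up : Unit p) (uP : ∀ j → Unit (1# - P (suc j))) (uA : ∀ j → Unit (1# - a * P j))
    (uX : ∀ j → Unit (1# - x̄ * P (suc j))) (uxa : Unit (1# - x * a))
    (c : ℕ → Carrier) (c₀ : c 0 ≈ 1#) (c-step : ∀ k → c (suc k) * den k ≈ c k * num k)
    where
    private
      y : Carrier
      y = x̄ * (z * a)

      N : Carrier
      N = P M

      x̄aN≈1 : x̄ * (a * N) ≈ 1#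
      x̄aN≈1 = trans (*-congˡ (sym x≈)) (trans (*-comm _ _) xx̄≈1)

      yc≈1 : y * (x * a) ≈ 1#
      yc≈1 = trans (solve 4 (λ x x̄ z a → x̄ :* (z :* a) :* (x :* a) := (x :* x̄) :* (z :* (a :* a))) ≡.refl x x̄ z a)
        (trans (*-cong xx̄≈1 za²≈1) (*-identityˡ 1#))

      yb≈x̄ : y * a ≈ x̄
      yb≈x̄ = trans (solve 3 (λ x̄ z a → x̄ :* (z :* a) :* a := x̄ :* (z :* (a :* a))) ≡.refl x̄ z a)
        (trans (*-congˡ za²≈1) (*-identityʳ x̄))

      yN≈z : y * N ≈ z
      yN≈z = trans (solve 4 (λ x̄ z a N → x̄ :* (z :* a) :* N := x̄ :* (a :* N) :* z) ≡.refl x̄ z a N)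
        (trans (*-congʳ x̄aN≈1) (*-identityˡ z))

      -- As `x = a p^M`, the factor `(q²/x; p)_k` is `(p^(-M); p)_k` and terminates the series; its
      -- partner is `(x p; p)_k`. The parameters `a` and `x a` have the partners `p` and `p/x`, and
      -- the argument `y p^M` is `z`.
      par : Parameters
      par = record
        { h = q ; b = a ; c = x * a ; y = y
        ; h²≈ybc = sym (trans (solve 3 (λ y a c → y :* (a :* c) := a :* (y :* c)) ≡.refl y a (x * a))
            (trans (*-congˡ yc≈1) (*-identityʳ a)))
        ; unit-p = uP
        ; unit-a = λ j → uA (suc j)
        ; unit-b = λ j → unit-resp (+-congˡ (-‿cong (sym (trans (*-congʳ yc≈1) (*-identityˡ _))))) (uP j)
        ; unit-c = λ j → unit-resp (+-congˡ (-‿cong (*-congʳ (sym yb≈x̄)))) (uX j) }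

      module Se = Series par

      D≈ : ∀ k → Se.D M k ≈ den k
      D≈ k = trans (*-cong (*-congˡ (*-cong
          (+-congˡ (-‿cong (trans (*-congʳ yc≈1) (*-identityˡ _))))
          (+-congˡ (-‿cong (*-congʳ yb≈x̄)))))
          (+-congˡ (-‿cong (trans (solve 4 (λ a p N P → a :* (p :* (N :* P)) := a :* N :* (p :* P)) ≡.refl a p N (P k))
            (*-congʳ (sym x≈))))))
        (solve 3 (λ u v w → u :* (u :* v) :* w := u :* u :* (w :* v)) ≡.refl _ _ _)

      N≈ : ∀ k → Se.N M k ≈ num k * z
      N≈ k = trans (*-congˡ factor)
        (solve 4 (λ u v w z → u :* (u :* v) :* (z :* w) := u :* u :* (v :* w) :* z) ≡.refl _ _ _ z)
        where
        factor : (P M - P k) * y ≈ z * (1# - x̄ * a * P k)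
        factor = trans (solve 3 (λ N P y → (N :- P) :* y := y :* N :- y :* P) ≡.refl N (P k) y)
          (trans (+-congʳ yN≈z)
            (solve 4 (λ x̄ z a P → z :- x̄ :* (z :* a) :* P := z :* (:1 :- x̄ :* a :* P)) ≡.refl x̄ z a (P k)))

      f≈ : ∀ k → Se.f M k ≈ pow z k * c k
      f≈ zero = sym (trans (*-identityˡ _) c₀)
      f≈ (suc k) = cancelˡ (Se.unit-D M k) (begin
        Se.D M k * Se.f M (suc k)         ≈⟨ *-comm _ _ ⟩
        Se.f M (suc k) * Se.D M k         ≈⟨ Se.f-step M k ⟩
        Se.f M k * Se.N M k               ≈⟨ *-cong (f≈ k) (N≈ k) ⟩
        pow z k * c k * (num k * z)
          ≈⟨ solve 4 (λ w c n z → w :* c :* (n :* z) := z :* w :* (c :* n)) ≡.refl (pow z k) (c k) (num k) z ⟩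
        z * pow z k * (c k * num k)       ≈⟨ *-congˡ (c-step k) ⟨
        z * pow z k * (c (suc k) * den k)
          ≈⟨ solve 3 (λ w c d → w :* (c :* d) := d :* (w :* c)) ≡.refl (z * pow z k) (c (suc k)) (den k) ⟩
        den k * (z * pow z k * c (suc k)) ≈⟨ *-congʳ (D≈ k) ⟨
        Se.D M k * (z * pow z k * c (suc k)) ∎)

      S : Carrier
      S = sum (suc M) (λ k → weight k * (pow z k * c k))

      S≈ : Se.S M ≈ S
      S≈ = sum-cong (suc M) λ k _ → *-congˡ (f≈ k)

      A₀ Pp B₂ C₂ Br s : Carrier
      A₀ = poch a p M
      Pp = poch p p M
      B₂ = poch (a * a * p) p M
      C₂ = poch (a * a) p M
      Br = Se.bracket M
      s = σ M y

      uy : Unit y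
      uy = mkUnit (x * a) yc≈1

      -- Both `(y a p; p)_M` and `(y; p)_M` are read backwards. This produces the same `s` on either
      -- side, which `step₂` cancels together with `A₀`.
      step₁ : (1# - y) * S * (Pp * (pow (a * p) M * s * A₀)) ≈ A₀ * (1# - x) * (s * B₂) * Br
      step₁ = begin
        (1# - y) * S * (Pp * (pow (a * p) M * s * A₀))
          ≈⟨ *-cong (*-congˡ S≈) (*-cong (poch-cong p M (trans (*-congʳ yc≈1) (*-identityˡ p)))
               (trans (poch-reverse up M
                   (trans (solve 5 (λ y a p N x̄ → y :* a :* p :* a :* N := y :* a :* (a :* N) :* p) ≡.refl y a p N x̄)
                     (trans (*-congʳ (trans (*-congʳ yb≈x̄) x̄aN≈1)) (*-identityˡ p))))
                 (*-congʳ (trans (σ-cong M (*-assoc y a p)) (σ-* M y (a * p)))))) ⟨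
        (1# - y) * Se.S M * (poch (y * (x * a) * p) p M * poch (y * a * p) p M)
          ≈⟨ watson par M ⟩
        (1# - a) * (poch (a * p) p M * poch y p M) * Br
          ≈⟨ *-congʳ (trans (*-congˡ (*-congˡ (poch-reverse up M
               (trans (solve 4 (λ y a p N → y :* (a :* a :* p) :* N := y :* a :* (a :* N) :* p) ≡.refl y a p N)
                     (trans (*-congʳ (trans (*-congʳ yb≈x̄) x̄aN≈1)) (*-identityˡ p))))))
               (trans (sym (*-assoc _ _ _)) (*-congʳ (trans (sym (poch-head a p M)) (*-congˡ (+-congˡ (-‿cong (sym x≈)))))))) ⟩
        A₀ * (1# - x) * (s * B₂) * Br ∎

      step₂ : (1# - y) * S * Pp * pow (a * p) M ≈ (1# - x) * B₂ * Br
      step₂ = cancelˡ (unit-* (unit-σ M up uy) (unit-poch M uA)) (begin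
        s * A₀ * ((1# - y) * S * Pp * pow (a * p) M)
          ≈⟨ solve 6 (λ s A y S P w → s :* A :* (y :* S :* P :* w) := y :* S :* (P :* (w :* s :* A))) ≡.refl s A₀ (1# - y) S Pp _ ⟩
        (1# - y) * S * (Pp * (pow (a * p) M * s * A₀))   ≈⟨ step₁ ⟩
        A₀ * (1# - x) * (s * B₂) * Br
          ≈⟨ solve 5 (λ s A x B r → A :* x :* (s :* B) :* r := s :* A :* (x :* B :* r)) ≡.refl s A₀ (1# - x) B₂ Br ⟩
        s * A₀ * ((1# - x) * B₂ * Br) ∎)

      B₂≈ : (1# - a * a) * B₂ ≈ C₂ * (1# - x * a)
      B₂≈ = trans (sym (poch-head (a * a) p M)) (*-congˡ (+-congˡ (-‿cong
        (trans (solve 2 (λ a N → a :* a :* N := a :* N :* a) ≡.refl a N) (*-congʳ (sym x≈))))))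

      1-y≈ : 1# - y ≈ - y * (1# - x * a)
      1-y≈ = trans (+-congʳ (sym yc≈1)) (solve 2 (λ y c → y :* c :- y := :- y :* (:1 :- c)) ≡.refl y (x * a))

      step₃ : - y * (S * Pp * pow (a * p) M * (1# - a * a)) ≈ (1# - x) * C₂ * Br
      step₃ = cancelˡ uxa (begin
        (1# - x * a) * (- y * (S * Pp * pow (a * p) M * (1# - a * a)))
          ≈⟨ solve 6 (λ u y S P w A → u :* (:- y :* (S :* P :* w :* A)) := A :* ((:- y :* u) :* S :* P :* w)) ≡.refl (1# - x * a) y S Pp _ (1# - a * a) ⟩
        (1# - a * a) * ((- y * (1# - x * a)) * S * Pp * pow (a * p) M)
          ≈⟨ *-congˡ (*-congʳ (*-congʳ (*-congʳ 1-y≈))) ⟨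
        (1# - a * a) * ((1# - y) * S * Pp * pow (a * p) M)   ≈⟨ *-congˡ step₂ ⟩
        (1# - a * a) * ((1# - x) * B₂ * Br)
          ≈⟨ solve 4 (λ A x B r → A :* (x :* B :* r) := x :* (A :* B) :* r) ≡.refl (1# - a * a) (1# - x) B₂ Br ⟩
        (1# - x) * ((1# - a * a) * B₂) * Br    ≈⟨ *-congʳ (*-congˡ B₂≈) ⟩
        (1# - x) * (C₂ * (1# - x * a)) * Br
          ≈⟨ solve 4 (λ x C u r → x :* (C :* u) :* r := u :* (x :* C :* r)) ≡.refl (1# - x) C₂ (1# - x * a) Br ⟩
        (1# - x * a) * ((1# - x) * C₂ * Br) ∎)

      a²Br≈ : a * a * Br ≈ - (1# - a) * numeratorE
      a²Br≈ = begin
        a * a * Br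
          ≈⟨ solve 5 (λ q x a y N → a :* a :* ((:1 :- q) :* (:1 :- q) :* (:1 :- y :* N)
                 :- y :* (:1 :- a) :* (:1 :- x :* a) :* (:1 :- N))
               := a :* a :* (:1 :- q) :* (:1 :- q) :* (:1 :- y :* N)
                 :- (:1 :- a) :* (:1 :- x :* a) :* (y :* a :* a :- y :* a :* (a :* N))) ≡.refl q x a y N ⟩
        a * a * (1# - q) * (1# - q) * (1# - y * N) - (1# - a) * (1# - x * a) * (y * a * a - y * a * (a * N))
          ≈⟨ +-cong (*-congˡ (+-congˡ (-‿cong yN≈z))) (-‿cong (*-congˡ (+-cong (*-congʳ yb≈x̄)
               (-‿cong (trans (*-congʳ yb≈x̄) x̄aN≈1))))) ⟩
        a * a * (1# - q) * (1# - q) * (1# - z) - (1# - a) * (1# - x * a) * (x̄ * a - 1#)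
          ≈⟨ solve 5 (λ q x x̄ a z → a :* a :* (:1 :- q) :* (:1 :- q) :* (:1 :- z) :- (:1 :- a) :* (:1 :- x :* a) :* (x̄ :* a :- :1)
               := (:1 :- q) :* (:1 :- q) :* (a :* a :- z :* (a :* a)) :- (:1 :- a) :* (:1 :- x :* a) :* (x̄ :* a :- :1)) ≡.refl q x x̄ a z ⟩
        (1# - q) * (1# - q) * (a * a - z * (a * a)) - (1# - a) * (1# - x * a) * (x̄ * a - 1#)
          ≈⟨ +-congʳ (*-congˡ (+-congˡ (-‿cong za²≈1))) ⟩
        (1# - q) * (1# - q) * (a * a - 1#) - (1# - a) * (1# - x * a) * (x̄ * a - 1#)
          ≈⟨ solve 4 (λ q x x̄ a → (:1 :- q) :* (:1 :- q) :* (a :* a :- :1) :- (:1 :- a) :* (:1 :- x :* a) :* (x̄ :* a :- :1)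
               := :- (:1 :- a) :* ((:1 :- q) :* (:1 :- q) :* (:1 :+ a) :- (:1 :- x :* a) :* (:1 :- x̄ :* a))) ≡.refl q x x̄ a ⟩
        - (1# - a) * numeratorE ∎

    -- For `p = q⁸` the factor `1 - x` is `1 - q^(2n)`, the numerator of the `q²`-integer of
    -- `n = 4 M + 1`, and `C₂ / Pp` is the quotient of Pochhammer symbols on the right-hand side of
    -- the theorem.
    linear-sum : S * (Pp * pow a M * (1# + a)) ≈ (1# - x) * C₂ * numeratorE
    linear-sum = cancelˡ (unit-neg (unit-resp (+-congˡ (-‿cong (*-identityʳ a))) (uA 0))) (begin
      - (1# - a) * (S * (Pp * pow a M * (1# + a)))
        ≈⟨ *-congʳ (trans (sym (*-identityˡ _)) (*-congʳ (sym x̄aN≈1))) ⟩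
      x̄ * (a * N) * (- (1# - a)) * (S * (Pp * pow a M * (1# + a)))
        ≈⟨ *-congʳ (*-congʳ (*-congʳ (sym yb≈x̄))) ⟩
      y * a * (a * N) * (- (1# - a)) * (S * (Pp * pow a M * (1# + a)))
        ≈⟨ solve 6 (λ y a N S P w → y :* a :* (a :* N) :* (:- (:1 :- a)) :* (S :* (P :* w :* (:1 :+ a)))
             := a :* a :* (:- y :* (S :* P :* (w :* N) :* (:1 :- a :* a)))) ≡.refl y a N S Pp (pow a M) ⟩
      a * a * (- y * (S * Pp * (pow a M * N) * (1# - a * a)))
        ≈⟨ *-congˡ (*-congˡ (*-congʳ (*-congˡ (pow-distrib a p M)))) ⟨
      a * a * (- y * (S * Pp * pow (a * p) M * (1# - a * a)))   ≈⟨ *-congˡ step₃ ⟩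
      a * a * ((1# - x) * C₂ * Br)
        ≈⟨ solve 4 (λ a x C r → a :* (x :* C :* r) := x :* C :* (a :* r)) ≡.refl (a * a) (1# - x) C₂ Br ⟩
      (1# - x) * C₂ * (a * a * Br)              ≈⟨ *-congˡ a²Br≈ ⟩
      (1# - x) * C₂ * (- (1# - a) * numeratorE)
        ≈⟨ solve 4 (λ x C u e → x :* C :* (u :* e) := u :* (x :* C :* e)) ≡.refl (1# - x) C₂ (- (1# - a)) numeratorE ⟩
      - (1# - a) * ((1# - x) * C₂ * numeratorE) ∎)

-- Convolutions and sums at roots of unity

module Convolution (R : CommutativeRing 0ℓ 0ℓ) (α : ℕ → CommutativeRing.Carrier R) where
  open CommutativeRing R
  open Solver R
  open Kit R

  s t u : ℕ → Carrier
  s k = sum (suc k) λ j → α j * α (k ℕ.∸ j)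
  t k = sum (suc k) λ j → sum (suc (k ℕ.∸ j)) λ i → α j * α i * α (k ℕ.∸ j ℕ.∸ i)
  u k = sum (suc k) λ j → sum (suc (k ℕ.∸ j)) λ i → sum (suc (k ℕ.∸ j ℕ.∸ i)) λ h →
    α j * α i * α h * α (k ℕ.∸ j ℕ.∸ i ℕ.∸ h)

  conv : (ℕ → Carrier) → ℕ → Carrier
  conv f k = sum (suc k) λ j → α j * f (k ℕ.∸ j)

  t≈ : ∀ k → t k ≈ conv s k
  t≈ k = sum-cong (suc k) λ j _ → trans
    (sum-cong (suc (k ℕ.∸ j)) λ i _ → *-assoc _ _ _)
    (sum-*ˡ (suc (k ℕ.∸ j)) (α j) _)

  u≈ : ∀ k → u k ≈ conv t k
  u≈ k = sum-cong (suc k) λ j _ → trans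
    (sum-cong (suc (k ℕ.∸ j)) λ i _ → trans
      (sum-cong (suc (k ℕ.∸ j ℕ.∸ i)) λ h _ →
        solve 4 (λ a b c d → a :* b :* c :* d := a :* (b :* c :* d)) ≡.refl _ _ _ _)
      (sum-*ˡ (suc (k ℕ.∸ j ℕ.∸ i)) (α j) _))
    (sum-*ˡ (suc (k ℕ.∸ j)) (α j) _)

  -- The triangle `j + i < n` is summed row by row, which reduces sums of convolutions to partial
  -- sums of `f`.
  sum-conv : ∀ n f → sum n (conv f) ≈ sum n (λ j → α j * sum (n ℕ.∸ j) f)
  sum-conv zero f = refl
  sum-conv (suc n) f = trans (+-congʳ (sum-conv n f))
    (trans (solve 3 (λ a b c → a :+ (b :+ c) := (a :+ b) :+ c) ≡.refl _ _ _)
    (+-cong (trans (sym (sum-+ n _ _)) (sum-cong n λ j j<n → trans (sym (distribˡ _ _ _))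
        (*-congˡ (reflexive (≡.sym (≡.cong (λ m → sum m f) (ℕₚ.+-∸-assoc 1 (ℕₚ.<⇒≤ j<n))))))))
      (*-congˡ (trans (reflexive (≡.cong f (ℕₚ.n∸n≡0 n))) (trans (sym (+-identityˡ _))
        (reflexive (≡.cong (λ m → sum m f) (≡.sym (ℕₚ.m+n∸n≡m 1 n)))))))))

  module Concentrated (M : ℕ) (vanish : ∀ j → M ℕ.< j → α j ≈ 0#) where
    β : Carrier
    β = sum (suc M) α

    sum-α : ∀ N → M ℕ.< N → sum N α ≈ β
    sum-α N M<N with ℕₚ.≤⇒≤′ M<N
    ... | ℕ.≤′-reflexive ≡.refl = refl
    ... | ℕ.≤′-step {n} l = trans (+-cong (sum-α n (ℕₚ.≤′⇒≤ l)) (vanish n (ℕₚ.≤′⇒≤ l))) (+-identityʳ β)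

    -- For `j` up to `M` the inner sum still has more than `m` terms and has reached its final value
    -- `B`; for larger `j` the factor `α j` is zero.
    conv-power : ∀ {f m B} → (∀ N → m ℕ.< N → sum N f ≈ B) → ∀ N → M ℕ.+ m ℕ.< N → sum N (conv f) ≈ β * B
    conv-power {f} {m} {B} hyp N lt = trans (sum-conv N f)
      (trans (sum-cong N λ j _ → term j)
      (trans (sum-cong N λ j _ → *-comm (α j) B)
      (trans (sum-*ˡ N B α) (trans (*-comm _ _) (*-congʳ (sum-α N (ℕₚ.≤-<-trans (ℕₚ.m≤m+n M m) lt)))))))
      where
      term : ∀ j → α j * sum (N ℕ.∸ j) f ≈ α j * B
      term j with j ℕ.≤? M
      ... | yes j≤M = *-congˡ (hyp (N ℕ.∸ j) (ℕₚ.m+n≤o⇒m≤o∸n (suc m)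
              (ℕₚ.≤-trans (ℕ.s≤s (ℕₚ.≤-trans (ℕₚ.+-monoʳ-≤ m j≤M) (ℕₚ.≤-reflexive (ℕₚ.+-comm m M)))) lt)))
      ... | no j≰M = trans (*-congʳ z) (trans (zeroˡ _) (sym (trans (*-congʳ z) (zeroˡ _))))
        where z = vanish j (ℕₚ.≰⇒> j≰M)

    sum-s : ∀ N → M ℕ.+ M ℕ.< N → sum N s ≈ β * β
    sum-s = conv-power sum-α

    sum-t : ∀ N → M ℕ.+ (M ℕ.+ M) ℕ.< N → sum N t ≈ β * (β * β)
    sum-t N lt = trans (sum-cong N λ k _ → t≈ k) (conv-power sum-s N lt)

    sum-u : ∀ N → M ℕ.+ (M ℕ.+ (M ℕ.+ M)) ℕ.< N → sum N u ≈ β * (β * (β * β))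
    sum-u N lt = trans (sum-cong N λ k _ → u≈ k) (conv-power sum-t N lt)

  module Periodic (d m : ℕ) .{{_ : ℕ.NonZero d}}
    (vanish : ∀ j → m ℕ.< j % d → α j ≈ 0#) where

    Outside : ℕ → ℕ → Set
    Outside c N = N % d ≡ 0 ⊎ c ℕ.< N % d

    Vanishes : ℕ → (ℕ → Carrier) → Set
    Vanishes c F = ∀ N → Outside c N → F N ≈ 0#

    outside? : ∀ c N → Outside c N ⊎ (0 ℕ.< N % d × N % d ℕ.≤ c)
    outside? c N with N % d ℕ.≟ 0 | c ℕ.<? N % d
    ... | yes z | _ = inj₁ (inj₁ z)
    ... | no _ | yes l = inj₁ (inj₂ l)
    ... | no nz | no nl = inj₂ (ℕₚ.n≢0⇒n>0 nz , ℕₚ.≮⇒≥ nl)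

    -- A nonzero term requires `j % d` to be at most `m` and `(N ∸ j) % d` to lie between 1 and `c`.
    -- As `m + c < d`, these residues add without a carry, so `N % d` lies between 1 and `m + c`.
    conv-vanishes : ∀ {c f} → m ℕ.+ c ℕ.< d → Vanishes c (λ N → sum N f) → Vanishes (m ℕ.+ c) (λ N → sum N (conv f))
    conv-vanishes {c} {f} small hyp N out = trans (sum-conv N f) (sum-zero N term)
      where
      term : ∀ j → j ℕ.< N → α j * sum (N ℕ.∸ j) f ≈ 0#
      term j j<N with m ℕ.<? j % d | outside? c (N ℕ.∸ j)
      ... | yes l | _ = trans (*-congʳ (vanish j l)) (zeroˡ _)
      ... | no _ | inj₁ o = trans (*-congˡ (hyp (N ℕ.∸ j) o)) (zeroʳ _)
      ... | no l | inj₂ (lo , hi) = ⊥-elim ([ no-zero , no-large ]′ out)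
        where
        bound : j % d ℕ.+ (N ℕ.∸ j) % d ℕ.≤ m ℕ.+ c
        bound = ℕₚ.+-mono-≤ (ℕₚ.≮⇒≥ l) hi
        N%d : N % d ≡ j % d ℕ.+ (N ℕ.∸ j) % d
        N%d = ≡.trans (≡.cong (_% d) (≡.sym (ℕₚ.m+[n∸m]≡n (ℕₚ.<⇒≤ j<N))))
          (≡.trans (DivMod.%-distribˡ-+ j (N ℕ.∸ j) d) (DivMod.m<n⇒m%n≡m (ℕₚ.≤-<-trans bound small)))
        no-zero : ¬ N % d ≡ 0
        no-zero z = ℕₚ.<⇒≢ (ℕₚ.<-≤-trans lo (ℕₚ.m≤n+m _ (j % d))) (≡.trans (≡.sym z) N%d)
        no-large : ¬ m ℕ.+ c ℕ.< N % d
        no-large g = ℕₚ.<⇒≱ g (ℕₚ.≤-trans (ℕₚ.≤-reflexive N%d) bound)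

    module _ (small : m ℕ.+ (m ℕ.+ (m ℕ.+ m)) ℕ.< d) (hyp : Vanishes m (λ N → sum N α)) where
      private
        drop : ∀ {c} → m ℕ.+ c ℕ.< d → c ℕ.< d
        drop = ℕₚ.≤-<-trans (ℕₚ.m≤n+m _ m)

      s-vanishes : Vanishes (m ℕ.+ m) (λ N → sum N s)
      s-vanishes = conv-vanishes (drop (drop small)) hyp

      t-vanishes : Vanishes (m ℕ.+ (m ℕ.+ m)) (λ N → sum N t)
      t-vanishes N o = trans (sum-cong N λ k _ → t≈ k) (conv-vanishes (drop small) s-vanishes N o)

      u-vanishes : Vanishes (m ℕ.+ (m ℕ.+ (m ℕ.+ m))) (λ N → sum N u)
      u-vanishes N o = trans (sum-cong N λ k _ → u≈ k) (conv-vanishes small t-vanishes N o)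

module Products (R : CommutativeRing 0ℓ 0ℓ) where
  open CommutativeRing R
  open Solver R
  open Kit R

  prod : ℕ → (ℕ → Carrier) → Carrier
  prod zero f = 1#
  prod (suc n) f = prod n f * f n

  prod-cong : ∀ n {f g} → (∀ i → i ℕ.< n → f i ≈ g i) → prod n f ≈ prod n g
  prod-cong zero e = refl
  prod-cong (suc n) e = *-cong (prod-cong n λ i l → e i (ℕₚ.m<n⇒m<1+n l)) (e n ℕₚ.≤-refl)

  prod-* : ∀ n f g → prod n (λ i → f i * g i) ≈ prod n f * prod n g
  prod-* zero f g = sym (*-identityˡ _)
  prod-* (suc n) f g = trans (*-congʳ (prod-* n f g))
    (solve 4 (λ a b c d → (a :* b) :* (c :* d) := (a :* c) :* (b :* d)) ≡.refl _ _ _ _)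

  prod-const : ∀ n {c f} → (∀ i → i ℕ.< n → f i ≈ c) → prod n f ≈ pow c n
  prod-const zero e = refl
  prod-const (suc n) e = trans (*-cong (prod-const n λ i l → e i (ℕₚ.m<n⇒m<1+n l)) (e n ℕₚ.≤-refl)) (*-comm _ _)

  prod-head : ∀ n f → prod (suc n) f ≈ f 0 * prod n (λ i → f (suc i))
  prod-head zero f = *-comm _ _
  prod-head (suc n) f = trans (*-congʳ (prod-head n f)) (*-assoc _ _ _)

  prod-reverse : ∀ n {f g} → (∀ k j → suc (k ℕ.+ j) ≡ n → f k ≈ g j) → prod n f ≈ prod n g
  prod-reverse zero e = refl
  prod-reverse (suc n) {f} {g} e = trans (*-cong
      (prod-reverse n λ k j h → e k (suc j) (≡.cong suc (≡.trans (ℕₚ.+-suc k j) h)))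
      (e n 0 (≡.cong suc (ℕₚ.+-identityʳ n))))
    (trans (*-comm _ _) (sym (prod-head n g)))

  unit-prod : ∀ n {f} → (∀ i → i ℕ.< n → Unit (f i)) → Unit (prod n f)
  unit-prod zero e = unit-1
  unit-prod (suc n) e = unit-* (unit-prod n λ i l → e i (ℕₚ.m<n⇒m<1+n l)) (e n ℕₚ.≤-refl)

  sum-reverse : ∀ n {f g} → (∀ k j → suc (k ℕ.+ j) ≡ n → f k ≈ g j) → sum n f ≈ sum n g
  sum-reverse zero e = refl
  sum-reverse (suc n) {f} {g} e = trans (+-cong
      (sum-reverse n λ k j h → e k (suc j) (≡.cong suc (≡.trans (ℕₚ.+-suc k j) h)))
      (e n 0 (≡.cong suc (ℕₚ.+-identityʳ n))))
    (trans (+-comm _ _) (sym (sum-head n g)))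

  sum-split : ∀ m n f → sum (m ℕ.+ n) f ≈ sum m f + sum n (λ i → f (m ℕ.+ i))
  sum-split m zero f rewrite ℕₚ.+-identityʳ m = sym (+-identityʳ _)
  sum-split m (suc n) f rewrite ℕₚ.+-suc m n = trans (+-congʳ (sum-split m n f)) (+-assoc _ _ _)

module Recurrence (R : CommutativeRing 0ℓ 0ℓ) (c num den : ℕ → CommutativeRing.Carrier R) where
  open CommutativeRing R
  open Kit R

  module _ (step : ∀ k → c (suc k) * den k ≈ c k * num k) (unit-den : ∀ k → Unit (den k))
    (M : ℕ) (num-M≈0 : num M ≈ 0#) where

    vanishes-beyond : ∀ j → M ℕ.< j → c j ≈ 0#
    vanishes-beyond (suc j) (ℕ.s≤s M≤j) = cancelˡ (unit-den j)
      (trans (*-comm _ _) (trans (step j) (trans (product (ℕₚ.m≤n⇒m<n∨m≡n M≤j)) (sym (zeroʳ _)))))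
      where
      product : M ℕ.< j ⊎ M ≡ j → c j * num j ≈ 0#
      product (inj₁ lt) = trans (*-congʳ (vanishes-beyond j lt)) (zeroˡ _)
      product (inj₂ ≡.refl) = trans (*-congˡ num-M≈0) (zeroʳ _)

module Geometric (R : CommutativeRing 0ℓ 0ℓ) where
  open CommutativeRing R
  open Solver R
  open Kit R
  open Divisibility R

  geom : Carrier → ℕ → Carrier
  geom u s = sum s (pow u)

  geom-sum : ∀ u s → (1# - u) * geom u s ≈ 1# - pow u s
  geom-sum u zero = solve 1 (λ u → (:1 :- u) :* :0 := :1 :- :1) ≡.refl u
  geom-sum u (suc s) = trans (distribˡ _ _ _) (trans (+-congʳ (geom-sum u s))
    (solve 2 (λ u w → :1 :- w :+ (:1 :- u) :* w := :1 :- u :* w) ≡.refl u (pow u s)))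

  1-u∣1-pow : ∀ u s → 1# - u ∣ 1# - pow u s
  1-u∣1-pow u s = ∣-resp (geom-sum u s) (∣-*ʳ (geom u s) ∣-refl)

  geom-mod : ∀ u s → 1# - u ∣ geom u s - ι s
  geom-mod u zero = ∣-resp (sym (-‿inverseʳ 0#)) ∣0
  geom-mod u (suc s) = ∣-resp
    (solve 3 (λ S w i → S :- i :- (:1 :- w) := S :+ w :- (:1 :+ i)) ≡.refl (geom u s) (pow u s) (ι s))
    (∣-- (geom-mod u s) (1-u∣1-pow u s))

module RootOfUnitySum (R : CommutativeRing 0ℓ 0ℓ) (p q x x̄ z : CommutativeRing.Carrier R) where
  open CommutativeRing R
  open Solver R
  open Kit R
  open Products R
  open LinearSum R p q x x̄ z using (a; num; den; weight)
  open import Relation.Binary.Reasoning.Setoid setoid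

  private
    P : ℕ → Carrier
    P = pow p

  module _
    (xx̄≈1 : x * x̄ ≈ 1#) (za²≈1 : z * (a * a) ≈ 1#)
    (d m : ℕ) .{{_ : ℕ.NonZero d}} (1+m<d : suc m ℕ.< d)
    (aPm≈1 : a * P m ≈ 1#) (Pd≈1 : P d ≈ 1#) (zd≈1 : pow z d ≈ 1#)
    (two : Unit (1# + 1#)) (up : Unit p)
    (c : ℕ → Carrier) (c₀ : c 0 ≈ 1#) (c-step : ∀ k → c (suc k) * den k ≈ c k * num k)
    (unit-den : ∀ k → suc k ℕ.< d → Unit (den k))
    where

    term : ℕ → Carrier
    term k = weight k * (pow z k * c k)

    private
      Z : Carrier
      Z = a * a

      uZ : Unit Z
      uZ = mkUnit z (trans (*-comm _ _) za²≈1)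

      m<d : m ℕ.< d
      m<d = ℕₚ.<-trans (ℕₚ.n<1+n m) 1+m<d

      periodic : ∀ w → pow w d ≈ 1# → ∀ l k → pow w (l ℕ.* d ℕ.+ k) ≈ pow w k
      periodic w e l k = trans (pow-+ w (l ℕ.* d) k) (trans (*-congʳ
        (trans (reflexive (≡.cong (pow w) (ℕₚ.*-comm l d))) (trans (pow-* w d l)
          (trans (pow-cong l e) (pow-1 l))))) (*-identityˡ _))

      P≈ : ∀ l k → P (l ℕ.* d ℕ.+ k) ≈ P k
      P≈ = periodic p Pd≈1

      1-congʳ : ∀ {u v} w → u ≈ v → 1# - w * u ≈ 1# - w * v
      1-congʳ w e = +-congˡ (-‿cong (*-congˡ e))

      num≈ : ∀ l k → num (l ℕ.* d ℕ.+ k) ≈ num k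
      num≈ l k = *-cong (*-cong (1-congʳ a e) (1-congʳ a e)) (*-cong (1-congʳ _ e) (1-congʳ _ e))
        where e = P≈ l k

      den≈ : ∀ l k → den (l ℕ.* d ℕ.+ k) ≈ den k
      den≈ l k = *-cong (*-cong (1-congʳ p e) (1-congʳ p e)) (*-cong (1-congʳ x (*-congˡ e)) (1-congʳ x̄ (*-congˡ e)))
        where e = P≈ l k

      weight≈ : ∀ l k → weight (l ℕ.* d ℕ.+ k) ≈ weight k
      weight≈ l k = *-cong (*-cong (1-congʳ q e) (1-congʳ q e)) (1-congʳ a (*-cong e e))
        where e = P≈ l k

      -- Inside a block the denominators are units and the recurrence determines `c` from its first
      -- value. The step into a new block divides by a non-unit, so `c (l * d)` stays an unspecified
      -- constant.
      c≈ : ∀ l k → k ℕ.< d → c (l ℕ.* d ℕ.+ k) ≈ c (l ℕ.* d) * c k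
      c≈ l zero _ = trans (reflexive (≡.cong c (ℕₚ.+-identityʳ _)))
        (sym (trans (*-congˡ c₀) (*-identityʳ _)))
      c≈ l (suc k) lt = cancelˡ (unit-den k lt) (begin
        den k * c (l ℕ.* d ℕ.+ suc k)         ≡⟨ ≡.cong (λ i → den k * c i) (ℕₚ.+-suc _ k) ⟩
        den k * c (suc (l ℕ.* d ℕ.+ k))       ≈⟨ trans (*-comm _ _) (*-congˡ (sym (den≈ l k))) ⟩
        c (suc (l ℕ.* d ℕ.+ k)) * den (l ℕ.* d ℕ.+ k)   ≈⟨ c-step (l ℕ.* d ℕ.+ k) ⟩
        c (l ℕ.* d ℕ.+ k) * num (l ℕ.* d ℕ.+ k)
          ≈⟨ *-cong (c≈ l k (ℕₚ.<-trans (ℕₚ.n<1+n k) lt)) (num≈ l k) ⟩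
        c (l ℕ.* d) * c k * num k             ≈⟨ *-assoc _ _ _ ⟩
        c (l ℕ.* d) * (c k * num k)           ≈⟨ *-congˡ (c-step k) ⟨
        c (l ℕ.* d) * (c (suc k) * den k)
          ≈⟨ solve 3 (λ u v w → u :* (v :* w) := w :* (u :* v)) ≡.refl _ _ _ ⟩
        den k * (c (l ℕ.* d) * c (suc k)) ∎)

      term≈ : ∀ l k → k ℕ.< d → term (l ℕ.* d ℕ.+ k) ≈ c (l ℕ.* d) * term k
      term≈ l k lt = trans (*-cong (weight≈ l k) (*-cong (periodic z zd≈1 l k) (c≈ l k lt)))
        (solve 4 (λ w z u v → w :* (z :* (u :* v)) := u :* (w :* (z :* v))) ≡.refl _ _ _ _)

      -- `num m` contains the factor `1 - a P_m`, which is zero, and up to the end of the block the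
      -- recurrence can be solved for the next coefficient.
      c-vanishes : ∀ i → suc m ℕ.+ i ℕ.< d → c (suc m ℕ.+ i) ≈ 0#
      c-vanishes i lt = cancelˡ (unit-den (m ℕ.+ i) lt) (trans (*-comm _ _) (trans (c-step (m ℕ.+ i))
          (trans (vanishing i lt) (sym (zeroʳ _)))))
        where
        vanishing : ∀ i → suc m ℕ.+ i ℕ.< d → c (m ℕ.+ i) * num (m ℕ.+ i) ≈ 0#
        vanishing zero lt rewrite ℕₚ.+-identityʳ m = trans (*-congˡ (*-congʳ (*-congʳ
            (trans (+-congˡ (-‿cong aPm≈1)) (-‿inverseʳ 1#)))))
          (solve 3 (λ c u v → c :* (:0 :* u :* v) := :0) ≡.refl _ _ _)
        vanishing (suc i) lt = trans (*-congʳ (trans (reflexive (≡.cong c (ℕₚ.+-suc m i)))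
            (c-vanishes i (ℕₚ.<-trans (ℕₚ.+-monoʳ-< (suc m) (ℕₚ.n<1+n i)) lt))))
          (zeroˡ _)

    term-vanishes : ∀ j → m ℕ.< j % d → term j ≈ 0#
    term-vanishes j lt = begin
      term j                            ≡⟨ ≡.cong term (≡.trans (DivMod.m≡m%n+[m/n]*n j d) (ℕₚ.+-comm (j % d) _)) ⟩
      term (j / d ℕ.* d ℕ.+ j % d)      ≈⟨ term≈ (j / d) (j % d) (DivMod.m%n<n j d) ⟩
      c (j / d ℕ.* d) * term (j % d)
        ≈⟨ *-congˡ (*-congˡ (*-congˡ (trans (reflexive (≡.cong c (≡.sym split)))
             (c-vanishes (j % d ℕ.∸ suc m) (ℕₚ.≤-<-trans (ℕₚ.≤-reflexive split) (DivMod.m%n<n j d)))))) ⟩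
      c (j / d ℕ.* d) * (weight (j % d) * (pow z (j % d) * 0#))
        ≈⟨ solve 3 (λ u v w → u :* (v :* (w :* :0)) := :0) ≡.refl _ _ _ ⟩
      0# ∎
      where
      split : suc m ℕ.+ (j % d ℕ.∸ suc m) ≡ j % d
      split = ℕₚ.m+[n∸m]≡n lt

    private
      pow4 : Carrier → Carrier
      pow4 w = w * w * (w * w)

      den-unit-≤ : ∀ k j → suc (k ℕ.+ j) ≡ m → Unit (den k)
      den-unit-≤ k j e = unit-den k (ℕₚ.≤-<-trans (ℕ.s≤s (ℕₚ.m≤m+n k j)) (≡.subst (ℕ._< d) (≡.sym e) m<d))

      swap : ∀ k j → suc (k ℕ.+ j) ≡ m → suc (j ℕ.+ k) ≡ m
      swap k j e = ≡.trans (≡.cong suc (ℕₚ.+-comm j k)) e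

      pPP≈Pm : ∀ k j → suc (k ℕ.+ j) ≡ m → p * (P k * P j) ≈ P m
      pPP≈Pm k j e = trans (*-congˡ (sym (pow-+ p k j))) (reflexive (≡.cong P e))

      -- With u = a Pₖ and v = p Pⱼ we have u v = 1, and 1 - u w = - u w (1 - v / w).
      num-reflect : ∀ k j → suc (k ℕ.+ j) ≡ m → num k ≈ pow4 (a * P k) * den j
      num-reflect k j e = begin
        (1# - u) * (1# - u) * ((1# - x * a * P k) * (1# - x̄ * a * P k))
          ≈⟨ *-cong (*-cong one-u one-u) (*-cong (reflect x x̄ xx̄≈1) (reflect x̄ x (trans (*-comm x̄ x) xx̄≈1))) ⟩
        (- u * (1# - v)) * (- u * (1# - v)) * ((- (x * u) * (1# - x̄ * v)) * (- (x̄ * u) * (1# - x * v)))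
          ≈⟨ solve 6 (λ u v x x̄ r s → (:- u :* v) :* (:- u :* v) :* ((:- (x :* u) :* r) :* (:- (x̄ :* u) :* s))
               := x :* x̄ :* (u :* u :* (u :* u) :* (v :* v :* (s :* r)))) ≡.refl u (1# - v) x x̄ (1# - x̄ * v) (1# - x * v) ⟩
        x * x̄ * (pow4 u * den j)   ≈⟨ trans (*-congʳ xx̄≈1) (*-identityˡ _) ⟩
        pow4 u * den j ∎
        where
        u = a * P k
        v = p * P j
        uv≈1 : u * v ≈ 1#
        uv≈1 = trans (solve 4 (λ a K p J → a :* K :* (p :* J) := a :* (p :* (K :* J))) ≡.refl a (P k) p (P j))
          (trans (*-congˡ (pPP≈Pm k j e)) aPm≈1)
        one-u : 1# - u ≈ - u * (1# - v)
        one-u = trans (+-congʳ (sym uv≈1)) (solve 2 (λ u v → u :* v :- u := :- u :* (:1 :- v)) ≡.refl u v)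
        reflect : ∀ x x̄ → x * x̄ ≈ 1# → 1# - x * a * P k ≈ - (x * u) * (1# - x̄ * v)
        reflect x x̄ h = trans (+-congʳ (sym (trans (*-cong h uv≈1) (*-identityˡ 1#))))
          (solve 5 (λ x x̄ a K v → x :* x̄ :* (a :* K :* v) :- x :* a :* K := :- (x :* (a :* K)) :* (:1 :- x̄ :* v))
            ≡.refl x x̄ a (P k) v)

      -- Comparing the product of all num k with the reversed product of all den k.
      c-last : c m * (P m * P m) ≈ pow Z m
      c-last = cancelˡ (unit-prod m unit-den′) (begin
        prod m den * (c m * (P m * P m))
          ≈⟨ solve 3 (λ D c P → D :* (c :* P) := c :* D :* P) ≡.refl _ _ _ ⟩
        c m * prod m den * (P m * P m)                 ≈⟨ *-congʳ (c-prod m) ⟩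
        prod m num * (P m * P m)
          ≈⟨ *-congʳ (trans (prod-cong m λ k lt → num-reflect k (m ℕ.∸ suc k) (ℕₚ.m+[n∸m]≡n lt)) (prod-* m _ _)) ⟩
        prod m (λ k → pow4 (a * P k)) * prod m (λ k → den (m ℕ.∸ suc k)) * (P m * P m)
          ≈⟨ *-congʳ (*-congˡ (prod-reverse m λ k j e → reflexive (≡.cong den (complement k j e)))) ⟩
        prod m (λ k → pow4 (a * P k)) * prod m den * (P m * P m)
          -- One half of each fourth power is reversed. Index `k` then carries `(a P_k)² (a P_j)²`
          -- with `j = m - 1 - k`, and together with a `p²` taken from `P_m²` this is `a²`, because
          -- `a p P_k P_j = 1`.
          ≈⟨ *-congʳ (*-congʳ (trans (prod-* m _ _) (*-congˡ
               (prod-reverse m {g = λ k → a * P (m ℕ.∸ suc k) * (a * P (m ℕ.∸ suc k))}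
                 λ k j e → reflexive (≡.cong (λ i → a * P i * (a * P i)) (≡.sym (complement j k (swap k j e)))))))) ⟩
        prod m (λ k → a * P k * (a * P k)) * prod m (λ k → a * P (m ℕ.∸ suc k) * (a * P (m ℕ.∸ suc k))) * prod m den * (P m * P m)
          ≈⟨ solve 4 (λ u v D P → u :* v :* D :* P := D :* (u :* v :* P)) ≡.refl _ _ _ _ ⟩
        prod m den * (prod m (λ k → a * P k * (a * P k)) * prod m (λ k → a * P (m ℕ.∸ suc k) * (a * P (m ℕ.∸ suc k))) * (P m * P m))
          ≈⟨ *-congˡ (*-cong (prod-* m _ _) (trans (prod-const m λ _ _ → refl) (pow-distrib p p m))) ⟨
        prod m den * (prod m (λ k → a * P k * (a * P k) * (a * P (m ℕ.∸ suc k) * (a * P (m ℕ.∸ suc k)))) * prod m (λ _ → p * p))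
          ≈⟨ *-congˡ (trans (sym (prod-* m _ _)) (prod-const m λ k lt → const k lt)) ⟩
        prod m den * pow Z m ∎)
        where
        unit-den′ : ∀ k → k ℕ.< m → Unit (den k)
        unit-den′ k lt = unit-den k (ℕₚ.≤-<-trans lt m<d)
        c-prod : ∀ k → c k * prod k den ≈ prod k num
        c-prod zero = trans (*-identityʳ _) c₀
        c-prod (suc k) = trans (solve 3 (λ c D e → c :* (D :* e) := D :* (c :* e)) ≡.refl _ _ _)
          (trans (*-congˡ (c-step k)) (trans (solve 3 (λ c D e → D :* (c :* e) := c :* D :* e) ≡.refl _ _ _)
            (*-congʳ (c-prod k))))
        complement : ∀ k j → suc (k ℕ.+ j) ≡ m → m ℕ.∸ suc k ≡ j
        complement k j e = ≡.trans (≡.cong (ℕ._∸ suc k) (≡.sym e)) (ℕₚ.m+n∸m≡n (suc k) j)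
        const : ∀ k → k ℕ.< m → a * P k * (a * P k) * (a * P (m ℕ.∸ suc k) * (a * P (m ℕ.∸ suc k))) * (p * p) ≈ Z
        const k lt = begin
          a * P k * (a * P k) * (a * J * (a * J)) * (p * p)
            ≈⟨ solve 4 (λ a K J p → a :* K :* (a :* K) :* (a :* J :* (a :* J)) :* (p :* p)
                 := a :* (p :* (K :* J)) :* (a :* (p :* (K :* J))) :* (a :* a)) ≡.refl a (P k) J p ⟩
          a * (p * (P k * J)) * (a * (p * (P k * J))) * Z  ≈⟨ *-congʳ (*-cong e e) ⟩
          1# * 1# * Z  ≈⟨ solve 1 (λ Z → :1 :* :1 :* Z := Z) ≡.refl Z ⟩
          Z ∎
          where
          J = P (m ℕ.∸ suc k)
          e : a * (p * (P k * J)) ≈ 1#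
          e = trans (*-congˡ (pPP≈Pm k (m ℕ.∸ suc k) (ℕₚ.m+[n∸m]≡n lt))) aPm≈1

      κ : Carrier
      κ = pow4 (p * P m)

      -- For `k + j + 1 = m` the ratios `num k / den k` and `num j / den j` have by `num-reflect`
      -- the product `(a P_k)⁴ (a P_j)⁴`, the inverse of `κ`. So each index moved from `j` to `k`
      -- costs one factor `κ`.
      c-reflect : ∀ k j → k ℕ.+ j ≡ m → c j ≈ pow κ k * c m * c k
      c-reflect zero j ≡.refl = sym (trans (*-cong (*-identityˡ _) c₀) (*-identityʳ _))
      c-reflect (suc k) j e = cancelˡ (den-unit-≤ k j e) (begin
        den k * c j   ≈⟨ trans (sym (*-identityˡ _)) (*-congʳ (sym unity)) ⟩
        κ * pow4 (a * P k) * pow4 (a * P j) * (den k * c j)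
          ≈⟨ solve 5 (λ κ u v d c → κ :* u :* v :* (d :* c) := κ :* u :* (c :* (v :* d))) ≡.refl κ _ _ _ _ ⟩
        κ * pow4 (a * P k) * (c j * (pow4 (a * P j) * den k))
          ≈⟨ *-congˡ (*-congˡ (num-reflect j k (swap k j e))) ⟨
        κ * pow4 (a * P k) * (c j * num j)    ≈⟨ *-congˡ (c-step j) ⟨
        κ * pow4 (a * P k) * (c (suc j) * den j)
          ≈⟨ *-congˡ (*-congʳ (c-reflect k (suc j) (≡.trans (ℕₚ.+-suc k j) e))) ⟩
        κ * pow4 (a * P k) * (pow κ k * c m * c k * den j)
          ≈⟨ solve 6 (λ κ u w m c d → κ :* u :* (w :* m :* c :* d) := κ :* w :* m :* (c :* (u :* d))) ≡.refl κ _ _ _ _ _ ⟩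
        κ * pow κ k * c m * (c k * (pow4 (a * P k) * den j))
          ≈⟨ *-congˡ (*-congˡ (num-reflect k j e)) ⟨
        κ * pow κ k * c m * (c k * num k)     ≈⟨ *-congˡ (c-step k) ⟨
        κ * pow κ k * c m * (c (suc k) * den k)
          ≈⟨ solve 3 (λ u c d → u :* (c :* d) := d :* (u :* c)) ≡.refl _ _ _ ⟩
        den k * (κ * pow κ k * c m * c (suc k)) ∎)
        where
        unity : κ * pow4 (a * P k) * pow4 (a * P j) ≈ 1#
        unity = trans (solve 5 (λ a p K J m →
            let w = λ t → t :* t :* (t :* t) in
            w (p :* m) :* w (a :* K) :* w (a :* J) := w (a :* (p :* (K :* J))) :* w (a :* m)) ≡.refl a p (P k) (P j) (P m))
          (trans (*-cong (pow4-1 (trans (*-congˡ (pPP≈Pm k j e)) aPm≈1)) (pow4-1 aPm≈1)) (*-identityˡ 1#))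
          where
          pow4-1 : ∀ {w} → w ≈ 1# → pow4 w ≈ 1#
          pow4-1 h = trans (*-cong (*-cong h h) (*-cong h h)) (solve 0 (:1 :* :1 :* (:1 :* :1) := :1) ≡.refl)

      PP≈Pm : ∀ k j → k ℕ.+ j ≡ m → P k * P j ≈ P m
      PP≈Pm k j e = trans (sym (pow-+ p k j)) (reflexive (≡.cong P e))

      -- Since `a P_k P_j = 1`, each of the three factors changes sign under the reflection. This is
      -- the origin of the minus sign in `term-reflect`.
      weight-reflect : ∀ k j → k ℕ.+ j ≡ m → weight j ≈ - Z * pow4 (P j) * weight k
      weight-reflect k j e = begin
        (1# - q * P j) * (1# - q * P j) * (1# - a * (P j * P j))
          ≈⟨ *-cong (*-cong (+-congʳ (sym h)) (+-congʳ (sym h))) (+-congʳ (sym (trans (*-cong h h) (*-identityˡ 1#)))) ⟩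
        (w - q * P j) * (w - q * P j) * (w * w - a * (P j * P j))
          ≈⟨ solve 3 (λ q K J → let w = q :* q :* (K :* J) in
               (w :- q :* J) :* (w :- q :* J) :* (w :* w :- q :* q :* (J :* J))
               := :- (q :* q :* (q :* q)) :* (J :* J :* (J :* J)) :* ((:1 :- q :* K) :* (:1 :- q :* K) :* (:1 :- q :* q :* (K :* K))))
               ≡.refl q (P k) (P j) ⟩
        - Z * pow4 (P j) * weight k ∎
        where
        w = a * (P k * P j)
        h : w ≈ 1#
        h = trans (*-congˡ (PP≈Pm k j e)) aPm≈1

      cm≈ : c m ≈ Z * pow Z m
      cm≈ = trans (trans (sym (*-identityˡ _)) (*-congʳ (sym (trans (*-cong aPm≈1 aPm≈1) (*-identityˡ 1#)))))
        (trans (solve 3 (λ a P c → a :* P :* (a :* P) :* c := a :* a :* (c :* (P :* P))) ≡.refl a (P m) (c m))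
          (*-congˡ c-last))

      pow4-pow : ∀ w k → pow4 (pow w k) ≈ pow (pow4 w) k
      pow4-pow w k = trans (*-cong (sym (pow-distrib w w k)) (sym (pow-distrib w w k))) (sym (pow-distrib (w * w) (w * w) k))

      -- The monomial factors from the reflections of `weight` and `c` turn `z^j` exactly into
      -- `z^k`; this is where the value `z = a^(-2)` matters.
      scale : ∀ k j → k ℕ.+ j ≡ m → Z * pow4 (P j) * (pow z j * (pow κ k * c m)) ≈ pow z k
      scale k j e = cancelˡ (unit-pow k uZ) (begin
        pow Z k * (Z * pow4 (P j) * (pow z j * (pow κ k * c m)))
          ≈⟨ *-congˡ (*-congˡ (*-congˡ (*-congˡ (trans cm≈ (*-congˡ (trans (reflexive (≡.cong (pow Z) (≡.sym e))) (pow-+ Z k j))))))) ⟩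
        pow Z k * (Z * pow4 (P j) * (pow z j * (pow κ k * (Z * (pow Z k * pow Z j)))))
          ≈⟨ solve 6 (λ Zk Z J zj κk Zj → Zk :* (Z :* J :* (zj :* (κk :* (Z :* (Zk :* Zj)))))
               := (zj :* Zj) :* (κk :* (Zk :* Zk)) :* (Z :* Z :* J)) ≡.refl (pow Z k) Z _ (pow z j) (pow κ k) (pow Z j) ⟩
        (pow z j * pow Z j) * (pow κ k * (pow Z k * pow Z k)) * (Z * Z * pow4 (P j))
          ≈⟨ *-congʳ (*-cong (zZ j) κZ) ⟩
        1# * pow4 (P k) * (Z * Z * pow4 (P j))
          ≈⟨ solve 3 (λ a K J → let w = λ t → t :* t :* (t :* t) in
               :1 :* w K :* (a :* a :* (a :* a) :* w J) := w (a :* (K :* J))) ≡.refl a (P k) (P j) ⟩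
        pow4 (a * (P k * P j))
          ≈⟨ pow4-1 (trans (*-congˡ (PP≈Pm k j e)) aPm≈1) ⟩
        1#                     ≈⟨ trans (*-comm _ _) (zZ k) ⟨
        pow Z k * pow z k ∎)
        where
        pow4-1 : ∀ {w} → w ≈ 1# → pow4 w ≈ 1#
        pow4-1 h = trans (*-cong (*-cong h h) (*-cong h h)) (solve 0 (:1 :* :1 :* (:1 :* :1) := :1) ≡.refl)
        zZ : ∀ j → pow z j * pow Z j ≈ 1#
        zZ j = trans (sym (pow-distrib z Z j)) (trans (pow-cong j za²≈1) (pow-1 j))
        κZ : pow κ k * (pow Z k * pow Z k) ≈ pow4 (P k)
        κZ = begin
          pow κ k * (pow Z k * pow Z k)   ≈⟨ *-congˡ (pow-distrib Z Z k) ⟨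
          pow κ k * pow (Z * Z) k         ≈⟨ pow-distrib κ (Z * Z) k ⟨
          pow (κ * (Z * Z)) k
            ≈⟨ pow-cong k (trans (solve 3 (λ a p m → let w = λ t → t :* t :* (t :* t) in
                 w (p :* m) :* (a :* a :* (a :* a)) := w (a :* m) :* w p) ≡.refl a p (P m))
                 (trans (*-congʳ (pow4-1 aPm≈1)) (*-identityˡ _))) ⟩
          pow (pow4 p) k                  ≈⟨ pow4-pow p k ⟨
          pow4 (P k) ∎

      term-reflect : ∀ k j → k ℕ.+ j ≡ m → term j ≈ - term k
      term-reflect k j e = begin
        weight j * (pow z j * c j)   ≈⟨ *-cong (weight-reflect k j e) (*-congˡ (c-reflect k j e)) ⟩
        (- Z * pow4 (P j) * weight k) * (pow z j * (pow κ k * c m * c k))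
          ≈⟨ solve 7 (λ Z J w z κ m c → (:- Z :* J :* w) :* (z :* (κ :* m :* c))
               := :- (w :* ((Z :* J :* (z :* (κ :* m))) :* c))) ≡.refl Z _ (weight k) (pow z j) (pow κ k) (c m) (c k) ⟩
        - (weight k * ((Z * pow4 (P j) * (pow z j * (pow κ k * c m))) * c k))
          ≈⟨ -‿cong (*-congˡ (*-congʳ (scale k j e))) ⟩
        - term k ∎

      S : Carrier
      S = sum (suc m) term

      S≈0 : S ≈ 0#
      S≈0 = cancelˡ two (begin
        (1# + 1#) * S
          ≈⟨ solve 1 (λ S → (:1 :+ :1) :* S := S :+ S) ≡.refl S ⟩
        S + S
          ≈⟨ +-congˡ (sum-reverse (suc m) {g = λ k → - term k} λ k j e →
               term-reflect j k (≡.trans (ℕₚ.+-comm j k) (ℕₚ.suc-injective e))) ⟩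
        S + sum (suc m) (λ k → - term k)     ≈⟨ sum-+ (suc m) _ _ ⟨
        sum (suc m) (λ k → term k - term k)  ≈⟨ sum-zero (suc m) (λ k _ → -‿inverseʳ _) ⟩
        0#                                   ≈⟨ zeroʳ _ ⟨
        (1# + 1#) * 0# ∎)

      initial : ∀ i → m ℕ.< i → i ℕ.≤ d → sum i term ≈ 0#
      initial i lt i≤d with ℕₚ.≤⇒≤′ lt
      ... | ℕ.≤′-reflexive ≡.refl = S≈0
      ... | ℕ.≤′-step {n} l = trans (+-cong (initial n (ℕₚ.≤′⇒≤ l) (ℕₚ.<⇒≤ i≤d))
              (term-vanishes n (≡.subst (m ℕ.<_) (≡.sym (DivMod.m<n⇒m%n≡m i≤d)) (ℕₚ.≤′⇒≤ l)))) (+-identityʳ 0#)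

      block : ∀ l i → i ℕ.≤ d → sum i (λ k → term (l ℕ.* d ℕ.+ k)) ≈ c (l ℕ.* d) * sum i term
      block l i i≤d = trans (sum-cong i λ k lt → term≈ l k (ℕₚ.<-≤-trans lt i≤d)) (sum-*ˡ i _ term)

      blocks : ∀ l → sum (l ℕ.* d) term ≈ 0#
      blocks zero = refl
      blocks (suc l) = trans (reflexive (≡.cong (λ i → sum i term) (ℕₚ.+-comm d (l ℕ.* d))))
        (trans (sum-split (l ℕ.* d) d term) (trans (+-cong (blocks l)
          (trans (block l d ℕₚ.≤-refl) (trans (*-congˡ (initial d m<d ℕₚ.≤-refl)) (zeroʳ _)))) (+-identityʳ 0#)))

    sum-vanishes : ∀ N → N % d ≡ 0 ⊎ m ℕ.< N % d → sum N term ≈ 0#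
    sum-vanishes N out = trans (reflexive (≡.cong (λ i → sum i term)
        (≡.trans (DivMod.m≡m%n+[m/n]*n N d) (ℕₚ.+-comm (N % d) _))))
      (trans (sum-split (N / d ℕ.* d) (N % d) term) (trans (+-cong (blocks (N / d))
        (trans (block (N / d) (N % d) (ℕₚ.<⇒≤ (DivMod.m%n<n N d))) (trans (*-congˡ (rest out)) (zeroʳ _)))) (+-identityʳ 0#)))
      where
      rest : N % d ≡ 0 ⊎ m ℕ.< N % d → sum (N % d) term ≈ 0#
      rest (inj₁ e) rewrite e = refl
      rest (inj₂ lt) = initial (N % d) lt (ℕₚ.<⇒≤ (DivMod.m%n<n N d))

-- Localisations

-- Fractions whose denominators are regular modulo g, compared modulo g: the quotient by g of
-- a localisation. For g = 0 this is the field of fractions.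
module Localisation (R : CommutativeRing 0ℓ 0ℓ) (g : CommutativeRing.Carrier R) where
  open CommutativeRing R
  open Solver R
  open Divisibility R

  infix 8 _/_[_]
  record Fraction : Set where
    no-eta-equality
    constructor _/_[_]
    field
      num den : Carrier
      reg : Reg g den
  open Fraction public

  infix 4 _≃_
  record _≃_ (x y : Fraction) : Set where
    constructor mk≃
    field cross : g ∣ num x * den y - num y * den x
  open _≃_ public

  exact : ∀ {x y} → num x * den y ≈ num y * den x → x ≃ y
  exact e = mk≃ (∣-resp (sym (trans (+-congʳ e) (-‿inverseʳ _))) ∣0)

  ≃-sym : ∀ {x y} → x ≃ y → y ≃ x
  ≃-sym {x} {y} (mk≃ h) = mk≃ (∣-resp
    (solve 2 (λ u v → :- (u :- v) := v :- u) ≡.refl ((num x) * (den y)) ((num y) * (den x))) (∣-neg h))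

  ≃-trans : ∀ {x y z} → x ≃ y → y ≃ z → x ≃ z
  ≃-trans {x} {y} {z} (mk≃ h) (mk≃ k) = mk≃ ((reg y) _ (∣-resp
    (solve 6 (λ a b c d e f → f :* (a :* d :- c :* b) :+ b :* (c :* f :- e :* d) := d :* (a :* f :- e :* b))
      ≡.refl (num x) (den x) (num y) (den y) (num z) (den z))
    (∣-+ (∣-*ˡ (den z) h) (∣-*ˡ (den x) k))))

  infixl 6 _⊕_
  infixl 7 _⊗_
  _⊕_ _⊗_ : Fraction → Fraction → Fraction
  (x ⊕ y) .num = num x * den y + num y * den x
  (x ⊕ y) .den = den x * den y
  (x ⊕ y) .reg = reg-* (reg x) (reg y)
  (x ⊗ y) .num = num x * num y
  (x ⊗ y) .den = den x * den y
  (x ⊗ y) .reg = reg-* (reg x) (reg y)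

  ⊖_ : Fraction → Fraction
  (⊖ x) .num = - num x
  (⊖ x) .den = den x
  (⊖ x) .reg = reg x

  emb : Carrier → Fraction
  emb a .num = a
  emb a .den = 1#
  emb a .reg = reg-1

  ⊕-cong : ∀ {x y u v} → x ≃ y → u ≃ v → x ⊕ u ≃ y ⊕ v
  ⊕-cong {x} {x′} {y} {y′} (mk≃ h) (mk≃ k) = mk≃ (∣-resp
    (solve 8 (λ a b a′ b′ c d c′ d′ →
      d :* d′ :* (a :* b′ :- a′ :* b) :+ b :* b′ :* (c :* d′ :- c′ :* d)
      := (a :* d :+ c :* b) :* (b′ :* d′) :- (a′ :* d′ :+ c′ :* b′) :* (b :* d)) ≡.refl (num x) (den x) (num x′) (den x′) (num y) (den y) (num y′) (den y′))
    (∣-+ (∣-*ˡ ((den y) * (den y′)) h) (∣-*ˡ ((den x) * (den x′)) k)))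

  ⊗-cong : ∀ {x y u v} → x ≃ y → u ≃ v → x ⊗ u ≃ y ⊗ v
  ⊗-cong {x} {x′} {y} {y′} (mk≃ h) (mk≃ k) = mk≃ (∣-resp
    (solve 8 (λ a b a′ b′ c d c′ d′ →
      c :* d′ :* (a :* b′ :- a′ :* b) :+ a′ :* b :* (c :* d′ :- c′ :* d)
      := (a :* c) :* (b′ :* d′) :- (a′ :* c′) :* (b :* d)) ≡.refl (num x) (den x) (num x′) (den x′) (num y) (den y) (num y′) (den y′))
    (∣-+ (∣-*ˡ ((num y) * (den y′)) h) (∣-*ˡ ((num x′) * (den x)) k)))

  ⊖-cong : ∀ {x y} → x ≃ y → ⊖ x ≃ ⊖ y
  ⊖-cong {x} {y} (mk≃ h) = mk≃ (∣-resp
    (solve 4 (λ a b c d → :- (a :* d :- c :* b) := (:- a) :* d :- (:- c) :* b) ≡.refl (num x) (den x) (num y) (den y)) (∣-neg h))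

  fractionRing : CommutativeRing 0ℓ 0ℓ
  fractionRing = record
    { Carrier = Fraction
    ; _≈_ = _≃_
    ; _+_ = _⊕_
    ; _*_ = _⊗_
    ; -_ = ⊖_
    ; 0# = emb 0#
    ; 1# = emb 1#
    ; isCommutativeRing = record
      { isRing = record
        { +-isAbelianGroup = record
          { isGroup = record
            { isMonoid = record
              { isSemigroup = record
                { isMagma = record
                  { isEquivalence = record { refl = exact refl ; sym = ≃-sym ; trans = ≃-trans }
                  ; ∙-cong = ⊕-cong }
                ; assoc = λ x y z → exact
                    (solve 6 (λ a b c d e f →
                      ((a :* d :+ c :* b) :* f :+ e :* (b :* d)) :* (b :* (d :* f))
                      := (a :* (d :* f) :+ (c :* f :+ e :* d) :* b) :* ((b :* d) :* f)) ≡.refl (num x) (den x) (num y) (den y) (num z) (den z)) }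
              ; identity = (λ x → exact
                  (solve 2 (λ a b → (:0 :* b :+ a :* :1) :* b := a :* (:1 :* b)) ≡.refl (num x) (den x)))
                , (λ x → exact
                  (solve 2 (λ a b → (a :* :1 :+ :0 :* b) :* b := a :* (b :* :1)) ≡.refl (num x) (den x))) }
            ; inverse = (λ x → exact
                (solve 2 (λ a b → ((:- a) :* b :+ a :* b) :* :1 := :0 :* (b :* b)) ≡.refl (num x) (den x)))
              , (λ x → exact
                (solve 2 (λ a b → (a :* b :+ (:- a) :* b) :* :1 := :0 :* (b :* b)) ≡.refl (num x) (den x)))
            ; ⁻¹-cong = ⊖-cong }
          ; comm = λ x y → exact
              (solve 4 (λ a b c d → (a :* d :+ c :* b) :* (d :* b) := (c :* b :+ a :* d) :* (b :* d)) ≡.refl (num x) (den x) (num y) (den y)) }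
        ; *-cong = ⊗-cong
        ; *-assoc = λ x y z → exact
            (solve 6 (λ a b c d e f → ((a :* c) :* e) :* (b :* (d :* f)) := (a :* (c :* e)) :* ((b :* d) :* f))
              ≡.refl (num x) (den x) (num y) (den y) (num z) (den z))
        ; *-identity = (λ x → exact
            (solve 2 (λ a b → (:1 :* a) :* b := a :* (:1 :* b)) ≡.refl (num x) (den x)))
          , (λ x → exact
            (solve 2 (λ a b → (a :* :1) :* b := a :* (b :* :1)) ≡.refl (num x) (den x)))
        ; distrib = (λ x y z → exact
            (solve 6 (λ a b c d e f → (a :* (c :* f :+ e :* d)) :* ((b :* d) :* (b :* f))
              := ((a :* c) :* (b :* f) :+ (a :* e) :* (b :* d)) :* (b :* (d :* f))) ≡.refl (num x) (den x) (num y) (den y) (num z) (den z)))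
          , (λ x y z → exact
            (solve 6 (λ a b c d e f → ((c :* f :+ e :* d) :* a) :* ((d :* b) :* (f :* b))
              := ((c :* a) :* (f :* b) :+ (e :* a) :* (d :* b)) :* ((d :* f) :* b)) ≡.refl (num x) (den x) (num y) (den y) (num z) (den z))) }
      ; *-comm = λ x y → exact
          (solve 4 (λ a b c d → (a :* c) :* (d :* b) := (c :* a) :* (b :* d)) ≡.refl (num x) (den x) (num y) (den y)) }
    }

  emb-cong : ∀ {a b} → a ≈ b → emb a ≃ emb b
  emb-cong e = exact (*-congʳ e)

  emb-* : ∀ a b → emb (a * b) ≃ emb a ⊗ emb b
  emb-* a b = exact (solve 2 (λ a b → (a :* b) :* (:1 :* :1) := (a :* b) :* :1) ≡.refl a b)

  emb-+ : ∀ a b → emb (a + b) ≃ emb a ⊕ emb b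
  emb-+ a b = exact (solve 2 (λ a b → (a :+ b) :* (:1 :* :1) := (a :* :1 :+ b :* :1) :* :1) ≡.refl a b)

  emb-- : ∀ a b → emb (a - b) ≃ emb a ⊕ ⊖ emb b
  emb-- a b = exact (solve 2 (λ a b → (a :- b) :* (:1 :* :1) := (a :* :1 :+ (:- b) :* :1) :* :1) ≡.refl a b)

  emb-0 : ∀ {a} → g ∣ a → emb a ≃ emb 0#
  emb-0 {a} d = mk≃ (∣-resp (solve 1 (λ a → a := a :* :1 :- :0 :* :1) ≡.refl a) d)

  ≃0⇒∣ : ∀ {y} → y ≃ emb 0# → g ∣ num y
  ≃0⇒∣ {x} (mk≃ d) = ∣-resp (solve 2 (λ a b → a :* :1 :- :0 :* b := a) ≡.refl (num x) (den x)) d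

  open Kit fractionRing using (mkUnit; Unit; unit-resp) renaming (pow to powᶠ)
  private module KR = Kit R

  emb-pow : ∀ a n → emb (KR.pow a n) ≃ powᶠ (emb a) n
  emb-pow a zero = exact refl
  emb-pow a (suc n) = ≃-trans (emb-* a _) (⊗-cong (exact refl) (emb-pow a n))

  recip : ∀ y → Reg g (num y) → Fraction
  recip y r .num = den y
  recip y r .den = num y
  recip y r .reg = r

  recip-inverse : ∀ y r → y ⊗ recip y r ≃ emb 1#
  recip-inverse x r = exact (solve 2 (λ a b → a :* b :* :1 := :1 :* (b :* a)) ≡.refl (num x) (den x))

  unit-emb : ∀ {a} → Reg g a → Unit (emb a)
  unit-emb r = mkUnit (recip (emb _) r) (recip-inverse (emb _) r)

module FractionField (R : CommutativeRing 0ℓ 0ℓ) (dom : IsDomain R) where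
  open CommutativeRing R
  open Solver R
  open Divisibility R
  open DomainProperties R dom
  module K = Localisation R 0#
  open K using (mk≃; exact) renaming (Fraction to K; num to numᴷ; den to denᴷ; reg to regᴷ; _≃_ to _≃ᴷ_; emb to embᴷ; _⊗_ to _⊗ᴷ_)

  reg-0⇒nonzero : ∀ {s} → Reg 0# s → ¬ s ≈ 0#
  reg-0⇒nonzero {s} r z with r 1# (∣-resp (sym (trans (*-congʳ z) (zeroˡ _))) ∣0)
  ... | div u e = 1≉0 (trans (sym e) (zeroʳ u))

  den≉0 : ∀ y → ¬ denᴷ y ≈ 0#
  den≉0 y = reg-0⇒nonzero (regᴷ y)

  cross-≈ : ∀ {x y} → x ≃ᴷ y → numᴷ x * denᴷ y ≈ numᴷ y * denᴷ x
  cross-≈ (mk≃ (div u e)) = x∙y⁻¹≈ε⇒x≈y _ _ (trans (sym e) (zeroʳ u))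
    where open import Algebra.Properties.Ring ring using (x∙y⁻¹≈ε⇒x≈y)

  module Comparison (g : Carrier) where
    private module L = Localisation R g
    open L using (Fraction; num; den; reg; _≃_; _/_[_])
    private
      module KitK = Kit K.fractionRing
      module KitL = Kit L.fractionRing

    infix 4 _~_
    -- The fraction `y`, with denominator regular modulo `g`, represents the element `x` of the
    -- fraction field. A relation and not a map, because only some `x` have such a representative;
    -- by `~-unique` its class modulo `g` depends on `x` alone.
    record _~_ (x : K) (y : Fraction) : Set where
      constructor mk~
      field same : numᴷ x * den y ≈ num y * denᴷ x
    open _~_ public

    ~-emb : ∀ a → embᴷ a ~ L.emb a
    ~-emb a = mk~ refl

    ~-+ : ∀ {x y u v} → x ~ y → u ~ v → (x K.⊕ u) ~ (y L.⊕ v)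
    ~-+ {x} {x̂} {y} {û} (mk~ e) (mk~ f) = mk~
      (trans (solve 6 (λ a b c d s t → (a :* d :+ c :* b) :* (s :* t) := (a :* s) :* (d :* t) :+ (c :* t) :* (b :* s)) ≡.refl (numᴷ x) (denᴷ x) (numᴷ y) (denᴷ y) (den x̂) (den û))
      (trans (+-cong (*-congʳ e) (*-congʳ f))
        (solve 6 (λ p b r d s t → (p :* b) :* (d :* t) :+ (r :* d) :* (b :* s) := (p :* t :+ r :* s) :* (b :* d)) ≡.refl (num x̂) (denᴷ x) (num û) (denᴷ y) (den x̂) (den û))))

    ~-* : ∀ {x y u v} → x ~ y → u ~ v → (x K.⊗ u) ~ (y L.⊗ v)
    ~-* {x} {x̂} {y} {û} (mk~ e) (mk~ f) = mk~
      (trans (solve 4 (λ a c s t → (a :* c) :* (s :* t) := (a :* s) :* (c :* t)) ≡.refl (numᴷ x) (numᴷ y) (den x̂) (den û))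
      (trans (*-cong e f)
        (solve 4 (λ p b r d → (p :* b) :* (r :* d) := (p :* r) :* (b :* d)) ≡.refl (num x̂) (denᴷ x) (num û) (denᴷ y))))

    ~-neg : ∀ {x y} → x ~ y → (K.⊖ x) ~ (L.⊖ y)
    ~-neg {x} {x̂} (mk~ e) = mk~
      (trans (solve 2 (λ a s → (:- a) :* s := :- (a :* s)) ≡.refl (numᴷ x) (den x̂))
      (trans (-‿cong e) (solve 2 (λ p b → :- (p :* b) := (:- p) :* b) ≡.refl (num x̂) (denᴷ x))))

    ~-- : ∀ {x y u v} → x ~ y → u ~ v → (x K.⊕ K.⊖ u) ~ (y L.⊕ L.⊖ v)
    ~-- e f = ~-+ e (~-neg f)

    ~-pow : ∀ {x y} n → x ~ y → KitK.pow x n ~ KitL.pow y n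
    ~-pow zero e = ~-emb 1#
    ~-pow (suc n) e = ~-* e (~-pow n e)

    ~-sum : ∀ n {f h} → (∀ i → f i ~ h i) → KitK.sum n f ~ KitL.sum n h
    ~-sum zero e = ~-emb 0#
    ~-sum (suc n) e = ~-+ (~-sum n e) (e n)

    ~-poch : ∀ {x y u v} k → x ~ y → u ~ v → KitK.poch x u k ~ KitL.poch y v k
    ~-poch zero e f = ~-emb 1#
    ~-poch (suc k) e f = ~-* (~-poch k e f) (~-- (~-emb 1#) (~-* e (~-pow k f)))

    ~-resp : ∀ {x x′ y} → x ≃ᴷ x′ → x ~ y → x′ ~ y
    ~-resp {x} {x′} {y} h (mk~ e) = mk~ (*-cancelˡ (denᴷ x) (den≉0 x)
      (trans (solve 3 (λ b a s → b :* (a :* s) := (a :* b) :* s) ≡.refl (denᴷ x) (numᴷ x′) (den y))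
      (trans (*-congʳ (sym (cross-≈ h)))
      (trans (solve 3 (λ a b s → a :* b :* s := (a :* s) :* b) ≡.refl (numᴷ x) (denᴷ x′) (den y))
      (trans (*-congʳ e)
        (solve 3 (λ p b d → p :* b :* d := b :* (p :* d)) ≡.refl (num y) (denᴷ x) (denᴷ x′)))))))

    ~-unique : ∀ {x y y′} → x ~ y → x ~ y′ → y ≃ y′
    ~-unique {x} {y} {y′} (mk~ e) (mk~ f) = L.exact (*-cancelˡ (denᴷ x) (den≉0 x)
      (trans (solve 3 (λ b p s → b :* (p :* s) := (p :* b) :* s) ≡.refl (denᴷ x) (num y) (den y′))
      (trans (*-congʳ (sym e))
      (trans (solve 3 (λ a s t → a :* s :* t := (a :* t) :* s) ≡.refl (numᴷ x) (den y) (den y′))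
      (trans (*-congʳ f)
        (solve 3 (λ p b d → p :* b :* d := b :* (p :* d)) ≡.refl (num y′) (denᴷ x) (den y)))))))

    ~-recip : ∀ {x y} → x ~ y → (r : Reg 0# (numᴷ x)) (r′ : Reg g (num y)) → K.recip x r ~ L.recip y r′
    ~-recip {x} {y} (mk~ e) r r′ = mk~ (trans (*-comm _ _) (trans (sym e) (*-comm _ _)))

    -- One step of a recurrence: representability passes from `x` to `x′` when the divisor is
    -- regular.
    ~-solve : ∀ {x x′ y δ ν} → (r : Reg g δ) → x′ ⊗ᴷ embᴷ δ ≃ᴷ x ⊗ᴷ embᴷ ν → x ~ y →
      x′ ~ (y L.⊗ (ν / δ [ r ]))
    ~-solve {x} {x′} {y} {δ} {ν} r h (mk~ e) = mk~ (*-cancelˡ (denᴷ x) (den≉0 x)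
      (trans (solve 4 (λ b a s δ → b :* (a :* (s :* δ)) := (a :* δ :* (b :* :1)) :* s) ≡.refl (denᴷ x) (numᴷ x′) (den y) δ)
      (trans (*-congʳ (cross-≈ h))
      (trans (solve 4 (λ a ν d s → a :* ν :* (d :* :1) :* s := (a :* s) :* (ν :* d)) ≡.refl (numᴷ x) ν (denᴷ x′) (den y))
      (trans (*-congʳ e)
        (solve 4 (λ p b ν d → p :* b :* (ν :* d) := b :* (p :* ν :* d)) ≡.refl (num y) (denᴷ x) ν (denᴷ x′)))))))

    -- Cross-multiplication gives `den y * a ≈ num y * b`. Here `g` divides `num y`, and `den y` is
    -- regular. This is the passage from vanishing modulo `g` back to divisibility of numerators.
    ∣-numerator : ∀ {x y a b} → x ~ y → y ≃ L.emb 0# → numᴷ x * b ≈ a * denᴷ x → g ∣ a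
    ∣-numerator {x} {y} {a} {b} (mk~ e) z f = reg y a (∣-resp
      (*-cancelˡ (denᴷ x) (den≉0 x)
        (trans (solve 3 (λ D p b → D :* (p :* b) := (p :* D) :* b) ≡.refl (denᴷ x) (num y) b)
        (trans (*-congʳ (sym e))
        (trans (solve 3 (λ n s b → n :* s :* b := (n :* b) :* s) ≡.refl (numᴷ x) (den y) b)
        (trans (*-congʳ f)
          (solve 3 (λ a D s → a :* D :* s := D :* (s :* a)) ≡.refl a (denᴷ x) (den y)))))))
      (∣-*ʳ b (L.≃0⇒∣ z)))

-- The summand α

module Side (R : CommutativeRing 0ℓ 0ℓ) (q x g : CommutativeRing.Carrier R) where
  private module R where
    open CommutativeRing R public
    open Divisibility R public
    open Kit R public
  open Localisation R g hiding (_≃_)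
  open CommutativeRing fractionRing public
  open Kit fractionRing public
  private module S = Solver fractionRing
  open S using (solve; _:=_; _:*_; _:+_; _:-_; :1; :0)
  open import Relation.Binary.Reasoning.Setoid setoid

  -- With the inverse `v`, the product of the numerators of `y` and `v` is congruent to the product
  -- of their denominators, which is regular; a divisor of a regular element is regular.
  unit⇒reg : ∀ {y} → Unit y → R.Reg g (num y)
  unit⇒reg {y} (mkUnit v e) = R.reg-∣ {s′ = num y R.* num v} (R.div (num v) (R.*-comm _ _))
    (R.reg-mod {s′ = den y R.* den v} (R.∣-resp
      (Solver.solve R 2 (λ a b → a :*′ :1′ :-′ :1′ :*′ b :=′ a :-′ b) ≡.refl (num y R.* num v) (den y R.* den v))
      (cross e)) (R.reg-* (reg y) (reg v)))
    where
    open Solver R using () renaming (_:*_ to _:*′_; _:-_ to _:-′_; _:=_ to _:=′_; :1 to :1′)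

  -- Numerator and denominator are swapped, instead of taking the inverse stored in the unit, so
  -- that the result has literally the form of `invF`.
  inverseOf : ∀ y → Unit y → Fraction
  inverseOf y u = recip y (unit⇒reg u)

  inverseOf-inverse : ∀ y u → y * inverseOf y u ≈ 1#
  inverseOf-inverse y u = recip-inverse y (unit⇒reg u)

  q̂ x̂ p a q2 : Fraction
  q̂ = emb q
  x̂ = emb x
  p = pow q̂ 8
  a = q̂ * q̂
  q2 = pow q̂ 2

  q2≈a : q2 ≈ a
  q2≈a = solve 1 (λ q → q :* (q :* :1) := q :* q) ≡.refl q̂

  emb-1-pow : ∀ n → emb (R.1# R.- R.pow q n) ≈ 1# - pow q̂ n
  emb-1-pow n = trans (emb-- _ _) (+-congˡ (-‿cong (emb-pow q n)))

  emb-1-x*pow : ∀ n → emb (R.1# R.- x R.* R.pow q n) ≈ 1# - x̂ * pow q̂ n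
  emb-1-x*pow n = trans (emb-- _ _) (+-congˡ (-‿cong (trans (emb-* x _) (*-congˡ (emb-pow q n)))))

  emb-x-pow : ∀ n → emb (x R.- R.pow q n) ≈ x̂ - pow q̂ n
  emb-x-pow n = trans (emb-- _ _) (+-congˡ (-‿cong (emb-pow q n)))

  pow-p : ∀ k → pow q̂ (8 ℕ.* k) ≈ pow p k
  pow-p k = pow-* q̂ 8 k

  pow-8k+1 : ∀ k → pow q̂ (8 ℕ.* k ℕ.+ 1) ≈ q̂ * pow p k
  pow-8k+1 k = trans (pow-+ q̂ (8 ℕ.* k) 1) (trans (*-congʳ (pow-p k))
    (solve 2 (λ q P → P :* (q :* :1) := q :* P) ≡.refl q̂ (pow p k)))

  pow-8k+2 : ∀ k → pow q̂ (8 ℕ.* k ℕ.+ 2) ≈ a * pow p k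
  pow-8k+2 k = trans (pow-+ q̂ (8 ℕ.* k) 2) (trans (*-congʳ (pow-p k))
    (solve 2 (λ q P → P :* (q :* (q :* :1)) := q :* q :* P) ≡.refl q̂ (pow p k)))

  pow-8k+4 : ∀ k → pow q̂ (8 ℕ.* k ℕ.+ 4) ≈ pow q̂ 4 * pow p k
  pow-8k+4 k = trans (pow-+ q̂ (8 ℕ.* k) 4) (trans (*-congʳ (pow-p k)) (*-comm _ _))

  pow-2[8k+1] : ∀ k → pow q̂ (2 ℕ.* (8 ℕ.* k ℕ.+ 1)) ≈ a * (pow p k * pow p k)
  pow-2[8k+1] k = trans (reflexive (≡.cong (pow q̂) (≡.cong (8 ℕ.* k ℕ.+ 1 ℕ.+_) (ℕₚ.+-identityʳ _))))
    (trans (pow-+ q̂ (8 ℕ.* k ℕ.+ 1) (8 ℕ.* k ℕ.+ 1)) (trans (*-cong (pow-8k+1 k) (pow-8k+1 k))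
      (solve 2 (λ q P → (q :* P) :* (q :* P) := q :* q :* (P :* P)) ≡.refl q̂ (pow p k))))

  record Regularity : Set where
    field
      reg-q : R.Reg g q
      reg-x : R.Reg g x
      reg-1-q : R.Reg g (R.1# R.- R.pow q 1)
      reg-1-q² : R.Reg g (R.1# R.- R.pow q 2)
      reg-1+q² : R.Reg g (R.1# R.+ R.pow q 2)

  module Elements (regularity : Regularity) where
    open Regularity regularity

    unit-q̂ : Unit q̂
    unit-q̂ = unit-emb reg-q

    unit-x̂ : Unit x̂
    unit-x̂ = unit-emb reg-x

    unit-1-q̂ : Unit (1# - q̂)
    unit-1-q̂ = unit-resp (trans (emb-1-pow 1) (+-congˡ (-‿cong (*-identityʳ q̂)))) (unit-emb reg-1-q)

    unit-1-q2 : Unit (1# - q2)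
    unit-1-q2 = unit-resp (emb-1-pow 2) (unit-emb reg-1-q²)

    unit-1+q2 : Unit (1# + q2)
    unit-1+q2 = unit-resp (trans (emb-+ _ _) (+-congˡ (emb-pow q 2))) (unit-emb reg-1+q²)

    x̄ i₁ i₂ z : Fraction
    x̄ = inverseOf x̂ unit-x̂
    i₁ = inverseOf (1# - q̂) unit-1-q̂
    i₂ = inverseOf (1# - q2) unit-1-q2
    z = inverseOf (pow q̂ 4) (unit-pow 4 unit-q̂)

    iq : ℕ → Fraction
    iq k = inverseOf (pow q̂ k) (unit-pow k unit-q̂)

    x̂x̄≈1 : x̂ * x̄ ≈ 1#
    x̂x̄≈1 = inverseOf-inverse x̂ unit-x̂

    i₁-inverse : (1# - q̂) * i₁ ≈ 1#
    i₁-inverse = inverseOf-inverse (1# - q̂) unit-1-q̂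

    za²≈1 : z * (a * a) ≈ 1#
    za²≈1 = trans (solve 2 (λ z q → z :* (q :* q :* (q :* q)) := q :* (q :* (q :* (q :* :1))) :* z) ≡.refl z q̂)
      (inverseOf-inverse (pow q̂ 4) (unit-pow 4 unit-q̂))

    iq-inverse : ∀ k → pow q̂ k * iq k ≈ 1#
    iq-inverse k = inverseOf-inverse (pow q̂ k) (unit-pow k unit-q̂)

    iq-4k : ∀ k → iq (4 ℕ.* k) ≈ pow z k
    iq-4k k = cancelˡ (unit-pow (4 ℕ.* k) unit-q̂) (trans (iq-inverse (4 ℕ.* k))
      (sym (trans (*-congʳ (pow-* q̂ 4 k)) (trans (sym (pow-distrib (pow q̂ 4) z k))
        (trans (pow-cong k (inverseOf-inverse (pow q̂ 4) (unit-pow 4 unit-q̂))) (pow-1 k))))))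

    qint qint2 : ℕ → Fraction
    qint m = (1# - pow q̂ m) * i₁
    qint2 m = (1# - pow q̂ (2 ℕ.* m)) * i₂

    open LinearSum fractionRing p q̂ x̂ x̄ z public using (weight; numeratorE)
      renaming (num to top; den to bottom)

    unit-E : Unit (pow (1# - q̂) 2 * (1# + q2))
    unit-E = unit-* (unit-pow 2 unit-1-q̂) unit-1+q2

    iE : Fraction
    iE = inverseOf (pow (1# - q̂) 2 * (1# + q2)) unit-E

    E : Fraction
    E = 1# - ((1# - x̂ * q2) * (1# - q2 * x̄)) * iE

    E-numerator : (1# - q̂) * (1# - q̂) * (1# + a) * E ≈ numeratorE
    E-numerator = trans expand (+-congˡ (-‿cong (trans (*-congˡ inverse-iE) (*-identityʳ _))))
      where
      inverse-iE : pow (1# - q̂) 2 * (1# + q2) * iE ≈ 1#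
      inverse-iE = inverseOf-inverse (pow (1# - q̂) 2 * (1# + q2)) unit-E
      expand : (1# - q̂) * (1# - q̂) * (1# + a) * E
        ≈ (1# - q̂) * (1# - q̂) * (1# + a) - (1# - x̂ * a) * (1# - x̄ * a) * (pow (1# - q̂) 2 * (1# + q2) * iE)
      expand = solve 4 (λ q x x̄ i →
        (:1 :- q) :* (:1 :- q) :* (:1 :+ q :* q) :* (:1 :- ((:1 :- x :* (q :* (q :* :1))) :* (:1 :- q :* (q :* :1) :* x̄)) :* i)
        := (:1 :- q) :* (:1 :- q) :* (:1 :+ q :* q) :- (:1 :- x :* (q :* q)) :* (:1 :- x̄ :* (q :* q))
          :* (((:1 :- q) :* ((:1 :- q) :* :1)) :* (:1 :+ q :* (q :* :1)) :* i)) ≡.refl q̂ x̂ x̄ iE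

    ν : Fraction
    ν = i₁ * i₁ * i₂

    prefactor : ℕ → Fraction
    prefactor k = iq (4 ℕ.* k) * pow (qint (8 ℕ.* k ℕ.+ 1)) 2 * qint2 (8 ℕ.* k ℕ.+ 1)

    prefactor≈ : ∀ k → prefactor k ≈ ν * (weight k * pow z k)
    prefactor≈ k = trans (*-cong (*-cong (iq-4k k) (pow-cong 2 (*-congʳ (+-congˡ (-‿cong (pow-8k+1 k))))))
        (*-congʳ (+-congˡ (-‿cong (pow-2[8k+1] k)))))
      (solve 5 (λ Z u v i j → Z :* (u :* i :* (u :* i :* :1)) :* (v :* j) := i :* i :* j :* (u :* u :* v :* Z)) ≡.refl
        (pow z k) (1# - q̂ * pow p k) (1# - a * (pow p k * pow p k)) i₁ i₂)

    topProduct bottomProduct : ℕ → Fraction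
    topProduct k = pow (poch q2 p k) 2 * poch (x̂ * q2) p k * poch (q2 * x̄) p k
    bottomProduct k = pow (poch p p k) 2 * poch (x̂ * p) p k * poch (p * x̄) p k

    topProduct-step : ∀ k → topProduct (suc k) ≈ topProduct k * top k
    topProduct-step k = solve 7 (λ A B C q x x̄ P → let q2 = q :* (q :* :1) in
        (A :* (:1 :- q2 :* P)) :* ((A :* (:1 :- q2 :* P)) :* :1) :* (B :* (:1 :- x :* q2 :* P)) :* (C :* (:1 :- q2 :* x̄ :* P))
        := A :* (A :* :1) :* B :* C
          :* ((:1 :- q :* q :* P) :* (:1 :- q :* q :* P) :* ((:1 :- x :* (q :* q) :* P) :* (:1 :- x̄ :* (q :* q) :* P))))
        ≡.refl (poch q2 p k) (poch (x̂ * q2) p k) (poch (q2 * x̄) p k) q̂ x̂ x̄ (pow p k)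

    bottomProduct-step : ∀ k → bottomProduct (suc k) ≈ bottomProduct k * bottom k
    bottomProduct-step k = solve 7 (λ A B C p x x̄ P →
        (A :* (:1 :- p :* P)) :* ((A :* (:1 :- p :* P)) :* :1) :* (B :* (:1 :- x :* p :* P)) :* (C :* (:1 :- p :* x̄ :* P))
        := A :* (A :* :1) :* B :* C
          :* ((:1 :- p :* P) :* (:1 :- p :* P) :* ((:1 :- x :* (p :* P)) :* (:1 :- x̄ :* (p :* P)))))
        ≡.refl (poch p p k) (poch (x̂ * p) p k) (poch (p * x̄) p k) p x̂ x̄ (pow p k)

    -- This is `bottom k` multiplied by `x`, which makes it a polynomial: `1 - x̄ p^(k+1)` becomes
    -- `x - q^(8k+8)`. Likewise `μ` is `top k` multiplied by `x`.
    δ : ℕ → R.Carrier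
    δ k = (R.1# R.- R.pow q (8 ℕ.* suc k)) R.* (R.1# R.- R.pow q (8 ℕ.* suc k))
      R.* ((R.1# R.- x R.* R.pow q (8 ℕ.* suc k)) R.* (x R.- R.pow q (8 ℕ.* suc k)))

    μ : ℕ → R.Carrier
    μ k = (R.1# R.- R.pow q (8 ℕ.* k ℕ.+ 2)) R.* (R.1# R.- R.pow q (8 ℕ.* k ℕ.+ 2))
      R.* ((R.1# R.- x R.* R.pow q (8 ℕ.* k ℕ.+ 2)) R.* (x R.- R.pow q (8 ℕ.* k ℕ.+ 2)))

    private
      emb-factors : ∀ n → emb ((R.1# R.- R.pow q n) R.* (R.1# R.- R.pow q n)
          R.* ((R.1# R.- x R.* R.pow q n) R.* (x R.- R.pow q n)))
        ≈ (1# - pow q̂ n) * (1# - pow q̂ n) * ((1# - x̂ * pow q̂ n) * (1# - x̄ * pow q̂ n)) * x̂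
      emb-factors n = trans (trans (emb-* _ _) (*-cong
          (trans (emb-* _ _) (*-cong (emb-1-pow n) (emb-1-pow n)))
          (trans (emb-* _ _) (*-cong (emb-1-x*pow n) (emb-x-pow n)))))
        (trans (*-congˡ (*-congˡ (+-congˡ (-‿cong (trans (sym (*-identityˡ _)) (*-congʳ (sym x̂x̄≈1)))))))
          (solve 4 (λ u x x̄ P → u :* ((:1 :- x :* P) :* (x :- x :* x̄ :* P)) := u :* ((:1 :- x :* P) :* (:1 :- x̄ :* P)) :* x)
            ≡.refl _ x̂ x̄ (pow q̂ n)))

    emb-δ : ∀ k → emb (δ k) ≈ bottom k * x̂
    emb-δ k = trans (emb-factors (8 ℕ.* suc k)) (*-congʳ (*-cong (*-cong e e)
      (*-cong (+-congˡ (-‿cong (*-congˡ (pow-p (suc k))))) (+-congˡ (-‿cong (*-congˡ (pow-p (suc k))))))))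
      where e = +-congˡ {1#} (-‿cong (pow-p (suc k)))

    emb-μ : ∀ k → emb (μ k) ≈ top k * x̂
    emb-μ k = trans (emb-factors (8 ℕ.* k ℕ.+ 2)) (*-congʳ (*-cong (*-cong e e)
      (*-cong (+-congˡ (-‿cong (trans (*-congˡ (pow-8k+2 k)) (sym (*-assoc _ _ _)))))
              (+-congˡ (-‿cong (trans (*-congˡ (pow-8k+2 k)) (sym (*-assoc _ _ _))))))))
      where e = +-congˡ {1#} (-‿cong (pow-8k+2 k))

    unit-bottom : ∀ k → R.Reg g (δ k) → Unit (bottom k)
    unit-bottom k r = unit-factor (unit-resp (emb-δ k) (unit-emb r))

-- The case in which every denominator of the summand is regular modulo `g`, so that its definition
-- can be read literally. It covers the field of fractions (`g = 0`) and the factors linear in `x`,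
-- but not the cyclotomic ones.
module Poles (R : CommutativeRing 0ℓ 0ℓ) (q x g : CommutativeRing.Carrier R)
  (regularity : Side.Regularity R q x g)
  (reg-δ : ∀ k → Divisibility.Reg R g (Side.Elements.δ R q x g regularity k)) where
  private module R where
    open CommutativeRing R public
    open Divisibility R public
    open Kit R public
  open Localisation R g using (Fraction; emb; unit-emb; fractionRing)
  open Side R q x g
  open Elements regularity
  open Solver fractionRing using (solve; _:=_; _:*_; _:+_; _:-_; :1; :0)
  open import Relation.Binary.Reasoning.Setoid setoid

  unit-bottom′ : ∀ k → Unit (bottom k)
  unit-bottom′ k = unit-bottom k (reg-δ k)

  unit-bottomProduct : ∀ k → Unit (bottomProduct k)
  unit-bottomProduct zero = unit-resp (solve 0 (:1 := :1 :* (:1 :* :1) :* :1 :* :1) ≡.refl) unit-1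
  unit-bottomProduct (suc k) = unit-resp (sym (bottomProduct-step k)) (unit-* (unit-bottomProduct k) (unit-bottom′ k))

  unit-1-p : ∀ k → Unit (1# - p * pow p k)
  unit-1-p k = unit-factor (unit-factor (unit-bottom′ k))

  unit-1-x : ∀ k → Unit (1# - x̂ * pow p (suc k))
  unit-1-x k = unit-factor (unit-factor (unit-resp (*-comm _ _) (unit-bottom′ k)))

  unit-1-x̄ : ∀ k → Unit (1# - x̄ * pow p (suc k))
  unit-1-x̄ k = unit-factor (unit-resp (*-comm _ _) (unit-factor (unit-resp (*-comm _ _) (unit-bottom′ k))))

  ip : ℕ → Fraction
  ip m = inverseOf (poch p p m) (unit-poch m unit-1-p)

  ip-inverse : ∀ m → poch p p m * ip m ≈ 1#
  ip-inverse m = inverseOf-inverse (poch p p m) (unit-poch m unit-1-p)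

  c α ratio : ℕ → Fraction
  c k = topProduct k * inverseOf (bottomProduct k) (unit-bottomProduct k)
  α k = prefactor k * c k
  ratio m = poch (pow q̂ 4) p m * ip m

  c₀ : c 0 ≈ 1#
  c₀ = trans (*-congʳ (solve 0 (:1 :* (:1 :* :1) :* :1 :* :1 := :1 :* (:1 :* :1) :* :1 :* :1) ≡.refl))
    (inverseOf-inverse (bottomProduct 0) (unit-bottomProduct 0))

  c-bottomProduct : ∀ k → c k * bottomProduct k ≈ topProduct k
  c-bottomProduct k = trans (*-assoc _ _ _) (trans (*-congˡ (trans (*-comm _ _)
    (inverseOf-inverse (bottomProduct k) (unit-bottomProduct k)))) (*-identityʳ _))

  c-step : ∀ k → c (suc k) * bottom k ≈ c k * top k
  c-step k = cancelˡ (unit-bottomProduct k) (begin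
    bottomProduct k * (c (suc k) * bottom k)
      ≈⟨ solve 3 (λ u v w → u :* (v :* w) := v :* (u :* w)) ≡.refl _ _ _ ⟩
    c (suc k) * (bottomProduct k * bottom k)  ≈⟨ *-congˡ (bottomProduct-step k) ⟨
    c (suc k) * bottomProduct (suc k)         ≈⟨ c-bottomProduct (suc k) ⟩
    topProduct (suc k)                        ≈⟨ topProduct-step k ⟩
    topProduct k * top k                      ≈⟨ *-congʳ (c-bottomProduct k) ⟨
    c k * bottomProduct k * top k
      ≈⟨ solve 3 (λ u v w → u :* v :* w := v :* (u :* w)) ≡.refl _ _ _ ⟩
    bottomProduct k * (c k * top k) ∎)

  c-step-emb : ∀ k → c (suc k) * emb (δ k) ≈ c k * emb (μ k)
  c-step-emb k = trans (*-congˡ (emb-δ k)) (trans (sym (*-assoc _ _ _)) (trans (*-congʳ (c-step k))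
    (trans (*-assoc _ _ _) (*-congˡ (sym (emb-μ k))))))

  ratio₀ : ratio 0 ≈ 1#
  ratio₀ = ip-inverse 0

  ratio-poch : ∀ k → ratio k * poch p p k ≈ poch (pow q̂ 4) p k
  ratio-poch k = trans (*-assoc _ _ _) (trans (*-congˡ (trans (*-comm _ _) (ip-inverse k))) (*-identityʳ _))

  ratio-step : ∀ k → ratio (suc k) * emb (R.1# R.- R.pow q (8 ℕ.* suc k)) ≈ ratio k * emb (R.1# R.- R.pow q (8 ℕ.* k ℕ.+ 4))
  ratio-step k = cancelˡ (unit-poch k unit-1-p) (begin
    poch p p k * (ratio (suc k) * emb (R.1# R.- R.pow q (8 ℕ.* suc k)))
      ≈⟨ *-congˡ (*-congˡ (trans (emb-1-pow (8 ℕ.* suc k)) (+-congˡ (-‿cong (pow-p (suc k)))))) ⟩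
    poch p p k * (ratio (suc k) * (1# - p * pow p k))
      ≈⟨ solve 3 (λ u v w → u :* (v :* w) := v :* (u :* w)) ≡.refl _ _ _ ⟩
    ratio (suc k) * poch p p (suc k)          ≈⟨ ratio-poch (suc k) ⟩
    poch (pow q̂ 4) p k * (1# - pow q̂ 4 * pow p k)
      ≈⟨ *-cong (ratio-poch k) (trans (emb-1-pow (8 ℕ.* k ℕ.+ 4)) (+-congˡ (-‿cong (pow-8k+4 k)))) ⟨
    ratio k * poch p p k * emb (R.1# R.- R.pow q (8 ℕ.* k ℕ.+ 4))
      ≈⟨ solve 3 (λ u v w → u :* v :* w := v :* (u :* w)) ≡.refl _ _ _ ⟩
    poch p p k * (ratio k * emb (R.1# R.- R.pow q (8 ℕ.* k ℕ.+ 4))) ∎)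

  α≈ : ∀ k → α k ≈ ν * (weight k * (pow z k * c k))
  α≈ k = trans (*-congʳ (prefactor≈ k))
    (solve 4 (λ n w z c → n :* (w :* z) :* c := n :* (w :* (z :* c))) ≡.refl ν (weight k) (pow z k) (c k))

  rhs : ℕ → ℕ → ℕ → ℕ → Fraction
  rhs n m e i = pow (qint2 n) i * pow (ratio m) i * iq e * pow E i

  module Linear (reg-1-q^ : ∀ j → R.Reg g (R.1# R.- R.pow q (suc j)))
    (M : ℕ) (x≈ : x̂ ≈ a * pow p M ⊎ x̄ ≈ a * pow p M) where

    private
      X : Fraction
      X = a * pow p M

      unit-1-q^ : ∀ j → Unit (1# - pow q̂ (suc j))
      unit-1-q^ j = unit-resp (emb-1-pow (suc j)) (unit-emb (reg-1-q^ j))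

      unit-1-aP : ∀ j → Unit (1# - a * pow p j)
      unit-1-aP j = unit-resp (+-congˡ (-‿cong (trans (reflexive (≡.cong (pow q̂) (≡.sym (ℕₚ.+-comm (8 ℕ.* j) 2)))) (pow-8k+2 j))))
        (unit-1-q^ (suc (8 ℕ.* j)))

      unit-p : Unit p
      unit-p = unit-pow 8 unit-q̂

      unit-1-Xa : Unit (1# - X * a)
      unit-1-Xa = unit-resp (+-congˡ (-‿cong (trans (reflexive (≡.cong (pow q̂) (≡.sym (ℕₚ.+-comm (8 ℕ.* M) 4))))
          (trans (pow-8k+4 M) (solve 2 (λ q P → q :* (q :* (q :* (q :* :1))) :* P := q :* q :* P :* (q :* q)) ≡.refl q̂ (pow p M))))))
        (unit-1-q^ (3 ℕ.+ 8 ℕ.* M))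

      unit-1-uX : ∀ {u} → u ≈ X → Unit (1# - u * a)
      unit-1-uX e = unit-resp (+-congˡ (-‿cong (*-congʳ (sym e)))) unit-1-Xa

      swapped : ∀ {u v w} → u * (v * w) ≈ u * (w * v)
      swapped = *-congˡ (*-comm _ _)

    S : Fraction
    S = sum (suc M) (λ k → weight k * (pow z k * c k))

    S≈ : S * (poch p p M * pow a M * (1# + a)) ≈ (1# - X) * poch (a * a) p M * numeratorE
    S≈ = [ direct , reflected ]′ x≈
      where
      direct : x̂ ≈ X → S * (poch p p M * pow a M * (1# + a)) ≈ (1# - X) * poch (a * a) p M * numeratorE
      direct e = trans
        (LinearSum.linear-sum fractionRing p q̂ x̂ x̄ z x̂x̄≈1 za²≈1 M e unit-p unit-1-p unit-1-aP unit-1-x̄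
          (unit-1-uX e) c c₀ c-step)
        (*-congʳ (*-congʳ (+-congˡ (-‿cong e))))
      -- Up to the order of two factors, `top`, `bottom` and `numeratorE` are symmetric in `x̂` and
      -- `x̄`.
      reflected : x̄ ≈ X → S * (poch p p M * pow a M * (1# + a)) ≈ (1# - X) * poch (a * a) p M * numeratorE
      reflected e = trans
        (LinearSum.linear-sum fractionRing p q̂ x̄ x̂ z (trans (*-comm _ _) x̂x̄≈1) za²≈1 M e unit-p unit-1-p unit-1-aP unit-1-x
          (unit-1-uX e) c c₀ (λ k → trans (*-congˡ swapped) (trans (c-step k) (*-congˡ swapped))))
        (*-cong (*-congʳ (+-congˡ (-‿cong e))) (+-congˡ (-‿cong (*-comm _ _))))

    private
      ā w : Fraction
      ā = z * a
      w = pow ā M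

      aā≈1 : a * ā ≈ 1#
      aā≈1 = trans (solve 2 (λ z a → a :* (z :* a) := z :* (a :* a)) ≡.refl z a) za²≈1

      a^Mw≈1 : pow a M * w ≈ 1#
      a^Mw≈1 = trans (sym (pow-distrib a ā M)) (trans (pow-cong M aā≈1) (pow-1 M))

      q^2M≈ : pow q̂ (2 ℕ.* M) ≈ pow a M
      q^2M≈ = trans (pow-* q̂ 2 M) (pow-cong M q2≈a)

      iq-2Mi : ∀ i → iq (2 ℕ.* M ℕ.* i) ≈ pow w i
      iq-2Mi i = cancelˡ (unit-pow (2 ℕ.* M ℕ.* i) unit-q̂) (trans (iq-inverse (2 ℕ.* M ℕ.* i))
        (sym (trans (*-congʳ (trans (pow-* q̂ (2 ℕ.* M) i) (pow-cong i q^2M≈)))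
          (trans (sym (pow-distrib _ _ i)) (trans (pow-cong i a^Mw≈1) (pow-1 i))))))

    n : ℕ
    n = suc (4 ℕ.* M)

    private
      q^2n≈ : pow q̂ (2 ℕ.* n) ≈ X
      q^2n≈ = trans (reflexive (≡.cong (pow q̂) exponent)) (pow-8k+2 M)
        where
        exponent : 2 ℕ.* n ≡ 8 ℕ.* M ℕ.+ 2
        exponent = ≡.trans (ℕₚ.*-suc 2 (4 ℕ.* M)) (≡.trans (ℕₚ.+-comm 2 (2 ℕ.* (4 ℕ.* M)))
          (≡.cong (ℕ._+ 2) (≡.sym (ℕₚ.*-assoc 2 4 M))))

    β* : Fraction
    β* = qint2 n * ratio M * w * E

    sum-α≈ : sum (suc M) α ≈ β*
    sum-α≈ = cancelˡ (unit-* (unit-* (unit-* (unit-poch M unit-1-p) (unit-pow M (unit-* unit-q̂ unit-q̂)))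
        (unit-resp (+-congˡ q2≈a) unit-1+q2)) (unit-* unit-1-q̂ unit-1-q̂)) (begin
      Pp * A * B * (C * C) * sum (suc M) α
        ≈⟨ *-congˡ (trans (sum-cong (suc M) λ k _ → α≈ k) (sum-*ˡ (suc M) ν _)) ⟩
      Pp * A * B * (C * C) * (i₁ * i₁ * i₂ * S)
        ≈⟨ solve 7 (λ P A B C i j S → P :* A :* B :* (C :* C) :* (i :* i :* j :* S)
             := (C :* i) :* (C :* i) :* j :* (S :* (P :* A :* B))) ≡.refl Pp A B C i₁ i₂ S ⟩
      (C * i₁) * (C * i₁) * i₂ * (S * (Pp * A * B))
        ≈⟨ *-cong (trans (*-congʳ (trans (*-cong i₁-inverse i₁-inverse) (*-identityˡ 1#))) (*-identityˡ i₂)) S≈ ⟩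
      i₂ * ((1# - X) * poch (a * a) p M * numeratorE)
        ≈⟨ *-congˡ (*-cong (*-cong (+-congˡ (-‿cong q^2n≈)) (poch-cong p M
             (solve 1 (λ q → q :* (q :* (q :* (q :* :1))) := q :* q :* (q :* q)) ≡.refl q̂))) E-numerator) ⟨
      i₂ * ((1# - pow q̂ (2 ℕ.* n)) * C₂ * (C * C * B * E))
        ≈⟨ solve 6 (λ j u D C B E → j :* (u :* D :* (C :* C :* B :* E)) := (u :* j) :* D :* (B :* (C :* C)) :* E)
             ≡.refl i₂ (1# - pow q̂ (2 ℕ.* n)) C₂ C B E ⟩
      qint2 n * C₂ * (B * (C * C)) * E
        ≈⟨ *-congʳ (*-congˡ (trans (sym (*-identityˡ _)) (*-congʳ (sym
             (trans (*-cong (ip-inverse M) a^Mw≈1) (*-identityˡ 1#)))))) ⟩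
      qint2 n * C₂ * ((Pp * ip M * (A * w)) * (B * (C * C))) * E
        ≈⟨ solve 9 (λ u D P i A w B C E → u :* D :* ((P :* i :* (A :* w)) :* (B :* C)) :* E
             := P :* A :* B :* C :* (u :* (D :* i) :* w :* E)) ≡.refl (qint2 n) C₂ Pp (ip M) A w B (C * C) E ⟩
      Pp * A * B * (C * C) * β* ∎)
      where
      Pp = poch p p M
      A = pow a M
      B = 1# + a
      C = 1# - q̂
      C₂ = poch (pow q̂ 4) p M

    -- With `n = 4 M + 1` the element `w` is `q^((1-n)/2)`; its powers for `i` = 2, 3, 4 are the
    -- powers of `q` in the three congruences.
    rhs≈ : ∀ i → rhs n M (2 ℕ.* M ℕ.* i) i ≈ pow β* i
    rhs≈ i = trans (*-congʳ (*-congˡ (iq-2Mi i))) (sym (trans (pow-distrib _ _ i)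
      (*-congʳ (trans (pow-distrib _ _ i) (*-congʳ (pow-distrib _ _ i))))))

    private
      1-vX≈0 : ∀ u v → u * v ≈ 1# → u ≈ X → 1# - v * a * pow p M ≈ 0#
      1-vX≈0 u v h e = trans (+-congˡ (-‿cong (trans (*-assoc v a (pow p M)) (trans (*-congˡ (sym e)) (trans (*-comm v u) h)))))
        (-‿inverseʳ 1#)

      top≈0 : x̂ ≈ X ⊎ x̄ ≈ X → top M ≈ 0#
      top≈0 (inj₁ e) = trans (*-congˡ (*-congˡ (1-vX≈0 x̂ x̄ x̂x̄≈1 e))) (trans (*-congˡ (zeroʳ _)) (zeroʳ _))
      top≈0 (inj₂ e) = trans (*-congˡ (*-congʳ (1-vX≈0 x̄ x̂ (trans (*-comm _ _) x̂x̄≈1) e))) (trans (*-congˡ (zeroˡ _)) (zeroʳ _))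

    α-vanishes : ∀ j → M ℕ.< j → α j ≈ 0#
    α-vanishes j lt = trans (*-congˡ (Recurrence.vanishes-beyond fractionRing c top bottom c-step unit-bottom′ M (top≈0 x≈) j lt))
      (zeroʳ (prefactor j))

    private
      module Conv = Convolution fractionRing α
      module Conc = Conv.Concentrated M α-vanishes

      4M<n : M ℕ.+ (M ℕ.+ (M ℕ.+ M)) ℕ.< n
      4M<n = ℕ.s≤s (ℕₚ.≤-reflexive (≡.cong (λ j → M ℕ.+ (M ℕ.+ (M ℕ.+ j))) (≡.sym (ℕₚ.+-identityʳ M))))

      drop : ∀ {k j} → k ℕ.+ j ℕ.< n → j ℕ.< n
      drop {k} = ℕₚ.≤-<-trans (ℕₚ.m≤n+m _ k)

      3M<n : M ℕ.+ (M ℕ.+ M) ℕ.< n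
      3M<n = drop {M} 4M<n

    s-linear : sum n Conv.s - rhs n M (2 ℕ.* M ℕ.* 2) 2 ≈ 0#
    s-linear = trans (+-cong (trans (Conc.sum-s n (drop {M} 3M<n)) (*-cong sum-α≈ sum-α≈)) (-‿cong (rhs≈ 2)))
      (solve 1 (λ b → b :* b :- b :* (b :* :1) := :0) ≡.refl β*)

    t-linear : sum n Conv.t - rhs n M (2 ℕ.* M ℕ.* 3) 3 ≈ 0#
    t-linear = trans (+-cong (trans (Conc.sum-t n 3M<n) (*-cong sum-α≈ (*-cong sum-α≈ sum-α≈))) (-‿cong (rhs≈ 3)))
      (solve 1 (λ b → b :* (b :* b) :- b :* (b :* (b :* :1)) := :0) ≡.refl β*)

    u-linear : sum n Conv.u - rhs n M (2 ℕ.* M ℕ.* 4) 4 ≈ 0#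
    u-linear = trans (+-cong (trans (Conc.sum-u n 4M<n) (*-cong sum-α≈ (*-cong sum-α≈ (*-cong sum-α≈ sum-α≈)))) (-‿cong (rhs≈ 4)))
      (solve 1 (λ b → b :* (b :* (b :* b)) :- b :* (b :* (b :* (b :* :1))) := :0) ≡.refl β*)

-- Integrality of sequences whose recurrence has poles

suc-%-cases : ∀ d k .{{_ : ℕ.NonZero d}} → (suc k % d ≡ 0 × suc (k % d) ≡ d) ⊎ (suc k % d ≡ suc (k % d))
suc-%-cases d k = cases (ℕₚ.m≤n⇒m<n∨m≡n (DivMod.m%n<n k d))
  where
  reduce : suc k % d ≡ suc (k % d) % d
  reduce = ≡.trans (≡.cong (λ i → suc i % d) (DivMod.m≡m%n+[m/n]*n k d)) (DivMod.[m+kn]%n≡m%n (suc (k % d)) (k / d) d)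
  cases : suc (k % d) ℕ.< d ⊎ suc (k % d) ≡ d → (suc k % d ≡ 0 × suc (k % d) ≡ d) ⊎ (suc k % d ≡ suc (k % d))
  cases (inj₁ lt) = inj₂ (≡.trans reduce (DivMod.m<n⇒m%n≡m lt))
  cases (inj₂ e) = inj₁ (≡.trans reduce (≡.trans (≡.cong (_% d) e) (DivMod.n%n≡0 d)) , e)

module Integrality (R : CommutativeRing 0ℓ 0ℓ) (dom : IsDomain R) (g : CommutativeRing.Carrier R) where
  private module R where
    open CommutativeRing R public
    open Divisibility R public
  open FractionField R dom
  open Comparison g
  private module L = Localisation R g
  open CommutativeRing K.fractionRing
  open Kit K.fractionRing
  open Solver K.fractionRing using (solve; _:=_; _:*_; :1)

  -- Numerators vanishing modulo g (at k ≡ j₀) precede denominators vanishing modulo g (at k ≡ d - 1),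
  -- and both do so through the same factor e. Inside a block, the sequence acquires the factor e
  -- after j₀ and loses it at the end of the block.
  module _ (r : ℕ → Carrier) (δ μ : ℕ → R.Carrier)
    (step : ∀ k → r (suc k) * K.emb (δ k) ≈ r k * K.emb (μ k))
    (e : R.Carrier) (e≉0 : ¬ e R.≈ R.0#)
    (d j₀ : ℕ) .{{_ : ℕ.NonZero d}} (1+j₀<d : suc j₀ ℕ.< d)
    (δ≉0 : ∀ k → ¬ δ k R.≈ R.0#)
    (μ-factor : ∀ k → k % d ≡ j₀ → ∃ λ μ′ → μ k R.≈ e R.* μ′)
    (δ-factor : ∀ k → suc k % d ≡ 0 → ∃ λ δ′ → δ k R.≈ e R.* δ′ × R.Reg g δ′)
    (δ-regular : ∀ k → ¬ suc k % d ≡ 0 → R.Reg g (δ k))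
    where

    private
      Integral : Carrier → Set
      Integral y = ∃ λ ŷ → y ~ ŷ

      State : ℕ → Set
      State k = (k % d ℕ.≤ j₀ × Integral (r k))
        ⊎ (j₀ ℕ.< k % d × ∃ λ y → r k ≈ K.emb e * y × Integral y)

      unit-e : Unit (K.emb e)
      unit-e = K.unit-emb (DomainProperties.reg-0 R dom e≉0)

      unit-δ : ∀ k → Unit (K.emb (δ k))
      unit-δ k = K.unit-emb (DomainProperties.reg-0 R dom (δ≉0 k))

      solve-δ : ∀ {y y′ δ μ} → R.Reg g δ → y′ * K.emb δ ≈ y * K.emb μ → Integral y → Integral y′
      solve-δ r h (ŷ , s) = _ , ~-solve r h s

      divided : ∀ k → Carrier → Carrier
      divided k y = y * inv (unit-δ k)

      divided-eq : ∀ k y → divided k y * K.emb (δ k) ≈ y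
      divided-eq k y = quotient-eq (unit-δ k)

      enter : ∀ k {μ′} → μ k R.≈ e R.* μ′ → r (suc k) ≈ K.emb e * divided k (r k * K.emb μ′)
      enter k {μ′} h = cancelˡ (unit-δ k) (trans (trans (*-comm _ _) (trans (step k)
          (*-congˡ (trans (K.emb-cong h) (K.emb-* e μ′)))))
        (trans (solve 3 (λ r e m → r :* (e :* m) := e :* (r :* m)) ≡.refl (r k) (K.emb e) (K.emb μ′))
        (trans (*-congˡ (sym (divided-eq k _)))
          (solve 3 (λ e y d → e :* (y :* d) := d :* (e :* y)) ≡.refl (K.emb e) _ (K.emb (δ k))))))

      inside : ∀ k {y} → r k ≈ K.emb e * y → r (suc k) ≈ K.emb e * divided k (y * K.emb (μ k))
      inside k {y} h = cancelˡ (unit-δ k) (trans (trans (*-comm _ _) (trans (step k) (*-congʳ h)))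
        (trans (*-assoc _ _ _)
        (trans (*-congˡ (sym (divided-eq k _)))
          (solve 3 (λ e y d → e :* (y :* d) := d :* (e :* y)) ≡.refl (K.emb e) _ (K.emb (δ k))))))

      -- At the end of a block the `e` stored in `r k` pays for the one in `δ k`, and only the
      -- regular `δ′` remains to be divided by.
      leave : ∀ k {y δ′} → r k ≈ K.emb e * y → δ k R.≈ e R.* δ′ → r (suc k) * K.emb δ′ ≈ y * K.emb (μ k)
      leave k {y} {δ′} h f = cancelˡ unit-e
        (trans (solve 3 (λ e r d → e :* (r :* d) := r :* (e :* d)) ≡.refl (K.emb e) (r (suc k)) (K.emb δ′))
        (trans (*-congˡ (sym (trans (K.emb-cong f) (K.emb-* e δ′))))
        (trans (step k) (trans (*-congʳ h) (*-assoc _ _ _)))))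

      next : ∀ k → State k → State (suc k)
      next k st = advance (suc-%-cases d k) st
        where
        advance : (suc k % d ≡ 0 × suc (k % d) ≡ d) ⊎ (suc k % d ≡ suc (k % d)) → State k → State (suc k)
        advance (inj₁ (z , last)) (inj₁ (le , _)) = ⊥-elim (ℕₚ.<⇒≢ (ℕₚ.≤-<-trans (ℕ.s≤s le) 1+j₀<d) last)
        advance (inj₁ (z , last)) (inj₂ (_ , y , h , int)) =
          inj₁ (≡.subst (ℕ._≤ j₀) (≡.sym z) ℕ.z≤n ,
            solve-δ (proj₂ (proj₂ (δ-factor k z))) (leave k h (proj₁ (proj₂ (δ-factor k z)))) int)
        advance (inj₂ s) st = proceed st (δ-regular k λ z → ℕₚ.0≢1+n (≡.trans (≡.sym z) s))
          where
          proceed : State k → R.Reg g (δ k) → State (suc k)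
          proceed (inj₁ (le , int)) reg = branch (ℕₚ.m≤n⇒m<n∨m≡n le)
            where
            branch : k % d ℕ.< j₀ ⊎ k % d ≡ j₀ → State (suc k)
            branch (inj₁ lt) = inj₁ (≡.subst (ℕ._≤ j₀) (≡.sym s) lt , solve-δ reg (step k) int)
            branch (inj₂ eq) = inj₂ (≡.subst (j₀ ℕ.<_) (≡.sym s) (ℕ.s≤s (ℕₚ.≤-reflexive (≡.sym eq)))
              , divided k (r k * K.emb (proj₁ (μ-factor k eq))) , enter k (proj₂ (μ-factor k eq))
              , solve-δ reg (divided-eq k _) int)
          proceed (inj₂ (lt , y , h , int)) reg = inj₂ (≡.subst (j₀ ℕ.<_) (≡.sym s) (ℕₚ.m<n⇒m<1+n lt)
              , divided k (y * K.emb (μ k)) , inside k h , solve-δ reg (divided-eq k _) int)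

      states : Integral (r 0) → ∀ k → State k
      states int zero = inj₁ (≡.subst (ℕ._≤ j₀) (≡.sym (DivMod.m<n⇒m%n≡m (ℕₚ.≤-<-trans ℕ.z≤n 1+j₀<d))) ℕ.z≤n , int)
      states int (suc k) = next k (states int k)

    integral : (∃ λ ŷ → r 0 ~ ŷ) → ∀ k → ∃ λ ŷ → r k ~ ŷ
    integral int k = conclude (states int k)
      where
      conclude : State k → Integral (r k)
      conclude (inj₁ (_ , i)) = i
      conclude (inj₂ (_ , y , h , ŷ , s)) = _ , ~-resp (sym h) (~-* (~-emb e) s)

-- Representatives modulo a factor

module Compare (R : CommutativeRing 0ℓ 0ℓ) (dom : IsDomain R) (q x g : CommutativeRing.Carrier R)
  (regK : Side.Regularity R q x (CommutativeRing.0# R)) (regL : Side.Regularity R q x g) where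
  open FractionField R dom
  open Comparison g public
  private
    module SK = Side R q x (CommutativeRing.0# R)
    module EK = SK.Elements regK
    module SL = Side R q x g
    module EL = SL.Elements regL

  ~-1 : SK.1# ~ SL.1#
  ~-1 = ~-emb (CommutativeRing.1# R)

  q~ : SK.q̂ ~ SL.q̂
  q~ = ~-emb q

  x~ : SK.x̂ ~ SL.x̂
  x~ = ~-emb x

  p~ : SK.p ~ SL.p
  p~ = ~-pow 8 q~

  a~ : SK.a ~ SL.a
  a~ = ~-* q~ q~

  q2~ : SK.q2 ~ SL.q2
  q2~ = ~-pow 2 q~

  x̄~ : EK.x̄ ~ EL.x̄
  x̄~ = ~-recip x~ _ _

  i₁~ : EK.i₁ ~ EL.i₁
  i₁~ = ~-recip (~-- ~-1 q~) _ _

  i₂~ : EK.i₂ ~ EL.i₂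
  i₂~ = ~-recip (~-- ~-1 q2~) _ _

  iq~ : ∀ k → EK.iq k ~ EL.iq k
  iq~ k = ~-recip (~-pow k q~) _ _

  iE~ : EK.iE ~ EL.iE
  iE~ = ~-recip (~-* (~-pow 2 (~-- ~-1 q~)) (~-+ ~-1 q2~)) _ _

  E~ : EK.E ~ EL.E
  E~ = ~-- ~-1 (~-* (~-* (~-- ~-1 (~-* x~ q2~)) (~-- ~-1 (~-* q2~ x̄~))) iE~)

  qint~ : ∀ m → EK.qint m ~ EL.qint m
  qint~ m = ~-* (~-- ~-1 (~-pow m q~)) i₁~

  qint2~ : ∀ m → EK.qint2 m ~ EL.qint2 m
  qint2~ m = ~-* (~-- ~-1 (~-pow (2 ℕ.* m) q~)) i₂~

  prefactor~ : ∀ k → EK.prefactor k ~ EL.prefactor k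
  prefactor~ k = ~-* (~-* (iq~ (4 ℕ.* k)) (~-pow 2 (qint~ (8 ℕ.* k ℕ.+ 1)))) (qint2~ (8 ℕ.* k ℕ.+ 1))

  topProduct~ : ∀ k → EK.topProduct k ~ EL.topProduct k
  topProduct~ k = ~-* (~-* (~-pow 2 (~-poch k q2~ p~)) (~-poch k (~-* x~ q2~) p~)) (~-poch k (~-* q2~ x̄~) p~)

  bottomProduct~ : ∀ k → EK.bottomProduct k ~ EL.bottomProduct k
  bottomProduct~ k = ~-* (~-* (~-pow 2 (~-poch k p~ p~)) (~-poch k (~-* x~ p~) p~)) (~-poch k (~-* p~ x̄~) p~)

  top~ : ∀ k → EK.top k ~ EL.top k
  top~ k = ~-* (~-* (~-- ~-1 (~-* a~ P~)) (~-- ~-1 (~-* a~ P~)))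
    (~-* (~-- ~-1 (~-* (~-* x~ a~) P~)) (~-- ~-1 (~-* (~-* x̄~ a~) P~)))
    where P~ = ~-pow k p~

  bottom~ : ∀ k → EK.bottom k ~ EL.bottom k
  bottom~ k = ~-* (~-* (~-- ~-1 (~-* p~ P~)) (~-- ~-1 (~-* p~ P~)))
    (~-* (~-- ~-1 (~-* x~ (~-* p~ P~))) (~-- ~-1 (~-* x̄~ (~-* p~ P~))))
    where P~ = ~-pow k p~

  module _ {αK : ℕ → SK.Carrier} {αL : ℕ → SL.Carrier} (α~ : ∀ k → αK k ~ αL k) where
    private
      module CK = Convolution K.fractionRing αK
      module CL = Convolution (Localisation.fractionRing R g) αL

    s~ : ∀ k → CK.s k ~ CL.s k
    s~ k = ~-sum (suc k) λ j → ~-* (α~ j) (α~ (k ℕ.∸ j))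

    t~ : ∀ k → CK.t k ~ CL.t k
    t~ k = ~-sum (suc k) λ j → ~-sum (suc (k ℕ.∸ j)) λ i → ~-* (~-* (α~ j) (α~ i)) (α~ (k ℕ.∸ j ℕ.∸ i))

    u~ : ∀ k → CK.u k ~ CL.u k
    u~ k = ~-sum (suc k) λ j → ~-sum (suc (k ℕ.∸ j)) λ i → ~-sum (suc (k ℕ.∸ j ℕ.∸ i)) λ h →
      ~-* (~-* (~-* (α~ j) (α~ i)) (α~ h)) (α~ (k ℕ.∸ j ℕ.∸ i ℕ.∸ h))

  rhs~ : ∀ n e i {ρK ρL} → ρK ~ ρL →
    (SK.pow (EK.qint2 n) i SK.* SK.pow ρK i SK.* EK.iq e SK.* SK.pow EK.E i)
    ~ (SL.pow (EL.qint2 n) i SL.* SL.pow ρL i SL.* EL.iq e SL.* SL.pow EL.E i)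
  rhs~ n e i ρ~ = ~-* (~-* (~-* (~-pow i (qint2~ n)) (~-pow i ρ~)) (iq~ e)) (~-pow i E~)

-- Vanishing of the differences modulo each factor

module Differences (R : CommutativeRing 0ℓ 0ℓ) (dom : IsDomain R) (q x : CommutativeRing.Carrier R)
  (regK : Side.Regularity R q x (CommutativeRing.0# R))
  (poleK : ∀ k → Divisibility.Reg R (CommutativeRing.0# R) (Side.Elements.δ R q x (CommutativeRing.0# R) regK k)) where
  private module R where
    open CommutativeRing R public
    open Divisibility R public
    open Kit R public
    open Solver R using (ι) public
  open FractionField R dom
  private
    module SK = Side R q x R.0#
    module EK = SK.Elements regK
  module PK = Poles R q x R.0# regK poleK
  module CK = Convolution K.fractionRing PK.α

  Δs Δt Δu : ℕ → ℕ → ℕ → K.Fraction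
  Δs n m e = SK.sum n CK.s SK.- PK.rhs n m e 2
  Δt n m e = SK.sum n CK.t SK.- PK.rhs n m e 3
  Δu n m e = SK.sum n CK.u SK.- PK.rhs n m e 4

  record Vanishes (g : R.Carrier) (y : K.Fraction) : Set where
    constructor vanishing
    open Comparison g
    private module L = Localisation R g
    field
      value : L.Fraction
      represents : y ~ value
      value≃0 : value L.≃ L.emb R.0#

  AllVanish : R.Carrier → ℕ → ℕ → ℕ → ℕ → ℕ → Set
  AllVanish g n m e₂ e₃ e₄ = Vanishes g (Δs n m e₂) × Vanishes g (Δt n m e₃) × Vanishes g (Δu n m e₄)

  module LinearCase (g : R.Carrier) (regL : Side.Regularity R q x g)
    (poleL : ∀ k → R.Reg g (Side.Elements.δ R q x g regL k))
    (reg-1-q^ : ∀ j → R.Reg g (R.1# R.- R.pow q (suc j)))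
    (M : ℕ) (relation : g R.∣ (x R.- R.pow q (8 ℕ.* M ℕ.+ 2)) ⊎ g R.∣ (R.1# R.- x R.* R.pow q (8 ℕ.* M ℕ.+ 2)))
    where
    private
      module SL = Side R q x g
      module EL = SL.Elements regL
      module PL = Poles R q x g regL poleL
      module Loc = Localisation R g
      open Compare R dom q x g regK regL
      open CommutativeRing Loc.fractionRing using (_≈_; _*_; 0#; 1#; sym; trans; +-congʳ; *-congˡ; *-comm)
      open import Algebra.Properties.Ring (CommutativeRing.ring Loc.fractionRing) using (x∙y⁻¹≈ε⇒x≈y)

      x≈ : SL.x̂ ≈ SL.a * SL.pow SL.p M ⊎ EL.x̄ ≈ SL.a * SL.pow SL.p M
      x≈ = convert relation
        where
        convert : g R.∣ (x R.- R.pow q (8 ℕ.* M ℕ.+ 2)) ⊎ g R.∣ (R.1# R.- x R.* R.pow q (8 ℕ.* M ℕ.+ 2)) →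
          SL.x̂ ≈ SL.a * SL.pow SL.p M ⊎ EL.x̄ ≈ SL.a * SL.pow SL.p M
        convert (inj₁ h) = inj₁ (trans
          (x∙y⁻¹≈ε⇒x≈y _ _ (trans (sym (SL.emb-x-pow (8 ℕ.* M ℕ.+ 2))) (Loc.emb-0 h))) (SL.pow-8k+2 M))
        convert (inj₂ h) = inj₂ (trans (SL.cancelˡ EL.unit-x̂ (trans EL.x̂x̄≈1
          (x∙y⁻¹≈ε⇒x≈y _ _ (trans (sym (SL.emb-1-x*pow (8 ℕ.* M ℕ.+ 2))) (Loc.emb-0 h))))) (SL.pow-8k+2 M))

      module Lin = PL.Linear reg-1-q^ M x≈

      α~ : ∀ k → PK.α k ~ PL.α k
      α~ k = ~-* (prefactor~ k) (~-* (topProduct~ k) (~-recip (bottomProduct~ k) _ _))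

      ratio~ : PK.ratio M ~ PL.ratio M
      ratio~ = ~-* (~-poch M (~-pow 4 q~) p~) (~-recip (~-poch M p~ p~) _ _)

    linear : ∀ {n e₂ e₃ e₄} → n ≡ suc (4 ℕ.* M) → e₂ ≡ 2 ℕ.* M ℕ.* 2 → e₃ ≡ 2 ℕ.* M ℕ.* 3 → e₄ ≡ 2 ℕ.* M ℕ.* 4 →
      AllVanish g n M e₂ e₃ e₄
    linear ≡.refl ≡.refl ≡.refl ≡.refl =
      (vanishing _ (~-- (~-sum (suc (4 ℕ.* M)) (s~ α~)) (rhs~ (suc (4 ℕ.* M)) (2 ℕ.* M ℕ.* 2) 2 ratio~)) Lin.s-linear) ,
      (vanishing _ (~-- (~-sum (suc (4 ℕ.* M)) (t~ α~)) (rhs~ (suc (4 ℕ.* M)) (2 ℕ.* M ℕ.* 3) 3 ratio~)) Lin.t-linear) ,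
      (vanishing _ (~-- (~-sum (suc (4 ℕ.* M)) (u~ α~)) (rhs~ (suc (4 ℕ.* M)) (2 ℕ.* M ℕ.* 4) 4 ratio~)) Lin.u-linear)

  module CyclicCase (g : R.Carrier) (regL : Side.Regularity R q x g)
    (m : ℕ) (1≤m : 1 ℕ.≤ m)
    (g∣1-q^2d : g R.∣ (R.1# R.- R.pow q (2 ℕ.* suc (4 ℕ.* m))))
    (reg-1-q^2j : ∀ j → ¬ suc (4 ℕ.* m) ∣ℕ j → R.Reg g (R.1# R.- R.pow q (2 ℕ.* j)))
    (reg-ι : ∀ s → R.Reg g (R.ι (suc s)))
    (reg-1-xq^ : ∀ j → R.Reg g (R.1# R.- x R.* R.pow q j))
    (reg-x-q^ : ∀ j → R.Reg g (x R.- R.pow q j))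
    (1-q^≉0 : ∀ j → 0 ℕ.< j → ¬ (R.1# R.- R.pow q j) R.≈ R.0#)
    where
    private
      d : ℕ
      d = suc (4 ℕ.* m)

      module SL = Side R q x g
      module EL = SL.Elements regL
      module Loc = Localisation R g
      open Compare R dom q x g regK regL

      u e : R.Carrier
      u = R.pow q (2 ℕ.* d)
      e = R.1# R.- u

      open Geometric R using (geom-sum; geom-mod)

      geom : ℕ → R.Carrier
      geom = Geometric.geom R u

      module RS = Solver R

      -- Modulo `1 - u`, hence modulo `g`, the geometric sum is the positive integer `suc s`.
      reg-geom : ∀ s → R.Reg g (geom (suc s))
      reg-geom s = R.reg-mod (R.∣-trans g∣1-q^2d (geom-mod u (suc s))) (reg-ι s)

      1-q^-multiple : ∀ t j → j ≡ 2 ℕ.* d ℕ.* t → R.1# R.- R.pow q j R.≈ e R.* geom t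
      1-q^-multiple t j ≡.refl = R.trans (R.+-congˡ (R.-‿cong (R.pow-* q (2 ℕ.* d) t))) (R.sym (geom-sum u t))

      e≉0 : ¬ e R.≈ R.0#
      e≉0 = 1-q^≉0 (2 ℕ.* d) (ℕ.s≤s ℕ.z≤n)

      -- `d = 4 m + 1` is prime to 4: explicitly, `d s = m (4 s) + s`.
      d∤⇒d∤4* : ∀ s → ¬ d ∣ℕ s → ¬ d ∣ℕ 4 ℕ.* s
      d∤⇒d∤4* s nd h = nd (ℕᵈ.∣m+n∣m⇒∣n {d} {m ℕ.* (4 ℕ.* s)} {s}
        (≡.subst (d ∣ℕ_) (solve 2 (λ m s → s :* (con 1 :+ con 4 :* m) := m :* (con 4 :* s) :+ s) ≡.refl m s) (ℕᵈ.n∣m*n s))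
        (ℕᵈ.∣n⇒∣m*n m h))
        where open +-*-Solver

      8*≡2*4* : ∀ s → 8 ℕ.* s ≡ 2 ℕ.* (4 ℕ.* s)
      8*≡2*4* s = ℕₚ.*-assoc 2 4 s

      reg-1-q^8s : ∀ k → ¬ suc k % d ≡ 0 → R.Reg g (R.1# R.- R.pow q (8 ℕ.* suc k))
      reg-1-q^8s k nz = R.reg-resp (R.reflexive (≡.cong (λ i → R.1# R.- R.pow q i) (≡.sym (8*≡2*4* (suc k)))))
        (reg-1-q^2j (4 ℕ.* suc k) (d∤⇒d∤4* (suc k) λ h → nz (ℕᵈ.n∣m⇒m%n≡0 (suc k) d h)))

      block-end : ∀ k → suc k % d ≡ 0 → ∃ λ t → R.1# R.- R.pow q (8 ℕ.* suc k) R.≈ e R.* geom (suc t)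
      block-end k z = convert (ℕᵈ.m%n≡0⇒n∣m (suc k) d z)
        where
        open +-*-Solver
        convert : d ∣ℕ suc k → ∃ λ t → R.1# R.- R.pow q (8 ℕ.* suc k) R.≈ e R.* geom (suc t)
        convert (ℕᵈ.divides (suc t) eq) = 3 ℕ.+ 4 ℕ.* t , 1-q^-multiple (4 ℕ.+ 4 ℕ.* t) (8 ℕ.* suc k)
          (≡.trans (≡.cong (8 ℕ.*_) eq) (solve 2 (λ d t → con 8 :* ((con 1 :+ t) :* d) := con 2 :* d :* (con 4 :+ con 4 :* t)) ≡.refl d t))

      decompose : ∀ k {j} → k % d ≡ j → k ≡ j ℕ.+ k / d ℕ.* d
      decompose k eq = ≡.trans (DivMod.m≡m%n+[m/n]*n k d) (≡.cong (ℕ._+ k / d ℕ.* d) eq)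

      -- Because `8 m + 2 = 2 d`, the numerators of `c` acquire the factor `e` at the residue `m`.
      -- For `ratio` the corresponding equation is `8 (2 m) + 4 = 4 d`.
      zero-at-m : ∀ k → k % d ≡ m → ∃ λ t → R.1# R.- R.pow q (8 ℕ.* k ℕ.+ 2) R.≈ e R.* geom t
      zero-at-m k eq = 1 ℕ.+ 4 ℕ.* (k / d) , 1-q^-multiple _ _
        (≡.trans (≡.cong (λ i → 8 ℕ.* i ℕ.+ 2) (decompose k eq))
          (solve 2 (λ m l → con 8 :* (m :+ l :* (con 1 :+ con 4 :* m)) :+ con 2
            := con 2 :* (con 1 :+ con 4 :* m) :* (con 1 :+ con 4 :* l)) ≡.refl m (k / d)))
        where open +-*-Solver

      zero-at-2m : ∀ k → k % d ≡ 2 ℕ.* m → ∃ λ t → R.1# R.- R.pow q (8 ℕ.* k ℕ.+ 4) R.≈ e R.* geom t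
      zero-at-2m k eq = 2 ℕ.+ 4 ℕ.* (k / d) , 1-q^-multiple _ _
        (≡.trans (≡.cong (λ i → 8 ℕ.* i ℕ.+ 4) (decompose k eq))
          (solve 2 (λ m l → con 8 :* (con 2 :* m :+ l :* (con 1 :+ con 4 :* m)) :+ con 4
            := con 2 :* (con 1 :+ con 4 :* m) :* (con 2 :+ con 4 :* l)) ≡.refl m (k / d)))
        where open +-*-Solver

      pull : ∀ {a b c} → a R.≈ e R.* b → a R.* a R.* c R.≈ e R.* e R.* (b R.* b R.* c)
      pull {a} {b} {c} h = R.trans (R.*-congʳ (R.*-cong h h))
        (RS.solve 3 (λ e b c → (e RS.:* b) RS.:* (e RS.:* b) RS.:* c RS.:= e RS.:* e RS.:* (b RS.:* b RS.:* c)) ≡.refl e b c)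

      reg-x-part : ∀ j → R.Reg g ((R.1# R.- x R.* R.pow q j) R.* (x R.- R.pow q j))
      reg-x-part j = R.reg-* (reg-1-xq^ j) (reg-x-q^ j)

      2+2m≤4m : 2 ℕ.+ 2 ℕ.* m ℕ.≤ 4 ℕ.* m
      2+2m≤4m = ℕₚ.≤-trans (ℕₚ.+-monoˡ-≤ (2 ℕ.* m) (ℕₚ.*-monoʳ-≤ 2 1≤m))
        (ℕₚ.≤-reflexive (solve 1 (λ m → con 2 :* m :+ con 2 :* m := con 4 :* m) ≡.refl m))
        where open +-*-Solver

      1+2m<d : suc (2 ℕ.* m) ℕ.< d
      1+2m<d = ℕₚ.m≤n⇒m≤1+n 2+2m≤4m

      1+m<d : suc m ℕ.< d
      1+m<d = ℕₚ.≤-<-trans (ℕ.s≤s (ℕₚ.m≤n*m m 2)) 1+2m<d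

      c~ : ∀ k → ∃ λ ĉ → PK.c k ~ ĉ
      -- The factors free of `x` occur squared in `μ` and in `δ`, so what is gained and lost in a
      -- block is `e²`; for `ratio` it is `e`.
      c~ = Integrality.integral R dom g PK.c EK.δ EK.μ PK.c-step-emb (e R.* e)
        (DomainProperties.*-nonzero R dom e≉0 e≉0) d m 1+m<d
        (λ k → reg-0⇒nonzero (poleK k))
        (λ k eq → _ , pull (proj₂ (zero-at-m k eq)))
        (λ k z → _ , pull (proj₂ (block-end k z)) ,
          R.reg-* (R.reg-* (reg-geom (proj₁ (block-end k z))) (reg-geom (proj₁ (block-end k z)))) (reg-x-part (8 ℕ.* suc k)))
        (λ k nz → R.reg-* (R.reg-* (reg-1-q^8s k nz) (reg-1-q^8s k nz)) (reg-x-part (8 ℕ.* suc k)))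
        (_ , ~-resp (SK.sym PK.c₀) ~-1)

      ratio~ : ∀ k → ∃ λ ρ → PK.ratio k ~ ρ
      ratio~ = Integrality.integral R dom g PK.ratio (λ k → R.1# R.- R.pow q (8 ℕ.* suc k)) (λ k → R.1# R.- R.pow q (8 ℕ.* k ℕ.+ 4))
        PK.ratio-step e e≉0 d (2 ℕ.* m) 1+2m<d
        (λ k → 1-q^≉0 (8 ℕ.* suc k) (ℕ.s≤s ℕ.z≤n))
        (λ k eq → _ , proj₂ (zero-at-2m k eq))
        (λ k z → _ , proj₂ (block-end k z) , reg-geom (proj₁ (block-end k z)))
        reg-1-q^8s
        (_ , ~-resp (SK.sym (PK.ratio₀)) ~-1)

      ĉ : ℕ → Loc.Fraction
      ĉ k = proj₁ (c~ k)

      α̂ : ℕ → Loc.Fraction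
      α̂ k = EL.prefactor k Loc.⊗ ĉ k

      α~ : ∀ k → PK.α k ~ α̂ k
      α~ k = ~-* (prefactor~ k) (proj₂ (c~ k))

      open CommutativeRing Loc.fractionRing using (_≈_; _*_; _+_; -_; _-_; 0#; 1#; sym; trans; refl; reflexive; +-cong; +-congʳ; +-congˡ; *-cong; *-congˡ; *-congʳ; *-comm; *-assoc; *-identityˡ; *-identityʳ; zeroˡ; zeroʳ; -‿cong; -‿inverseʳ)
      open import Algebra.Properties.Ring (CommutativeRing.ring Loc.fractionRing) using (x∙y⁻¹≈ε⇒x≈y; -0#≈0#)

      ĉ₀ : ĉ 0 ≈ 1#
      ĉ₀ = ~-unique (proj₂ (c~ 0)) (~-resp (SK.sym PK.c₀) ~-1)

      -- `ĉ k` is merely some representative; uniqueness of representatives carries the recurrence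
      -- over from the field of fractions, also where `bottom k` vanishes modulo `g`.
      ĉ-step : ∀ k → ĉ (suc k) * EL.bottom k ≈ ĉ k * EL.top k
      ĉ-step k = ~-unique (~-resp (PK.c-step k) (~-* (proj₂ (c~ (suc k))) (bottom~ k)))
        (~-* (proj₂ (c~ k)) (top~ k))

      q̂^2d≈1 : SL.pow SL.q̂ (2 ℕ.* d) ≈ 1#
      q̂^2d≈1 = sym (x∙y⁻¹≈ε⇒x≈y _ _ (trans (sym (SL.emb-1-pow (2 ℕ.* d))) (Loc.emb-0 g∣1-q^2d)))

      q̂^-multiple : ∀ t j → j ≡ 2 ℕ.* d ℕ.* t → SL.pow SL.q̂ j ≈ 1#
      q̂^-multiple t j ≡.refl = trans (SL.pow-* SL.q̂ (2 ℕ.* d) t) (trans (SL.pow-cong t q̂^2d≈1) (SL.pow-1 t))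

      aPm≈1 : SL.a * SL.pow SL.p m ≈ 1#
      aPm≈1 = trans (sym (SL.pow-8k+2 m)) (q̂^-multiple 1 (8 ℕ.* m ℕ.+ 2)
        (solve 1 (λ m → con 8 :* m :+ con 2 := con 2 :* (con 1 :+ con 4 :* m) :* con 1) ≡.refl m))
        where open +-*-Solver

      Pd≈1 : SL.pow SL.p d ≈ 1#
      Pd≈1 = trans (sym (SL.pow-p d)) (q̂^-multiple 4 (8 ℕ.* d) (solve 1 (λ d → con 8 :* d := con 2 :* d :* con 4) ≡.refl d))
        where open +-*-Solver

      zd≈1 : SL.pow EL.z d ≈ 1#
      zd≈1 = trans (sym (EL.iq-4k d)) (trans (sym (*-identityˡ _)) (trans (*-congʳ (sym
          (q̂^-multiple 2 (4 ℕ.* d) (solve 1 (λ d → con 4 :* d := con 2 :* d :* con 2) ≡.refl d))))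
          (EL.iq-inverse (4 ℕ.* d))))
        where open +-*-Solver

      two : SL.Unit (1# + 1#)
      two = SL.unit-resp (Loc.emb-+ R.1# R.1#)
        (Loc.unit-emb (R.reg-resp (R.+-congˡ (R.+-identityʳ R.1#)) (reg-ι 1)))

      d∤small : ∀ k → suc k ℕ.< d → ¬ suc k % d ≡ 0
      d∤small k lt z = ℕₚ.0≢1+n (≡.trans (≡.sym z) (DivMod.m<n⇒m%n≡m lt))

      unit-bottom : ∀ k → suc k ℕ.< d → SL.Unit (EL.bottom k)
      unit-bottom k lt = EL.unit-bottom k (R.reg-* (R.reg-* (reg-1-q^8s k (d∤small k lt)) (reg-1-q^8s k (d∤small k lt))) (reg-x-part (8 ℕ.* suc k)))

      module Root = RootOfUnitySum Loc.fractionRing SL.p SL.q̂ SL.x̂ EL.x̄ EL.z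

      term : ℕ → Loc.Fraction
      term = Root.term EL.x̂x̄≈1 EL.za²≈1 d m 1+m<d aPm≈1 Pd≈1 zd≈1 two (SL.unit-pow 8 EL.unit-q̂) ĉ ĉ₀ ĉ-step unit-bottom

      term-vanishes : ∀ j → m ℕ.< j % d → term j ≈ 0#
      term-vanishes = Root.term-vanishes EL.x̂x̄≈1 EL.za²≈1 d m 1+m<d aPm≈1 Pd≈1 zd≈1 two (SL.unit-pow 8 EL.unit-q̂) ĉ ĉ₀ ĉ-step unit-bottom

      sum-vanishes : ∀ N → N % d ≡ 0 ⊎ m ℕ.< N % d → SL.sum N term ≈ 0#
      sum-vanishes = Root.sum-vanishes EL.x̂x̄≈1 EL.za²≈1 d m 1+m<d aPm≈1 Pd≈1 zd≈1 two (SL.unit-pow 8 EL.unit-q̂) ĉ ĉ₀ ĉ-step unit-bottom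

      α̂≈ : ∀ k → α̂ k ≈ EL.ν * term k
      α̂≈ k = trans (*-congʳ (EL.prefactor≈ k)) (trans (*-assoc _ _ _) (*-congˡ (*-assoc _ _ _)))

      α̂-vanishes : ∀ j → m ℕ.< j % d → α̂ j ≈ 0#
      α̂-vanishes j lt = trans (α̂≈ j) (trans (*-congˡ (term-vanishes j lt)) (zeroʳ EL.ν))

      sum-α̂ : ∀ N → N % d ≡ 0 ⊎ m ℕ.< N % d → SL.sum N α̂ ≈ 0#
      sum-α̂ N o = trans (SL.sum-cong N λ k _ → α̂≈ k) (trans (SL.sum-*ˡ N EL.ν term)
        (trans (*-congˡ (sum-vanishes N o)) (zeroʳ EL.ν)))

      module Conv = Convolution Loc.fractionRing α̂
      module Per = Conv.Periodic d m α̂-vanishes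

      4m<d : m ℕ.+ (m ℕ.+ (m ℕ.+ m)) ℕ.< d
      4m<d = ℕ.s≤s (ℕₚ.≤-reflexive (≡.cong (λ j → m ℕ.+ (m ℕ.+ (m ℕ.+ j))) (≡.sym (ℕₚ.+-identityʳ m))))

    module _ (n k : ℕ) (d∣n : suc (4 ℕ.* m) ∣ℕ n) where
      private
        n%d : n % d ≡ 0
        n%d = ℕᵈ.n∣m⇒m%n≡0 n d d∣n

        qint2≈0 : EL.qint2 n ≈ 0#
        qint2≈0 = trans (*-congʳ (trans (+-congˡ (-‿cong (q̂^-multiple (ℕᵈ.quotient d∣n) (2 ℕ.* n) eq))) (-‿inverseʳ 1#))) (zeroˡ EL.i₂)
          where
          open +-*-Solver
          eq : 2 ℕ.* n ≡ 2 ℕ.* d ℕ.* ℕᵈ.quotient d∣n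
          eq = ≡.trans (≡.cong (2 ℕ.*_) (ℕᵈ.m∣n⇒n≡quotient*m d∣n))
            (solve 2 (λ t d → con 2 :* (t :* d) := con 2 :* d :* t) ≡.refl (ℕᵈ.quotient d∣n) d)

        ρ : Loc.Fraction
        ρ = proj₁ (ratio~ k)

        rhs≈0 : ∀ e i → SL.pow (EL.qint2 n) (suc i) * SL.pow ρ (suc i) * EL.iq e * SL.pow EL.E (suc i) ≈ 0#
        rhs≈0 e i = trans (*-congʳ (*-congʳ (*-congʳ (trans (*-congʳ qint2≈0) (zeroˡ _)))))
          (trans (*-congʳ (trans (*-congʳ (zeroˡ _)) (zeroˡ _))) (zeroˡ _))

        difference : ∀ {a b} → a ≈ 0# → b ≈ 0# → a - b ≈ 0#
        difference h h′ = trans (+-cong h (trans (-‿cong h′) -0#≈0#)) (CommutativeRing.+-identityʳ Loc.fractionRing 0#)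

      cyclic : ∀ e₂ e₃ e₄ → AllVanish g n k e₂ e₃ e₄
      cyclic e₂ e₃ e₄ =
        (vanishing _ (~-- (~-sum n (s~ α~)) (rhs~ n e₂ 2 (proj₂ (ratio~ k))))
          (difference (Per.s-vanishes 4m<d sum-α̂ n (inj₁ n%d)) (rhs≈0 e₂ 1))) ,
        (vanishing _ (~-- (~-sum n (t~ α~)) (rhs~ n e₃ 3 (proj₂ (ratio~ k))))
          (difference (Per.t-vanishes 4m<d sum-α̂ n (inj₁ n%d)) (rhs≈0 e₃ 2))) ,
        (vanishing _ (~-- (~-sum n (u~ α~)) (rhs~ n e₄ 4 (proj₂ (ratio~ k))))
          (difference (Per.u-vanishes 4m<d sum-α̂ n (inj₁ n%d)) (rhs≈0 e₄ 3)))

-- Cyclotomic factors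

-- The factors Φ d of 1 - v^n, built without irreducibility: Φ d is what remains of 1 - v^d after
-- dividing by Φ j for all proper divisors j, and 1 - v^j is regular modulo Φ d unless d ∣ j.
module Cyclotomic (R : CommutativeRing 0ℓ 0ℓ) (dom : IsDomain R) (v : CommutativeRing.Carrier R)
  (1-v^≉0 : ∀ j → ¬ CommutativeRing._≈_ R (CommutativeRing._-_ R (CommutativeRing.1# R) (Kit.pow R v (suc j))) (CommutativeRing.0# R))
  (reg-ι : ∀ j {g} → Divisibility._∣_ R g (CommutativeRing._-_ R (CommutativeRing.1# R) (Kit.pow R v (suc j))) →
    ∀ s → Divisibility.Reg R g (Solver.ι R (suc s)))
  where
  open CommutativeRing R
  open Solver R
  open Kit R
  open Products R
  open Divisibility R
  open DomainProperties R dom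
  open Geometric R

  F : ℕ → Carrier
  F j = 1# - pow v j

  F-multiple : ∀ {j n} → j ∣ℕ n → F j ∣ F n
  F-multiple {j} (ℕᵈ.divides k ≡.refl) = ∣-resp
    (+-congˡ (-‿cong (sym (trans (reflexive (≡.cong (pow v) (ℕₚ.*-comm k j))) (pow-* v j k)))))
    (1-u∣1-pow (pow v j) k)

  factor : (ℕ → Carrier) → ℕ → ℕ → Carrier
  factor Φ n j with j ∣ℕ? n
  ... | yes _ = Φ j
  ... | no _ = 1#

  factor-cases : ∀ Φ n j → (j ∣ℕ n × factor Φ n j ≡ Φ j) ⊎ (¬ j ∣ℕ n × factor Φ n j ≡ 1#)
  factor-cases Φ n j with j ∣ℕ? n
  ... | yes h = inj₁ (h , ≡.refl)
  ... | no h = inj₂ (h , ≡.refl)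

  divisorProduct : (ℕ → Carrier) → ℕ → ℕ → Carrier
  divisorProduct Φ n K = prod K (λ i → factor Φ n (suc i))

  record Factors (N : ℕ) (Φ : ℕ → Carrier) : Set where
    field
      Φ∣F : ∀ d → 0 ℕ.< d → d ℕ.≤ N → Φ d ∣ F d
      Φ-regular : ∀ d → 0 ℕ.< d → d ℕ.≤ N → ∀ j → ¬ d ∣ℕ j → Reg (Φ d) (F j)
      Φ-product : ∀ d → 0 ℕ.< d → d ℕ.≤ N → divisorProduct Φ d d ≈ F d

  module _ {N Φ} (factors : Factors N Φ) where
    open Factors factors

    factor-regular : ∀ n k i → 0 ℕ.< k → k ℕ.≤ N → suc i ℕ.< k → Reg (Φ k) (factor Φ n (suc i))
    factor-regular n k i k>0 k≤N i<k with factor-cases Φ n (suc i)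
    ... | inj₁ (_ , e) = reg-resp (reflexive (≡.sym e)) (reg-∣ (Φ∣F (suc i) (ℕ.s≤s ℕ.z≤n) (ℕₚ.≤-trans (ℕₚ.<⇒≤ i<k) k≤N))
            (Φ-regular k k>0 k≤N (suc i) λ h → ℕₚ.<⇒≱ i<k (ℕᵈ.∣⇒≤ h)))
    ... | inj₂ (_ , e) = reg-resp (reflexive (≡.sym e)) reg-1

    prod-regular : ∀ K {g f} → (∀ i → i ℕ.< K → Reg g (f i)) → Reg g (prod K f)
    prod-regular zero r = reg-1
    prod-regular (suc K) r = reg-* (prod-regular K λ i l → r i (ℕₚ.m<n⇒m<1+n l)) (r K ℕₚ.≤-refl)

    -- The factors are pairwise regular modulo one another, so common multiples are multiples of the product.
    product-divides : ∀ n (σ : ℕ → ℕ) → (∀ {i j} → i ℕ.< j → σ i ℕ.< σ j) → ∀ {t} K →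
      (∀ i → i ℕ.< K → suc (σ i) ℕ.≤ N × (suc (σ i) ∣ℕ n → Φ (suc (σ i)) ∣ t)) →
      prod K (λ i → factor Φ n (suc (σ i))) ∣ t
    product-divides n σ mono zero h = 1∣
    product-divides n σ mono {t} (suc K) h
      with product-divides n σ mono K (λ i l → h i (ℕₚ.m<n⇒m<1+n l)) | factor-cases Φ n (suc (σ K))
    ... | div w e | inj₂ (_ , eq) = div w (trans (*-congˡ (trans (*-congˡ (reflexive eq)) (*-identityʳ _))) e)
    ... | div w e | inj₁ (d , eq) = ∣-resp e (∣-respˡ (trans (*-congʳ (reflexive (≡.sym eq))) (*-comm _ _))
      (∣-*-mono (prod-regular K (λ i l → factor-regular n (suc (σ K)) (σ i) (ℕ.s≤s ℕ.z≤n) (proj₁ (h K ℕₚ.≤-refl)) (ℕ.s≤s (mono l)))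
        w (∣-resp (trans (sym e) (*-comm _ _)) (proj₂ (h K ℕₚ.≤-refl) d))) ∣-refl))

    -- As `F (i + k) - v^i F k = F i`, the exponents `j` for which `g` divides `F j * t` are closed
    -- under multiples and differences.
    bezout : ∀ {g t} j d → g ∣ F d * t → g ∣ F j * t → g ∣ F (GCD.gcd j d) * t
    bezout {g} {t} j d hd hj = combine (GCD.Bézout.identity (GCD.gcd-GCD j d))
      where
      lift : ∀ {j} k → g ∣ F j * t → g ∣ F (k ℕ.* j) * t
      lift {j} k h = ∣-trans h (∣-*-mono (F-multiple {j} {k ℕ.* j} (ℕᵈ.divides k ≡.refl)) ∣-refl)
      subtract : ∀ i k l → i ℕ.+ k ≡ l → g ∣ F k * t → g ∣ F l * t → g ∣ F i * t
      subtract i k l ≡.refl hk hl = ∣-resp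
        (trans (+-congʳ (*-congʳ (+-congˡ (-‿cong (pow-+ v i k)))))
          (solve 3 (λ I K t → (:1 :- I :* K) :* t :- I :* ((:1 :- K) :* t) := (:1 :- I) :* t) ≡.refl (pow v i) (pow v k) t))
        (∣-- hl (∣-*ˡ (pow v i) hk))
      combine : GCD.Bézout.Identity (GCD.gcd j d) j d → g ∣ F (GCD.gcd j d) * t
      combine (GCD.Bézout.+- a b eq) = subtract _ (b ℕ.* d) (a ℕ.* j) eq (lift b hd) (lift a hj)
      combine (GCD.Bézout.-+ a b eq) = subtract _ (a ℕ.* j) (b ℕ.* d) eq (lift a hj) (lift b hd)

    prod-∣ : ∀ K {f h} → (∀ i → i ℕ.< K → f i ∣ h i) → prod K f ∣ prod K h
    prod-∣ zero d = ∣-refl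
    prod-∣ (suc K) d = ∣-*-mono (prod-∣ K λ i l → d i (ℕₚ.m<n⇒m<1+n l)) (d K ℕₚ.≤-refl)

    prod-prefix : ∀ {f} K L → K ℕ.≤ L → prod K f ∣ prod L f
    prod-prefix K L le with ℕₚ.≤⇒≤′ le
    ... | ℕ.≤′-reflexive ≡.refl = ∣-refl
    ... | ℕ.≤′-step {n} l = ∣-*ʳ _ (prod-prefix K n (ℕₚ.≤′⇒≤ l))

    -- `Φ 1` is `1 - v`; cancelling it in the factorisation of `1 - v^(m+1)` leaves the divisors
    -- greater than 1.
    geom≈product : ∀ m → suc m ℕ.≤ N → prod m (λ i → factor Φ (suc m) (suc (suc i))) ≈ geom v (suc m)
    geom≈product m le = *-cancelˡ (F 1) (1-v^≉0 0)
      (trans (*-congʳ (sym (trans (factor-1 (suc m)) Φ1≈)))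
      (trans (sym (prod-head m (λ i → factor Φ (suc m) (suc i))))
      (trans (Φ-product (suc m) (ℕ.s≤s ℕ.z≤n) le)
      (trans (sym (geom-sum v (suc m))) (*-congʳ (sym F1≈))))))
      where
      F1≈ : F 1 ≈ 1# - v
      F1≈ = +-congˡ (-‿cong (*-identityʳ v))
      factor-1 : ∀ k → factor Φ k 1 ≈ Φ 1
      factor-1 k with factor-cases Φ k 1
      ... | inj₁ (_ , e) = reflexive e
      ... | inj₂ (nd , _) = ⊥-elim (nd (ℕᵈ.1∣ k))
      Φ1≈ : Φ 1 ≈ F 1
      Φ1≈ = trans (sym (trans (*-identityˡ _) (factor-1 1)))
        (Φ-product 1 (ℕ.s≤s ℕ.z≤n) (ℕₚ.≤-trans (ℕ.s≤s ℕ.z≤n) le))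

    geom-divides : ∀ {n m t} → n ≡ suc m → n ℕ.≤ N → (∀ d → 1 ℕ.< d → d ∣ℕ n → Φ d ∣ t) → geom v n ∣ t
    geom-divides {m = m} ≡.refl le h = ∣-respˡ (geom≈product m le) (product-divides (suc m) suc ℕ.s≤s m λ i i<m →
      ℕₚ.≤-trans (ℕ.s≤s i<m) le , h (suc (suc i)) (ℕ.s≤s (ℕ.s≤s ℕ.z≤n)))

    private
      d : ℕ
      d = suc N

      proper : Carrier
      proper = divisorProduct Φ d N

      proper∣ : proper ∣ F d
      proper∣ = product-divides d (λ i → i) (λ l → l) N λ i i<N →
        i<N , λ h → ∣-trans (Φ∣F (suc i) (ℕ.s≤s ℕ.z≤n) i<N) (F-multiple h)

      ϕ : Carrier
      ϕ = _∣_.quot proper∣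

      ϕ-eq : ϕ * proper ≈ F d
      ϕ-eq = _∣_.eq proper∣

      ϕ∣F : ϕ ∣ F d
      ϕ∣F = div proper (trans (*-comm _ _) ϕ-eq)

      F∣proper : ∀ e → e ∣ℕ d → 0 ℕ.< e → e ℕ.≤ N → F e ∣ proper
      F∣proper e e∣d e>0 e≤N = ∣-respˡ (Φ-product e e>0 e≤N) (∣-trans (prod-prefix e N e≤N) (prod-∣ N λ i _ → termwise i))
        where
        termwise : ∀ i → factor Φ e (suc i) ∣ factor Φ d (suc i)
        termwise i with factor-cases Φ e (suc i) | factor-cases Φ d (suc i)
        ... | inj₂ (_ , eq) | _ = ∣-respˡ (reflexive (≡.sym eq)) 1∣
        ... | inj₁ (_ , eq) | inj₁ (_ , eq′) = ∣-resp (reflexive (≡.trans eq (≡.sym eq′))) ∣-refl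
        ... | inj₁ (h , _) | inj₂ (nh , _) = ⊥-elim (nh (ℕᵈ.∣-trans h e∣d))

      -- Write `d = e (s + 1)` and `F d = F e * G`. Then `ϕ` divides `G`, because `F e` divides
      -- `proper`, and `G` is congruent to `s + 1` modulo `F e`. So if `ϕ` divides `F e * t`, it
      -- divides `(s + 1) t`, and positive integers are regular modulo `ϕ`.
      cofactor-regular : ∀ e → e ∣ℕ d → 0 ℕ.< e → e ℕ.≤ N → Reg ϕ (F e)
      cofactor-regular e@(suc e′) e∣d@(ℕᵈ.divides (suc s) eq) e>0 e≤N t h =
        reg-ι N ϕ∣F s t (∣-resp
          (solve 3 (λ G i t → G :* t :- (G :- i) :* t := i :* t) ≡.refl G (ι (suc s)) t)
          (∣-- (∣-*ʳ t ϕ∣G) (shift (geom-mod (pow v e) (suc s)))))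
        where
        G : Carrier
        G = geom (pow v e) (suc s)
        Fd≈ : F e * G ≈ F d
        Fd≈ = trans (geom-sum (pow v e) (suc s)) (+-congˡ (-‿cong (trans (sym (pow-* v e (suc s)))
          (reflexive (≡.cong (pow v) (≡.trans (ℕₚ.*-comm e (suc s)) (≡.sym eq)))))))
        cancel : F e ∣ proper → ϕ ∣ G
        cancel (div r re) = div r (*-cancelˡ (F e) (1-v^≉0 e′)
          (trans (solve 3 (λ E r p → E :* (r :* p) := p :* (r :* E)) ≡.refl (F e) r ϕ)
            (trans (*-congˡ re) (trans ϕ-eq (sym Fd≈)))))
        ϕ∣G : ϕ ∣ G
        ϕ∣G = cancel (F∣proper e e∣d e>0 e≤N)
        shift : F e ∣ G - ι (suc s) → ϕ ∣ (G - ι (suc s)) * t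
        shift (div r re) = ∣-resp (trans (sym (*-assoc _ _ _)) (*-congʳ re)) (∣-*ˡ r h)

      -- `bezout` replaces `j` by `gcd j d`, a proper divisor of `d`.
      ϕ-regular : ∀ j → ¬ d ∣ℕ j → Reg ϕ (F j)
      ϕ-regular j nd t h = cofactor-regular (GCD.gcd j d) (GCD.gcd[m,n]∣n j d)
          (ℕₚ.n≢0⇒n>0 λ z → ℕₚ.0≢1+n (≡.sym (GCD.gcd[m,n]≡0⇒n≡0 j {d} z))) g≤N t
          (bezout j d (∣-*ʳ t ϕ∣F) h)
        where
        g≢d : ¬ GCD.gcd j d ≡ d
        g≢d e = nd (≡.subst (_∣ℕ j) e (GCD.gcd[m,n]∣m j d))
        g≤N : GCD.gcd j d ℕ.≤ N
        g≤N = ℕ.s≤s⁻¹ (ℕₚ.≤∧≢⇒< (ℕᵈ.∣⇒≤ (GCD.gcd[m,n]∣n j d)) g≢d)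

      Ψ : ℕ → Carrier
      Ψ j with j ℕ.≟ d
      ... | yes _ = ϕ
      ... | no _ = Φ j

      Ψ-old : ∀ j → j ℕ.≤ N → Ψ j ≡ Φ j
      Ψ-old j le with j ℕ.≟ d
      ... | yes e = ⊥-elim (ℕₚ.<⇒≢ (ℕ.s≤s le) e)
      ... | no _ = ≡.refl

      Ψ-new : Ψ d ≡ ϕ
      Ψ-new with d ℕ.≟ d
      ... | yes _ = ≡.refl
      ... | no n = ⊥-elim (n ≡.refl)

      factor-old : ∀ n j → j ℕ.≤ N → factor Ψ n j ≡ factor Φ n j
      factor-old n j le with j ∣ℕ? n
      ... | yes _ = Ψ-old j le
      ... | no _ = ≡.refl

      product-old : ∀ n K → K ℕ.≤ N → divisorProduct Ψ n K ≈ divisorProduct Φ n K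
      product-old n K le = prod-cong K λ i l → reflexive (factor-old n (suc i) (ℕₚ.≤-trans l le))

      split : ∀ {e} → e ℕ.≤ d → e ℕ.≤ N ⊎ e ≡ d
      split le = [ (λ l → inj₁ (ℕ.s≤s⁻¹ l)) , inj₂ ]′ (ℕₚ.m≤n⇒m<n∨m≡n le)

      factor-self : factor Ψ d d ≡ ϕ
      factor-self with factor-cases Ψ d d
      ... | inj₁ (_ , e) = ≡.trans e Ψ-new
      ... | inj₂ (n , _) = ⊥-elim (n ℕᵈ.∣-refl)

    extend : Σ (ℕ → Carrier) (Factors d)
    extend = Ψ , record
      { Φ∣F = λ e e>0 le → old-or-new e le (λ z → z ∣ F e) (λ l → Φ∣F e e>0 l) (λ { ≡.refl → ϕ∣F })
      ; Φ-regular = λ e e>0 le j nd → old-or-new e le (λ z → Reg z (F j)) (λ l → Φ-regular e e>0 l j nd)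
          (λ { ≡.refl → ϕ-regular j nd })
      ; Φ-product = product }
      where
      old-or-new : ∀ e → e ℕ.≤ d → (T : Carrier → Set) → (e ℕ.≤ N → T (Φ e)) → (e ≡ d → T ϕ) → T (Ψ e)
      old-or-new e le T old new with split le
      ... | inj₁ l = ≡.subst T (≡.sym (Ψ-old e l)) (old l)
      ... | inj₂ ≡.refl = ≡.subst T (≡.sym Ψ-new) (new ≡.refl)
      product : ∀ e → 0 ℕ.< e → e ℕ.≤ d → divisorProduct Ψ e e ≈ F e
      product e e>0 le with split le
      ... | inj₁ l = trans (product-old e e l) (Φ-product e e>0 l)
      ... | inj₂ ≡.refl = trans (*-cong (product-old d N ℕₚ.≤-refl) (reflexive factor-self)) (trans (*-comm _ _) ϕ-eq)

  cyclotomicFactors : ∀ N → Σ (ℕ → Carrier) (Factors N)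
  cyclotomicFactors zero = (λ _ → 1#) , record
    { Φ∣F = λ d d>0 le → ⊥-elim (ℕₚ.<⇒≱ d>0 le)
    ; Φ-regular = λ d d>0 le → ⊥-elim (ℕₚ.<⇒≱ d>0 le)
    ; Φ-product = λ d d>0 le → ⊥-elim (ℕₚ.<⇒≱ d>0 le) }
  cyclotomicFactors (suc N) = extend (proj₂ (cyclotomicFactors N))

-- The poles of the summand in `x` sit at powers of `q⁸` and their inverses, whereas
-- `2 n = 8 M + 2`. So these poles never meet the linear factors of the modulus.
8*≢8*+2 : ∀ k M → ¬ 8 ℕ.* k ≡ 8 ℕ.* M ℕ.+ 2
8*≢8*+2 k M e = ℕₚ.0≢1+n (≡.trans (≡.sym (DivMod.m*n%n≡0 k 8)) (≡.trans (≡.cong (_% 8)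
  (≡.trans (ℕₚ.*-comm k 8) (≡.trans e (≡.trans (ℕₚ.+-comm (8 ℕ.* M) 2) (≡.cong (2 ℕ.+_) (ℕₚ.*-comm 8 M)))))) (DivMod.[m+kn]%n≡m%n 2 M 8)))

-- Regularity modulo the linear factors and assembly of the modulus

module Regularities (R : CommutativeRing 0ℓ 0ℓ) (dom : IsDomain R) (q x : CommutativeRing.Carrier R) where
  open CommutativeRing R
  open Divisibility R
  open DomainProperties R dom
  open Kit R
  open Solver R
  private module FF = FractionField R dom

  regularity : ∀ {g} → Reg g q → Reg g x → Reg g (1# - pow q 2) → Reg g (1# - pow q 4) → Side.Regularity R q x g
  regularity rq rx r₂ r₄ = record
    { reg-q = rq
    ; reg-x = rx
    ; reg-1-q = reg-∣ (div (1# + q) (solve 1 (λ q → (:1 :+ q) :* (:1 :- q :* :1) := :1 :- q :* (q :* :1)) ≡.refl q)) r₂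
    ; reg-1-q² = r₂
    ; reg-1+q² = reg-∣ (div (1# - pow q 2) (solve 1 (λ q → (:1 :- q :* (q :* :1)) :* (:1 :+ q :* (q :* :1))
        := :1 :- q :* (q :* (q :* (q :* :1)))) ≡.refl q)) r₄ }

  reg-q^ : ∀ {g} → Reg g q → ∀ n → Reg g (pow q n)
  reg-q^ rq zero = reg-1
  reg-q^ rq (suc n) = reg-* rq (reg-q^ rq n)

  reg-q^-q^ : ∀ {g} → Reg g q → (∀ j → Reg g (1# - pow q (suc j))) → ∀ i j → ¬ i ≡ j → Reg g (pow q i - pow q j)
  reg-q^-q^ {g} rq r i j i≢j = cases (ℕₚ.<-cmp i j)
    where
    open import Relation.Binary.Definitions using (Tri; tri<; tri≈; tri>)
    ordered : ∀ i k → Reg g (pow q i - pow q (suc i ℕ.+ k))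
    ordered i k = reg-resp (sym (trans (+-congˡ (-‿cong (trans (reflexive (≡.cong (pow q) (≡.sym (ℕₚ.+-suc i k)))) (pow-+ q i (suc k)))))
        (solve 2 (λ I K → I :- I :* K := I :* (:1 :- K)) ≡.refl (pow q i) (pow q (suc k)))))
      (reg-* (reg-q^ rq i) (r k))
    below : ∀ {i j} → i ℕ.< j → Reg g (pow q i - pow q j)
    below {i} {j} lt = ≡.subst (λ l → Reg g (pow q i - pow q l)) (ℕₚ.m+[n∸m]≡n lt) (ordered i (j ℕ.∸ suc i))
    cases : Tri (i ℕ.< j) (i ≡ j) (j ℕ.< i) → Reg g (pow q i - pow q j)
    cases (tri< lt _ _) = below lt
    cases (tri≈ _ e _) = ⊥-elim (i≢j e)
    cases (tri> _ _ gt) = reg-∣ (div (- 1#) (solve 2 (λ a b → (:- :1) :* (a :- b) := b :- a) ≡.refl (pow q i) (pow q j))) (below gt)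

  module _ (q≉0 : ¬ q ≈ 0#) (1-q^≉0 : ∀ j → ¬ 1# - pow q (suc j) ≈ 0#)
    (q-linear₁ : ∀ N → Reg q (x - pow q (suc N))) (1-q^-linear₁ : ∀ j N → Reg (1# - pow q (suc j)) (x - pow q N))
    (q-linear₂ : ∀ N → Reg q (1# - x * pow q (suc N))) (1-q^-linear₂ : ∀ j N → Reg (1# - pow q (suc j)) (1# - x * pow q N))
    (x-q^≉0 : ∀ N → ¬ x - pow q N ≈ 0#) (1-xq^≉0 : ∀ N → ¬ 1# - x * pow q N ≈ 0#) (x≉0 : ¬ x ≈ 0#)
    where

    -- Modulo `f` the indeterminate `x` equals `q^(N+1)`, so all elements in question reduce to `q`
    -- and `1 - q^j`. Their regularity modulo `f` comes by `reg-sym` from that of `f` modulo them.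
    module Linear₁ (N : ℕ) where
      f : Carrier
      f = x - pow q (suc N)

      f-q : Reg f q
      f-q = reg-sym q≉0 (q-linear₁ N)

      f-1-q^ : ∀ j → Reg f (1# - pow q (suc j))
      f-1-q^ j = reg-sym (1-q^≉0 j) (1-q^-linear₁ j (suc N))

      f-x : Reg f x
      f-x = reg-mod ∣-refl (reg-q^ f-q (suc N))

      f-1-xq^ : ∀ J → Reg f (1# - x * pow q J)
      f-1-xq^ J = reg-mod {s′ = 1# - pow q (suc N ℕ.+ J)}
        (∣-resp (trans (solve 3 (λ x K J → (:- J) :* (x :- K) := (:1 :- x :* J) :- (:1 :- K :* J)) ≡.refl x (pow q (suc N)) (pow q J))
            (+-congˡ (-‿cong (+-congˡ (-‿cong (sym (pow-+ q (suc N) J)))))))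
          (∣-*ˡ (- pow q J) ∣-refl)) (f-1-q^ (N ℕ.+ J))

      f-x-q^ : ∀ J → ¬ suc N ≡ J → Reg f (x - pow q J)
      f-x-q^ J ne = reg-mod {s′ = pow q (suc N) - pow q J}
        (∣-resp (solve 3 (λ x K J → x :- K := (x :- J) :- (K :- J)) ≡.refl x (pow q (suc N)) (pow q J)) ∣-refl)
        (reg-q^-q^ f-q f-1-q^ (suc N) J ne)

    -- Modulo `f` the indeterminate `x` is inverse to `q^(N+1)`; elements containing `x` are
    -- multiplied by this power before they are reduced.
    module Linear₂ (N : ℕ) where
      f : Carrier
      f = 1# - x * pow q (suc N)

      f-q : Reg f q
      f-q = reg-sym q≉0 (q-linear₂ N)

      f-1-q^ : ∀ j → Reg f (1# - pow q (suc j))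
      f-1-q^ j = reg-sym (1-q^≉0 j) (1-q^-linear₂ j (suc N))

      f-x : Reg f x
      f-x = reg-∣ {s′ = x * pow q (suc N)} (∣-*ʳ _ ∣-refl)
        (reg-mod (∣-resp (solve 1 (λ y → (:- :1) :* (:1 :- y) := y :- :1) ≡.refl (x * pow q (suc N))) (∣-*ˡ (- 1#) ∣-refl)) reg-1)

      f-x-q^ : ∀ J → Reg f (x - pow q J)
      f-x-q^ J = reg-∣ {s′ = pow q (suc N) * (x - pow q J)} (∣-*ˡ _ ∣-refl)
        (reg-mod {s′ = 1# - pow q (suc N ℕ.+ J)}
          (∣-resp (trans (solve 3 (λ x K J → (:- :1) :* (:1 :- x :* K) := K :* (x :- J) :- (:1 :- K :* J)) ≡.refl x (pow q (suc N)) (pow q J))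
              (+-congˡ (-‿cong (+-congˡ (-‿cong (sym (pow-+ q (suc N) J)))))))
            (∣-*ˡ (- 1#) ∣-refl)) (f-1-q^ (N ℕ.+ J)))

      f-1-xq^ : ∀ J → ¬ suc N ≡ J → Reg f (1# - x * pow q J)
      f-1-xq^ J ne = reg-∣ {s′ = pow q (suc N) * (1# - x * pow q J)} (∣-*ˡ _ ∣-refl)
        (reg-mod {s′ = pow q (suc N) - pow q J}
          (∣-resp (solve 3 (λ x K J → J :* (:1 :- x :* K) := K :* (:1 :- x :* J) :- (K :- J)) ≡.refl x (pow q (suc N)) (pow q J))
            (∣-*ˡ (pow q J) ∣-refl))
          (reg-q^-q^ f-q f-1-q^ (suc N) J ne))

    private
      J : ℕ → ℕ
      J k = ℕ.pred (8 ℕ.* suc k)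

    fieldRegularity : Side.Regularity R q x 0#
    fieldRegularity = regularity (reg-0 q≉0) (reg-0 x≉0) (reg-0 (1-q^≉0 1)) (reg-0 (1-q^≉0 3))

    fieldPoles : ∀ k → Reg 0# (Side.Elements.δ R q x 0# fieldRegularity k)
    fieldPoles k = reg-* (reg-* (reg-0 (1-q^≉0 (J k))) (reg-0 (1-q^≉0 (J k)))) (reg-* (reg-0 (1-xq^≉0 (8 ℕ.* suc k))) (reg-0 (x-q^≉0 (8 ℕ.* suc k))))

    Divides : Carrier → FF.K.Fraction → Set
    Divides P y = ∀ {a b} → FF.K.num y * b ≈ a * FF.K.den y → P ∣ a

    module Numerators
      (regK : Side.Regularity R q x 0#) (poleK : ∀ k → Reg 0# (Side.Elements.δ R q x 0# regK k))
      (n M e₂ e₃ e₄ : ℕ) (n≡ : n ≡ suc (4 ℕ.* M))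
      (e₂≡ : e₂ ≡ 2 ℕ.* M ℕ.* 2) (e₃≡ : e₃ ≡ 2 ℕ.* M ℕ.* 3) (e₄≡ : e₄ ≡ 2 ℕ.* M ℕ.* 4)
      ([n] : Carrier) ([n]-eq : [n] * (1# - pow q 2) ≈ 1# - pow q (2 ℕ.* n))
      (Φ : ℕ → Carrier)
      (combine : ∀ a → (∀ d → 1 ℕ.< d → d ∣ℕ n → Φ d ∣ a) → [n] ∣ a)
      (d≡ : ∀ d → 1 ℕ.< d → d ∣ℕ n → ∃ λ m → 1 ℕ.≤ m × d ≡ suc (4 ℕ.* m))
      (Φ∣ : ∀ d → 1 ℕ.< d → d ∣ℕ n → Φ d ∣ 1# - pow q (2 ℕ.* d))
      (Φ-1-q : ∀ d → 1 ℕ.< d → d ∣ℕ n → ∀ j → ¬ d ∣ℕ j → Reg (Φ d) (1# - pow q (2 ℕ.* j)))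
      (Φ-ι : ∀ d → 1 ℕ.< d → d ∣ℕ n → ∀ s → Reg (Φ d) (ι (suc s)))
      (Φ-q : ∀ d → 1 ℕ.< d → d ∣ℕ n → Reg (Φ d) q)
      (Φ-x : ∀ d → 1 ℕ.< d → d ∣ℕ n → Reg (Φ d) x)
      (Φ-1-xq : ∀ d → 1 ℕ.< d → d ∣ℕ n → ∀ j → Reg (Φ d) (1# - x * pow q j))
      (Φ-x-q : ∀ d → 1 ℕ.< d → d ∣ℕ n → ∀ j → Reg (Φ d) (x - pow q j))
      where

      open Differences R dom q x regK poleK

      private
        N : ℕ
        N = suc (8 ℕ.* M)

        N-eq : 8 ℕ.* M ℕ.+ 2 ≡ suc N
        N-eq = ℕₚ.+-comm (8 ℕ.* M) 2

        module L₁ = Linear₁ N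
        module L₂ = Linear₂ N

        8*suc≢ : ∀ k → ¬ suc N ≡ 8 ℕ.* suc k
        8*suc≢ k e = 8*≢8*+2 (suc k) M (≡.sym (≡.trans N-eq e))

      private
        reg₁ : Side.Regularity R q x L₁.f
        reg₁ = regularity L₁.f-q L₁.f-x (L₁.f-1-q^ 1) (L₁.f-1-q^ 3)

        pole₁ : ∀ k → Reg L₁.f (Side.Elements.δ R q x L₁.f reg₁ k)
        pole₁ k = reg-* (reg-* (L₁.f-1-q^ (J k)) (L₁.f-1-q^ (J k))) (reg-* (L₁.f-1-xq^ (8 ℕ.* suc k)) (L₁.f-x-q^ (8 ℕ.* suc k) (8*suc≢ k)))

        relation₁ : L₁.f ∣ x - pow q (8 ℕ.* M ℕ.+ 2)
        relation₁ = ∣-resp (+-congˡ (-‿cong (reflexive (≡.cong (pow q) (≡.sym N-eq))))) ∣-refl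

        reg₂ : Side.Regularity R q x L₂.f
        reg₂ = regularity L₂.f-q L₂.f-x (L₂.f-1-q^ 1) (L₂.f-1-q^ 3)

        pole₂ : ∀ k → Reg L₂.f (Side.Elements.δ R q x L₂.f reg₂ k)
        pole₂ k = reg-* (reg-* (L₂.f-1-q^ (J k)) (L₂.f-1-q^ (J k))) (reg-* (L₂.f-1-xq^ (8 ℕ.* suc k) (8*suc≢ k)) (L₂.f-x-q^ (8 ℕ.* suc k)))

        relation₂ : L₂.f ∣ 1# - x * pow q (8 ℕ.* M ℕ.+ 2)
        relation₂ = ∣-resp (+-congˡ (-‿cong (*-congˡ (reflexive (≡.cong (pow q) (≡.sym N-eq)))))) ∣-refl

      linear₁ : AllVanish L₁.f n M e₂ e₃ e₄
      linear₁ = LinearCase.linear L₁.f reg₁ pole₁ L₁.f-1-q^ M (inj₁ relation₁) n≡ e₂≡ e₃≡ e₄≡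

      linear₂ : AllVanish L₂.f n M e₂ e₃ e₄
      linear₂ = LinearCase.linear L₂.f reg₂ pole₂ L₂.f-1-q^ M (inj₂ relation₂) n≡ e₂≡ e₃≡ e₄≡

      cyclic : ∀ d → 1 ℕ.< d → d ∣ℕ n → AllVanish (Φ d) n M e₂ e₃ e₄
      cyclic d lt h = byShape (d≡ d lt h)
        where
        byShape : (∃ λ m → 1 ℕ.≤ m × d ≡ suc (4 ℕ.* m)) → AllVanish (Φ d) n M e₂ e₃ e₄
        byShape (m , 1≤m , ≡.refl) = CyclicCase.cyclic (Φ d)
          (regularity (Φ-q d lt h) (Φ-x d lt h) (Φ-1-q d lt h 1 (ℕᵈ.>⇒∤ lt)) (Φ-1-q d lt h 2 (ℕᵈ.>⇒∤ 2<d)))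
          m 1≤m (Φ∣ d lt h) (Φ-1-q d lt h) (Φ-ι d lt h) (Φ-1-xq d lt h) (Φ-x-q d lt h)
          (λ { (suc j) _ → 1-q^≉0 j }) n M h e₂ e₃ e₄
          where
          2<d : 2 ℕ.< d
          2<d = ℕ.s≤s (ℕₚ.≤-trans (ℕ.s≤s (ℕ.s≤s ℕ.z≤n)) (ℕₚ.*-monoʳ-≤ 4 1≤m))

      modulus : Carrier
      modulus = [n] * ((1# - x * pow q (2 ℕ.* n)) * (x - pow q (2 ℕ.* n)))

      private
        2n≡ : 2 ℕ.* n ≡ suc N
        2n≡ = ≡.trans (≡.cong (2 ℕ.*_) n≡) (solve′ 1 (λ M → con 2 :*′ (con 1 :+′ con 4 :*′ M) :=′ con 2 :+′ con 8 :*′ M) ≡.refl M)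
          where open +-*-Solver using (con) renaming (solve to solve′; _:*_ to _:*′_; _:+_ to _:+′_; _:=_ to _:=′_)

        [n]∣ : [n] ∣ 1# - pow q (suc N)
        [n]∣ = div (1# - pow q 2) (trans (*-comm _ _) (trans [n]-eq (+-congˡ (-‿cong (reflexive (≡.cong (pow q) 2n≡))))))

      module _ {y : FF.K.Fraction} {a b : Carrier}
        (same : FF.K.num y * b ≈ a * FF.K.den y) where

        vanishes⇒∣ : ∀ {g} → Vanishes g y → g ∣ a
        vanishes⇒∣ {g} (vanishing _ r z) = FractionField.Comparison.∣-numerator R dom g r z same

        modulus∣ : Vanishes L₁.f y → Vanishes L₂.f y → (∀ d → 1 ℕ.< d → d ∣ℕ n → Vanishes (Φ d) y) → modulus ∣ a
        modulus∣ h₁ h₂ hΦ = assemble (combine a λ d lt h → vanishes⇒∣ (hΦ d lt h)) (vanishes⇒∣ h₁) (vanishes⇒∣ h₂)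
          where
          assemble : [n] ∣ a → L₁.f ∣ a → L₂.f ∣ a → modulus ∣ a
          -- `[n]` divides `1 - q^(2n)` and so is regular modulo both linear factors, and `L₂.f` is
          -- regular modulo `L₁.f`; the three divisors are split off in turn.
          assemble (div w e) p₁ p₂ = second (reg-∣ [n]∣ (L₂.f-1-q^ N) w (∣-resp (trans (sym e) (*-comm _ _)) p₂))
            where
            second : L₂.f ∣ w → modulus ∣ a
            second (div w₂ e₂′) = first (reg-* (reg-∣ [n]∣ (L₁.f-1-q^ N)) (L₁.f-1-xq^ (suc N)) w₂
                (∣-resp (trans (sym e) (trans (*-congʳ (sym e₂′))
                  (solve 3 (λ w f n → w :* f :* n := n :* f :* w) ≡.refl w₂ L₂.f [n]))) p₁))
              where
              first : L₁.f ∣ w₂ → modulus ∣ a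
              first (div w₁ e₁) = div w₁ (trans (*-congˡ (*-congˡ (*-cong
                  (+-congˡ (-‿cong (*-congˡ (reflexive (≡.cong (pow q) 2n≡)))))
                  (+-congˡ (-‿cong (reflexive (≡.cong (pow q) 2n≡)))))))
                (trans (solve 4 (λ w n f g → w :* (n :* (f :* g)) := w :* g :* f :* n) ≡.refl w₁ [n] L₂.f L₁.f)
                (trans (*-congʳ (trans (*-congʳ e₁) e₂′)) e)))

      divisible : Divides modulus (Differences.Δs R dom q x regK poleK n M e₂)
        × Divides modulus (Differences.Δt R dom q x regK poleK n M e₃)
        × Divides modulus (Differences.Δu R dom q x regK poleK n M e₄)
      divisible =
          (λ same → modulus∣ same (proj₁ linear₁) (proj₁ linear₂) λ d lt h → proj₁ (cyclic d lt h))
        , (λ same → modulus∣ same (proj₁ (proj₂ linear₁)) (proj₁ (proj₂ linear₂)) λ d lt h → proj₁ (proj₂ (cyclic d lt h)))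
        , (λ same → modulus∣ same (proj₂ (proj₂ linear₁)) (proj₂ (proj₂ linear₂)) λ d lt h → proj₂ (proj₂ (cyclic d lt h)))

-- The ring of polynomials in x and q

open import Defs

ℤ-ring : CommutativeRing 0ℓ 0ℓ
ℤ-ring = ℤₚ.+-*-commutativeRing

ℤ-domain : IsDomain ℤ-ring
ℤ-domain = record
  { zero? = ℤ._≟ 0ℤ
  ; 1≉0 = λ ()
  ; integral = λ a b e nz → [ (λ z → ⊥-elim (nz z)) , (λ z → z) ]′ (ℤₚ.i*j≡0⇒i≡0∨j≡0 a e) }

ℤ-gcd : HasGCD ℤ-ring
ℤ-gcd = record
  { gcd = ℤᵍ.gcd
  ; gcd-∣ˡ = λ a b → fromℤ (ℤᵍ.gcd[i,j]∣i a b)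
  ; gcd-∣ʳ = λ a b → fromℤ (ℤᵍ.gcd[i,j]∣j a b)
  ; gcd-greatest = λ {a} {b} {d} p q → fromℤ (ℤᵍ.gcd-greatest {a} {b} {d} (toℤ p) (toℤ q)) }
  where
  open Divisibility ℤ-ring
  fromℤ : ∀ {d a} → d ℤᵘ.∣ a → d ∣ a
  fromℤ {d} {a} h = convert (ℤᵈ.∣ᵤ⇒∣ h)
    where
    convert : d ℤᵈ.∣ a → d ∣ a
    convert (ℤᵈ.divides k e) = div k (≡.sym e)
  toℤ : ∀ {d a} → d ∣ a → d ℤᵘ.∣ a
  toℤ (div k e) = ℤᵈ.∣⇒∣ᵤ (ℤᵈ.divides k (≡.sym e))

ops₁ : PolyOps ℤ-ring
ops₁ = record
  { add = add1 ; mul = mul1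
  ; add-[]ˡ = λ _ → ≡.refl ; add-[]ʳ = λ _ _ → ≡.refl ; add-∷ = λ _ _ _ _ → ≡.refl
  ; mul-[]ˡ = λ _ → ≡.refl ; mul-∷ = λ _ _ _ → ≡.refl }

ring₁ : CommutativeRing 0ℓ 0ℓ
ring₁ = PolyRing.polyRing ℤ-ring ops₁

domain₁ : IsDomain ring₁
domain₁ = PolyDomain.polyDomain ℤ-ring ops₁ ℤ-domain

gcd₁ : HasGCD ring₁
gcd₁ = PolyGCD.polyGCD ℤ-ring ops₁ ℤ-domain ℤ-gcd

ops₂ : PolyOps ring₁
ops₂ = record
  { add = addP ; mul = mulP
  ; add-[]ˡ = λ _ → ≡.refl ; add-[]ʳ = λ _ _ → ≡.refl ; add-∷ = λ _ _ _ _ → ≡.refl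
  ; mul-[]ˡ = λ _ → ≡.refl ; mul-∷ = λ _ _ _ → ≡.refl }

ring₂ : CommutativeRing 0ℓ 0ℓ
ring₂ = PolyRing.polyRing ring₁ ops₂

domain₂ : IsDomain ring₂
domain₂ = PolyDomain.polyDomain ring₁ ops₂ domain₁

gcd₂ : HasGCD ring₂
gcd₂ = PolyGCD.polyGCD ring₁ ops₂ domain₁ gcd₁

module R₁ = CommutativeRing ring₁
module R₂ = CommutativeRing ring₂
module D₁ = Divisibility ring₁
module D₂ = Divisibility ring₂
module K₁ = Kit ring₁
module K₂ = Kit ring₂

AllZero⇒≈[] : ∀ (p : P1) → All (_≡ 0ℤ) p → p R₁.≈ []
AllZero⇒≈[] [] [] = R₁.refl
AllZero⇒≈[] (a ∷ p) (z ∷ zs) = R₁.trans (PolyRing.∷-cong ℤ-ring ops₁ z (AllZero⇒≈[] p zs)) (PolyRing.0∷[] ℤ-ring ops₁)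

≈[]⇒AllZero : ∀ (p : P1) → p R₁.≈ [] → All (_≡ 0ℤ) p
≈[]⇒AllZero [] e = []
≈[]⇒AllZero (a ∷ p) e = PolyRing.at e 0 ∷ ≈[]⇒AllZero p (PolyRing.mk≋ λ i → PolyRing.at e (suc i))

IsZero⇒≈[] : ∀ (p : Poly) → IsZero p → p R₂.≈ []
IsZero⇒≈[] [] [] = R₂.refl
IsZero⇒≈[] (a ∷ p) (z ∷ zs) = R₂.trans (PolyRing.∷-cong ring₁ ops₂ (AllZero⇒≈[] a z) (IsZero⇒≈[] p zs)) (PolyRing.0∷[] ring₁ ops₂)

≈[]⇒IsZero : ∀ (p : Poly) → p R₂.≈ [] → IsZero p
≈[]⇒IsZero [] e = []
≈[]⇒IsZero (a ∷ p) e = ≈[]⇒AllZero a (PolyRing.at e 0) ∷ ≈[]⇒IsZero p (PolyRing.mk≋ λ i → PolyRing.at e (suc i))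

≈P⇒≈ : ∀ {a b} → a ≈P b → a R₂.≈ b
≈P⇒≈ {a} {b} e = x∙y⁻¹≈ε⇒x≈y a b (IsZero⇒≈[] (subP a b) e)
  where open import Algebra.Properties.Ring R₂.ring using (x∙y⁻¹≈ε⇒x≈y)

≈⇒≈P : ∀ {a b} → a R₂.≈ b → a ≈P b
≈⇒≈P {a} {b} e = ≈[]⇒IsZero (subP a b) (R₂.trans (R₂.+-congʳ {negP b} e) (R₂.-‿inverseʳ b))

∣P⇒∣ : ∀ {d a} → d ∣P a → d D₂.∣ a
∣P⇒∣ (c , e) = D₂.div c (≈P⇒≈ e)

∣⇒∣P : ∀ {d a} → d D₂.∣ a → d ∣P a
∣⇒∣P (D₂.div c e) = c , ≈⇒≈P e

∣1⇒IsUnit : ∀ {d} → d D₂.∣ R₂.1# → IsUnit d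
∣1⇒IsUnit {d} (D₂.div c e) = c , ≈⇒≈P (R₂.trans (R₂.*-comm d c) e)

-- Indeterminates, constants and the cyclotomic factors in ℤ[q][x]

module Indeterminate (R : CommutativeRing 0ℓ 0ℓ) (ops : PolyOps R) (dom : IsDomain R) where
  open CommutativeRing R
  open PolyOps ops
  open PolyRing R ops
  open PolyDomain R ops dom
  open Divisibility R
  open DomainProperties R dom using (reg-0)
  private
    module KR = Kit R
    module SR = Solver R
    module KP = Kit polyRing
    module SP = Solver polyRing
    module PR = CommutativeRing polyRing
    open import Algebra.Properties.Ring ring using (-0#≈0#)

  X : List Carrier
  X = 0# ∷ 1# ∷ []

  mul-X : ∀ p → mul X p ≋ 0# ∷ p
  mul-X p = ≋-trans (mul-0∷ (1# ∷ []) p) (∷-cong refl (mul-idˡ p))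

  C : Carrier → List Carrier
  C a = a ∷ []

  C-* : ∀ a b → mul (C a) (C b) ≋ C (a * b)
  C-* a b = mul-const a (C b)

  C-+ : ∀ a b → add (C a) (C b) ≋ C (a + b)
  C-+ a b = ≋-trans (≡⇒≋ (add-∷ a [] b [])) (∷-cong refl (≡⇒≋ (add-[]ˡ [])))

  C-pow : ∀ a n → KP.pow (C a) n ≋ C (KR.pow a n)
  C-pow a zero = ≋-refl
  C-pow a (suc n) = ≋-trans (mul-cong ≋-refl (C-pow a n)) (C-* a _)

  C-1-pow : ∀ a n → (PR.1# PR.- KP.pow (C a) n) ≋ C (1# - KR.pow a n)
  C-1-pow a n = ≋-trans (add-cong ≋-refl (neg-cong (C-pow a n))) (C-+ 1# (- KR.pow a n))

  C-ι : ∀ s → SP.ι s ≋ C (SR.ι s)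
  C-ι zero = ≋-sym 0∷[]
  C-ι (suc s) = ≋-trans (add-cong ≋-refl (C-ι s)) (C-+ 1# (SR.ι s))

  1-0∷ : ∀ p → (PR.1# PR.- (0# ∷ p)) ≋ (1# ∷ neg p)
  1-0∷ p = ≋-trans (≡⇒≋ (add-∷ 1# [] (- 0#) (neg p)))
    (∷-cong (trans (+-congˡ -0#≈0#) (+-identityʳ 1#)) (≡⇒≋ (add-[]ˡ (neg p))))

  1-pow-X : ∀ j → (PR.1# PR.- KP.pow X (suc j)) ≋ (1# ∷ neg (KP.pow X j))
  1-pow-X j = ≋-trans (add-cong ≋-refl (neg-cong (mul-X (KP.pow X j)))) (1-0∷ (KP.pow X j))

  1-X*C : ∀ {a} {p} → p ≋ C a → (PR.1# PR.- mul X p) ≋ (1# ∷ - a ∷ [])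
  1-X*C {a} e = ≋-trans (add-cong ≋-refl (neg-cong (≋-trans (mul-cong ≋-refl e) (mul-X (C a))))) (1-0∷ (C a))

  X-C : ∀ {a} {p} → p ≋ C a → (X PR.- p) ≋ (- a ∷ 1# ∷ [])
  X-C {a} e = ≋-trans (add-cong ≋-refl (neg-cong e))
    (≋-trans (≡⇒≋ (add-∷ 0# (1# ∷ []) (- a) [])) (∷-cong (+-identityˡ (- a)) (≡⇒≋ (add-[]ʳ 1# []))))

  -- A case of `reg-const`. It serves twice: for `1 - q^j` over ℤ and for `1 - x q^N` over ℤ[q].
  reg-head-1 : ∀ {e p s} → p ≋ (1# ∷ s) → P.Reg (C e) p
  reg-head-1 {s = s} h = P.reg-resp (≋-sym h) (reg-const 1# s reg-1)

  reg-C : ∀ {e a} → Reg e a → P.Reg (C e) (C a)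
  reg-C {a = a} r = reg-const a [] r

  reg-X : ∀ {e} → P.Reg (C e) X
  reg-X {e} t h = ∣ᶜ⇒const∣ λ i → const∣⇒∣ᶜ (P.∣-resp (mul-X t) h) (suc i)

  head-1-nonzero : ∀ {p s} → p ≋ (1# ∷ s) → ¬ p ≋ []
  head-1-nonzero h z = IsDomain.1≉0 dom (trans (sym (at h 0)) (at z 0))

  X-C-nonzero : ∀ {a p} → p ≋ C a → ¬ (X PR.- p) ≋ []
  X-C-nonzero e z = IsDomain.1≉0 dom (trans (sym (at (X-C e) 1)) (at z 1))

  X-nonzero : ¬ X ≋ []
  X-nonzero z = IsDomain.1≉0 dom (at z 1)

  C-nonzero : ∀ {a} → ¬ a ≈ 0# → ¬ C a ≋ []
  C-nonzero nz z = nz (at z 0)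

  C-∣ : ∀ {a b} → a ∣ b → C a P.∣ C b
  C-∣ (div k e) = P.div (C k) (≋-trans (C-* k _) (∷-cong e ≋-refl))

module I₁ = Indeterminate ℤ-ring ops₁ ℤ-domain
module I₂ = Indeterminate ring₁ ops₂ domain₁

private
  module Dom₁ = DomainProperties ring₁ domain₁
  module Dom₂ = DomainProperties ring₂ domain₂
  module S₁ = Solver ring₁
  module S₂ = Solver ring₂

q₁ v : P1
q₁ = I₁.X
v = K₁.pow q₁ 2

v^≈ : ∀ j → K₁.pow v j R₁.≈ K₁.pow q₁ (2 ℕ.* j)
v^≈ j = R₁.sym (K₁.pow-* q₁ 2 j)

1-v^≈ : ∀ j → (R₁.1# R₁.- K₁.pow v j) R₁.≈ (R₁.1# R₁.- K₁.pow q₁ (2 ℕ.* j))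
1-v^≈ j = R₁.+-congˡ {R₁.1#} (R₁.-‿cong (v^≈ j))

1-q₁^-nonzero : ∀ j → ¬ (R₁.1# R₁.- K₁.pow q₁ (suc j)) R₁.≈ R₁.0#
1-q₁^-nonzero j = I₁.head-1-nonzero (I₁.1-pow-X j)

1-v^-nonzero : ∀ j → ¬ (R₁.1# R₁.- K₁.pow v (suc j)) R₁.≈ R₁.0#
1-v^-nonzero j z = 1-q₁^-nonzero (j ℕ.+ suc (j ℕ.+ 0)) (R₁.trans (R₁.sym (1-v^≈ (suc j))) z)

ι-ℤ : ∀ s → Solver.ι ℤ-ring s ≡ + s
ι-ℤ zero = ≡.refl
ι-ℤ (suc s) = ≡.cong (λ i → 1ℤ ℤ.+ i) (ι-ℤ s)

-- A power of `v` subtracted from 1 has constant term 1, so it is regular modulo every integer, and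
-- so is its divisor `g`. For a nonzero integer `reg-sym` exchanges the roles.
reg-ι₁ : ∀ j {g} → g D₁.∣ (R₁.1# R₁.- K₁.pow v (suc j)) → ∀ s → D₁.Reg g (S₁.ι (suc s))
reg-ι₁ j {g} h s = D₁.reg-resp (R₁.sym (I₁.C-ι (suc s)))
  (Dom₁.reg-sym (I₁.C-nonzero λ z → ℕₚ.0≢1+n (≡.sym (ℤₚ.+-injective (≡.trans (≡.sym (ι-ℤ (suc s))) z))))
    (D₁.reg-∣ h (D₁.reg-resp (R₁.sym (1-v^≈ (suc j))) (I₁.reg-head-1 (I₁.1-pow-X (j ℕ.+ suc (j ℕ.+ 0)))))))

open Cyclotomic ring₁ domain₁ v 1-v^-nonzero reg-ι₁ using (Factors; cyclotomicFactors; geom-divides)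

q₂ x₂ : Poly
q₂ = qP
x₂ = xP

q₁-regular : ∀ {g} j → g D₁.∣ (R₁.1# R₁.- K₁.pow q₁ (suc j)) → D₁.Reg g q₁
q₁-regular {g} j h = D₁.reg-∣ {g} {q₁} {K₁.pow q₁ (suc j)} (D₁.∣-*ʳ {q₁} {q₁} (K₁.pow q₁ j) D₁.∣-refl)
  (D₁.reg-mod {g} {K₁.pow q₁ (suc j)} {R₁.1#} (D₁.∣-resp
    (S₁.solve 1 (λ y → S₁.:- (S₁.:1 S₁.:- y) S₁.:= y S₁.:- S₁.:1) ≡.refl (K₁.pow q₁ (suc j))) (D₁.∣-neg h)) D₁.reg-1)

q₁^-regular : ∀ {g} → D₁.Reg g q₁ → ∀ N → D₁.Reg g (K₁.pow q₁ N)
q₁^-regular {g} r zero = D₁.reg-1 {g}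
q₁^-regular {g} r (suc N) = D₁.reg-* {g} {q₁} {K₁.pow q₁ N} r (q₁^-regular {g} r N)

-q₁^-regular : ∀ {g} → D₁.Reg g q₁ → ∀ N → D₁.Reg g (R₁.- K₁.pow q₁ N)
-q₁^-regular {g} r N = D₁.reg-∣ {g} {R₁.- K₁.pow q₁ N} {K₁.pow q₁ N} (D₁.div (R₁.- R₁.1#)
  (S₁.solve 1 (λ y → (S₁.:- S₁.:1) S₁.:* (S₁.:- y) S₁.:= y) ≡.refl (K₁.pow q₁ N))) (q₁^-regular {g} r N)

q₂-nonzero : ¬ q₂ R₂.≈ R₂.0#
q₂-nonzero = I₂.C-nonzero I₁.X-nonzero

1-q₂^-nonzero : ∀ j → ¬ (R₂.1# R₂.- K₂.pow q₂ (suc j)) R₂.≈ R₂.0#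
1-q₂^-nonzero j z = I₂.C-nonzero (1-q₁^-nonzero j) (R₂.trans (R₂.sym (I₂.C-1-pow q₁ (suc j))) z)

x-q^-nonzero : ∀ N → ¬ (x₂ R₂.- K₂.pow q₂ N) R₂.≈ R₂.0#
x-q^-nonzero N = I₂.X-C-nonzero (I₂.C-pow q₁ N)

1-xq^-nonzero : ∀ N → ¬ (R₂.1# R₂.- x₂ R₂.* K₂.pow q₂ N) R₂.≈ R₂.0#
1-xq^-nonzero N = I₂.head-1-nonzero (I₂.1-X*C (I₂.C-pow q₁ N))

reg-1-xq^ : ∀ {e} N → D₂.Reg (I₂.C e) (R₂.1# R₂.- x₂ R₂.* K₂.pow q₂ N)
reg-1-xq^ N = I₂.reg-head-1 (I₂.1-X*C (I₂.C-pow q₁ N))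

reg-x-q^ : ∀ {e} → D₁.Reg e q₁ → ∀ N → D₂.Reg (I₂.C e) (x₂ R₂.- K₂.pow q₂ N)
reg-x-q^ r N = D₂.reg-resp (R₂.sym (I₂.X-C (I₂.C-pow q₁ N)))
  (PolyDomain.reg-const ring₁ ops₂ domain₁ (R₁.- K₁.pow q₁ N) (R₁.1# ∷ []) (-q₁^-regular r N))

q-linear₁ : ∀ N → D₂.Reg q₂ (x₂ R₂.- K₂.pow q₂ (suc N))
q-linear₁ N = D₂.reg-mod {s′ = x₂} (D₂.∣-resp
    (S₂.solve 3 (λ x q Q → S₂.:- Q S₂.:* q S₂.:= (x S₂.:- q S₂.:* Q) S₂.:- x) ≡.refl x₂ q₂ (K₂.pow q₂ N))
    (D₂.∣-*ˡ (R₂.- K₂.pow q₂ N) D₂.∣-refl))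
  I₂.reg-X

1-q^-linear₁ : ∀ j N → D₂.Reg (R₂.1# R₂.- K₂.pow q₂ (suc j)) (x₂ R₂.- K₂.pow q₂ N)
1-q^-linear₁ j N = D₂.reg-respˡ {I₂.C (R₁.1# R₁.- K₁.pow q₁ (suc j))} {R₂.1# R₂.- K₂.pow q₂ (suc j)} {x₂ R₂.- K₂.pow q₂ N}
  (R₂.sym (I₂.C-1-pow q₁ (suc j))) (reg-x-q^ {R₁.1# R₁.- K₁.pow q₁ (suc j)} (q₁-regular j D₁.∣-refl) N)

q-linear₂ : ∀ N → D₂.Reg q₂ (R₂.1# R₂.- x₂ R₂.* K₂.pow q₂ (suc N))
q-linear₂ N = reg-1-xq^ (suc N)

1-q^-linear₂ : ∀ j N → D₂.Reg (R₂.1# R₂.- K₂.pow q₂ (suc j)) (R₂.1# R₂.- x₂ R₂.* K₂.pow q₂ N)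
1-q^-linear₂ j N = D₂.reg-respˡ {I₂.C (R₁.1# R₁.- K₁.pow q₁ (suc j))} {R₂.1# R₂.- K₂.pow q₂ (suc j)} {R₂.1# R₂.- x₂ R₂.* K₂.pow q₂ N}
  (R₂.sym (I₂.C-1-pow q₁ (suc j))) (reg-1-xq^ {R₁.1# R₁.- K₁.pow q₁ (suc j)} N)

module CyclotomicFactors (n : ℕ) where
  private
    Φ₁ : ℕ → P1
    Φ₁ = proj₁ (cyclotomicFactors n)

    Φ-factors : Factors n Φ₁
    Φ-factors = proj₂ (cyclotomicFactors n)

    open Factors Φ-factors

  Φ : ℕ → Poly
  Φ d = I₂.C (Φ₁ d)

  module _ (d : ℕ) (1<d : 1 ℕ.< d) (d≤n : d ℕ.≤ n) where
    private
      0<d : 0 ℕ.< d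
      0<d = ℕₚ.<-trans (ℕ.s≤s ℕ.z≤n) 1<d

      Φ₁∣ : Φ₁ d D₁.∣ (R₁.1# R₁.- K₁.pow q₁ (2 ℕ.* d))
      Φ₁∣ = D₁.∣-resp (1-v^≈ d) (Φ∣F d 0<d d≤n)

      Φ₁-q : D₁.Reg (Φ₁ d) q₁
      Φ₁-q = positive d 0<d Φ₁∣
        where
        positive : ∀ d → 0 ℕ.< d → ∀ {g} → g D₁.∣ (R₁.1# R₁.- K₁.pow q₁ (2 ℕ.* d)) → D₁.Reg g q₁
        positive (suc d) _ h = q₁-regular (d ℕ.+ suc (d ℕ.+ 0)) h

    Φ∣ : Φ d D₂.∣ (R₂.1# R₂.- K₂.pow q₂ (2 ℕ.* d))
    Φ∣ = D₂.∣-resp (R₂.sym (I₂.C-1-pow q₁ (2 ℕ.* d))) (I₂.C-∣ Φ₁∣)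

    Φ-1-q : ∀ j → ¬ d ∣ℕ j → D₂.Reg (Φ d) (R₂.1# R₂.- K₂.pow q₂ (2 ℕ.* j))
    Φ-1-q j nd = D₂.reg-resp (R₂.sym (I₂.C-1-pow q₁ (2 ℕ.* j)))
      (I₂.reg-C {Φ₁ d} {R₁.1# R₁.- K₁.pow q₁ (2 ℕ.* j)} (D₁.reg-resp {Φ₁ d} {R₁.1# R₁.- K₁.pow v j} (1-v^≈ j) (Φ-regular d 0<d d≤n j nd)))

    Φ-ι : ∀ s → D₂.Reg (Φ d) (S₂.ι (suc s))
    Φ-ι s = D₂.reg-resp (R₂.sym (I₂.C-ι (suc s))) (I₂.reg-C {Φ₁ d} {S₁.ι (suc s)} (positive d 0<d (Φ∣F d 0<d d≤n)))
      where
      positive : ∀ d → 0 ℕ.< d → ∀ {g} → g D₁.∣ (R₁.1# R₁.- K₁.pow v d) → D₁.Reg g (S₁.ι (suc s))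
      positive (suc d) _ h = reg-ι₁ d h s

    Φ-q : D₂.Reg (Φ d) q₂
    Φ-q = I₂.reg-C {Φ₁ d} {q₁} Φ₁-q

    Φ-x : D₂.Reg (Φ d) x₂
    Φ-x = I₂.reg-X

    Φ-1-xq : ∀ j → D₂.Reg (Φ d) (R₂.1# R₂.- x₂ R₂.* K₂.pow q₂ j)
    Φ-1-xq j = reg-1-xq^ j

    Φ-x-q : ∀ j → D₂.Reg (Φ d) (x₂ R₂.- K₂.pow q₂ j)
    Φ-x-q j = reg-x-q^ Φ₁-q j

  module _ {m : ℕ} (n≡ : n ≡ suc m) where
    private
      bracket : P1
      bracket = Geometric.geom ring₁ v n

      qint2P≈geom : ∀ k → qint2P k R₂.≈ I₂.C (Geometric.geom ring₁ v k)
      qint2P≈geom zero = R₂.sym (PolyRing.0∷[] ring₁ ops₂)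
      qint2P≈geom (suc k) = R₂.trans (R₂.+-cong (qint2P≈geom k)
          (R₂.trans (R₂.reflexive (powP≡pow (2 ℕ.* k))) (R₂.trans (I₂.C-pow q₁ (2 ℕ.* k))
            (PolyRing.∷-cong ring₁ ops₂ (R₁.sym (v^≈ k)) R₂.refl))))
        (I₂.C-+ (Geometric.geom ring₁ v k) (K₁.pow v k))
        where
        powP≡pow : ∀ k → powP qP k ≡ K₂.pow q₂ k
        powP≡pow zero = ≡.refl
        powP≡pow (suc k) = ≡.cong (mulP qP) (powP≡pow k)

    -- Neither `Φ d` nor `qint2P n` involves `x`, so divisibility is tested on each coefficient of
    -- `a` in ℤ[q].
    combine : ∀ a → (∀ d → 1 ℕ.< d → d ∣ℕ n → Φ d D₂.∣ a) → qint2P n D₂.∣ a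
    combine a h = D₂.∣-respˡ (R₂.sym (qint2P≈geom n)) (PolyDomain.∣ᶜ⇒const∣ ring₁ ops₂ domain₁ λ i →
      geom-divides Φ-factors n≡ ℕₚ.≤-refl λ d lt d∣n → PolyDomain.const∣⇒∣ᶜ ring₁ ops₂ domain₁ (h d lt d∣n) i)

    qint2P-eq : (qint2P n R₂.* (R₂.1# R₂.- K₂.pow q₂ 2)) R₂.≈ (R₂.1# R₂.- K₂.pow q₂ (2 ℕ.* n))
    qint2P-eq = R₂.trans (R₂.*-cong (qint2P≈geom n) (I₂.C-1-pow q₁ 2)) (R₂.trans (I₂.C-* bracket (R₁.1# R₁.- v))
      (R₂.trans (PolyRing.∷-cong ring₁ ops₂ (R₁.trans (R₁.*-comm bracket (R₁.1# R₁.- v))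
          (R₁.trans (Geometric.geom-sum ring₁ v n) (1-v^≈ n))) R₂.refl)
        (R₂.sym (I₂.C-1-pow q₁ (2 ℕ.* n)))))

-- The congruences

open import Data.Nat using (_∸_; _*_; _<_)
open import Data.Nat.Divisibility using (_∣_)
open import Data.Nat.ListAction using (product)
open import Data.Nat.Primality using (Prime)
open import Data.Nat.Primality.Factorisation using (PrimeFactorisation; factorise)

product-%4 : ∀ ps → All (λ p → p % 4 ≡ 1) ps → product ps % 4 ≡ 1
product-%4 [] [] = ≡.refl
product-%4 (p ∷ ps) (e ∷ es) = ≡.trans (DivMod.%-distribˡ-* p (product ps) 4)
  (≡.cong₂ (λ a b → (a * b) % 4) e (product-%4 ps es))

≡1-mod-4 : ∀ n → 0 < n → (∀ p → Prime p → p ∣ n → p % 4 ≡ 1) → ∀ d → d ∣ n → d % 4 ≡ 1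
≡1-mod-4 n n>0 h d d∣n = ≡.trans (≡.cong (_% 4) isFactorisation) (product-%4 factors (primes factors factorsPrime λ p p∣ →
    ℕᵈ.∣-trans p∣ (ℕᵈ.∣-trans (≡.subst (product factors ∣_) (≡.sym isFactorisation) ℕᵈ.∣-refl) d∣n)))
  where
  instance
    d≢0 : ℕ.NonZero d
    d≢0 = ℕ.≢-nonZero λ { ≡.refl → ℕₚ.<⇒≢ n>0 (≡.sym (ℕᵈ.0∣⇒≡0 d∣n)) }
  open PrimeFactorisation (factorise d)
  primes : ∀ ps → All Prime ps → (∀ p → p ∣ product ps → p ∣ n) → All (λ p → p % 4 ≡ 1) ps
  primes [] [] k = []
  primes (p ∷ ps) (pr ∷ prs) k =
    h p pr (k p (ℕᵈ.m∣m*n (product ps))) ∷ primes ps prs λ p′ d → k p′ (ℕᵈ.∣n⇒∣m*n p d)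

1-mod-4-shape : ∀ d → d % 4 ≡ 1 → d ≡ suc (4 * (d / 4))
1-mod-4-shape d e = ≡.trans (DivMod.m≡m%n+[m/n]*n d 4)
  (≡.trans (≡.cong (ℕ._+ d / 4 * 4) e) (≡.cong suc (ℕₚ.*-comm (d / 4) 4)))

4*-/4 : ∀ M → (suc (4 * M) ∸ 1) / 4 ≡ M
4*-/4 M = ≡.trans (≡.cong (_/ 4) (ℕₚ.*-comm 4 M)) (DivMod.m*n/n≡m M 4)

-- From bare fractions to the field of fractions

open FractionField ring₂ domain₂ using (module K; den≉0)
open K using (Fraction; num; den; _⊕_; _⊗_; ⊖_; emb; recip)
private
  module KK = Kit K.fractionRing

⌜_⌝ : Fraction → Frac
⌜ y ⌝ = num y // den y

infix 4 _⇝_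
-- Equality on the nose: the operations on `Frac` and on the field of fractions compute the same
-- numerators and denominators, the latter merely carrying proofs of regularity.
record _⇝_ (X : Frac) (y : Fraction) : Set where
  constructor is
  field eq : X ≡ ⌜ y ⌝

⇝-+ : ∀ {X Y x y} → X ⇝ x → Y ⇝ y → (X +F Y) ⇝ (x ⊕ y)
⇝-+ (is ≡.refl) (is ≡.refl) = is ≡.refl

⇝-* : ∀ {X Y x y} → X ⇝ x → Y ⇝ y → (X *F Y) ⇝ (x ⊗ y)
⇝-* (is ≡.refl) (is ≡.refl) = is ≡.refl

⇝-- : ∀ {X Y x y} → X ⇝ x → Y ⇝ y → (X -F Y) ⇝ (x ⊕ ⊖ y)
⇝-- (is ≡.refl) (is ≡.refl) = is ≡.refl

⇝-inv : ∀ {X x r} → X ⇝ x → invF X ⇝ recip x r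
⇝-inv (is ≡.refl) = is ≡.refl

⇝-pow : ∀ {X x} n → X ⇝ x → powF X n ⇝ KK.pow x n
⇝-pow zero h = is ≡.refl
⇝-pow (suc n) h = ⇝-* h (⇝-pow n h)

⇝-sum : ∀ n {F f} → (∀ i → F i ⇝ f i) → sumF n F ⇝ KK.sum n f
⇝-sum zero h = is ≡.refl
⇝-sum (suc n) h = ⇝-+ (⇝-sum n h) (h n)

⇝-poch : ∀ {X Y x y} k → X ⇝ x → Y ⇝ y → poch X Y k ⇝ KK.poch x y k
⇝-poch zero h h′ = is ≡.refl
⇝-poch (suc k) h h′ = ⇝-* (⇝-poch k h h′) (⇝-- (is ≡.refl) (⇝-* h (⇝-pow k h′)))

-- The hypothesis applies to every representation of the difference, so also to lowest terms
-- `A1 // A2`. Once `P` divides `A1`, its coprimality to `A2` is inherited from that of `A1`.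
congMod : ∀ A B {P Δ} → (A -F B) ⇝ Δ →
  (∀ {a b} → mulP (num Δ) b R₂.≈ mulP a (den Δ) → P D₂.∣ a) → CongMod A B P
congMod A B {P} {Δ} (is eq) divisible =
  build (GCDProperties.lowest-terms ring₂ domain₂ gcd₂ (num Δ) (den Δ) (den≉0 Δ))
  where
  build : Σ Poly (λ A1 → Σ Poly λ A2 → mulP (num Δ) A2 R₂.≈ mulP A1 (den Δ) × ¬ A2 R₂.≈ R₂.0#
      × (∀ d → d D₂.∣ A1 → d D₂.∣ A2 → d D₂.∣ R₂.1#)) → CongMod A B P
  build (A1 , A2 , same , nz , coprime) = A1 , A2 , (λ z → nz (IsZero⇒≈[] A2 z))
    , ≡.subst (λ X → X ≈F (A1 // A2)) (≡.sym eq) (≈⇒≈P same)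
    , (λ d p q → ∣1⇒IsUnit (coprime d (∣P⇒∣ p) (∣P⇒∣ q)))
    , ∣⇒∣P P∣A1
    , (λ d p q → ∣1⇒IsUnit (coprime d (D₂.∣-trans (∣P⇒∣ p) P∣A1) (∣P⇒∣ q)))
    where
    P∣A1 : P D₂.∣ A1
    P∣A1 = divisible same

powP≡pow : ∀ k → powP qP k ≡ K₂.pow q₂ k
powP≡pow zero = ≡.refl
powP≡pow (suc k) = ≡.cong (mulP qP) (powP≡pow k)

regK : Side.Regularity ring₂ q₂ x₂ R₂.0#
regK = Regularities.fieldRegularity ring₂ domain₂ q₂ x₂ q₂-nonzero 1-q₂^-nonzero q-linear₁ 1-q^-linear₁ q-linear₂ 1-q^-linear₂
  x-q^-nonzero 1-xq^-nonzero I₂.X-nonzero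

poleK : ∀ k → D₂.Reg R₂.0# (Side.Elements.δ ring₂ q₂ x₂ R₂.0# regK k)
poleK = Regularities.fieldPoles ring₂ domain₂ q₂ x₂ q₂-nonzero 1-q₂^-nonzero q-linear₁ 1-q^-linear₁ q-linear₂ 1-q^-linear₂
  x-q^-nonzero 1-xq^-nonzero I₂.X-nonzero

rhs : ℕ → ℕ → ℕ → ℕ → Frac
rhs n m e i = powF (qint2 n) i *F powF (ratio m) i *F invF (powF qF e) *F powF E i

module Translation where
  private
    module SK = Side ring₂ q₂ x₂ R₂.0#
    module EK = SK.Elements regK
  open Differences ring₂ domain₂ q₂ x₂ regK poleK

  q⇝ : qF ⇝ SK.q̂
  q⇝ = is ≡.refl

  x⇝ : xF ⇝ SK.x̂
  x⇝ = is ≡.refl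

  1⇝ : oneF ⇝ emb R₂.1#
  1⇝ = is ≡.refl

  q2⇝ : q2 ⇝ SK.q2
  q2⇝ = ⇝-pow 2 q⇝

  p⇝ : q8 ⇝ SK.p
  p⇝ = ⇝-pow 8 q⇝

  qint⇝ : ∀ m → qint m ⇝ EK.qint m
  qint⇝ m = ⇝-* (⇝-- 1⇝ (⇝-pow m q⇝)) (⇝-inv (⇝-- 1⇝ q⇝))

  qint2⇝ : ∀ m → qint2 m ⇝ EK.qint2 m
  qint2⇝ m = ⇝-* (⇝-- 1⇝ (⇝-pow (2 * m) q⇝)) (⇝-inv (⇝-- 1⇝ q2⇝))

  α⇝ : ∀ k → α k ⇝ PK.α k
  α⇝ k = ⇝-* (⇝-* (⇝-* (⇝-inv (⇝-pow (4 * k) q⇝)) (⇝-pow 2 (qint⇝ (8 * k ℕ.+ 1)))) (qint2⇝ (8 * k ℕ.+ 1)))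
    (⇝-* (⇝-* (⇝-* (⇝-pow 2 (⇝-poch k q2⇝ p⇝)) (⇝-poch k (⇝-* x⇝ q2⇝) p⇝)) (⇝-poch k (⇝-* q2⇝ (⇝-inv x⇝)) p⇝))
      (⇝-inv (⇝-* (⇝-* (⇝-pow 2 (⇝-poch k p⇝ p⇝)) (⇝-poch k (⇝-* x⇝ p⇝) p⇝)) (⇝-poch k (⇝-* p⇝ (⇝-inv x⇝)) p⇝))))

  s⇝ : ∀ k → s k ⇝ CK.s k
  s⇝ k = ⇝-sum (suc k) λ j → ⇝-* (α⇝ j) (α⇝ (k ∸ j))

  t⇝ : ∀ k → t k ⇝ CK.t k
  t⇝ k = ⇝-sum (suc k) λ j → ⇝-sum (suc (k ∸ j)) λ i → ⇝-* (⇝-* (α⇝ j) (α⇝ i)) (α⇝ (k ∸ j ∸ i))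

  u⇝ : ∀ k → u k ⇝ CK.u k
  u⇝ k = ⇝-sum (suc k) λ j → ⇝-sum (suc (k ∸ j)) λ i → ⇝-sum (suc (k ∸ j ∸ i)) λ h →
    ⇝-* (⇝-* (⇝-* (α⇝ j) (α⇝ i)) (α⇝ h)) (α⇝ (k ∸ j ∸ i ∸ h))

  E⇝ : E ⇝ EK.E
  E⇝ = ⇝-- 1⇝ (⇝-* (⇝-* (⇝-- 1⇝ (⇝-* x⇝ q2⇝)) (⇝-- 1⇝ (⇝-* q2⇝ (⇝-inv x⇝))))
    (⇝-inv (⇝-* (⇝-pow 2 (⇝-- 1⇝ q⇝)) (⇝-+ 1⇝ q2⇝))))

  ratio⇝ : ∀ m → ratio m ⇝ PK.ratio m
  ratio⇝ m = ⇝-* (⇝-poch m (⇝-pow 4 q⇝) p⇝) (⇝-inv (⇝-poch m p⇝ p⇝))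

  rhs⇝ : ∀ n m e i → rhs n m e i ⇝ PK.rhs n m e i
  rhs⇝ n m e i = ⇝-* (⇝-* (⇝-* (⇝-pow i (qint2⇝ n)) (⇝-pow i (ratio⇝ m))) (⇝-inv (⇝-pow e q⇝))) (⇝-pow i E⇝)

  s-difference⇝ : ∀ n m e → (sumF n s -F rhs n m e 2) ⇝ Differences.Δs ring₂ domain₂ q₂ x₂ regK poleK n m e
  s-difference⇝ n m e = ⇝-- (⇝-sum n s⇝) (rhs⇝ n m e 2)

  t-difference⇝ : ∀ n m e → (sumF n t -F rhs n m e 3) ⇝ Differences.Δt ring₂ domain₂ q₂ x₂ regK poleK n m e
  t-difference⇝ n m e = ⇝-- (⇝-sum n t⇝) (rhs⇝ n m e 3)

  u-difference⇝ : ∀ n m e → (sumF n u -F rhs n m e 4) ⇝ Differences.Δu ring₂ domain₂ q₂ x₂ regK poleK n m e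
  u-difference⇝ n m e = ⇝-- (⇝-sum n u⇝) (rhs⇝ n m e 4)

open Translation

Divides : Poly → Fraction → Set
Divides P y = ∀ {a b} → mulP (num y) b R₂.≈ mulP a (den y) → P D₂.∣ a

theorem4 : (n : ℕ) → 0 < n → (∀ p → Prime p → p ∣ n → p % 4 ≡ 1) →
    CongMod (sumF n s)
    (powF (qint2 n) 2 *F powF (ratio ((n ∸ 1) / 4)) 2
    *F invF (powF qF (n ∸ 1)) *F powF E 2)
    (modulus n)
    × CongMod (sumF n t)
    (powF (qint2 n) 3 *F powF (ratio ((n ∸ 1) / 4)) 3
    *F invF (powF qF ((3 * (n ∸ 1)) / 2)) *F powF E 3)
    (modulus n)
    × CongMod (sumF n u)
    (powF (qint2 n) 4 *F powF (ratio ((n ∸ 1) / 4)) 4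
    *F invF (powF qF (2 * (n ∸ 1))) *F powF E 4)
    (modulus n)
theorem4 n n>0 primes≡1 =
    congMod (sumF n s) (rhs n M e₂ 2) (s-difference⇝ n M e₂) (λ same → modulus∣ (proj₁ divisible same))
  , congMod (sumF n t) (rhs n M e₃ 3) (t-difference⇝ n M e₃) (λ same → modulus∣ (proj₁ (proj₂ divisible) same))
  , congMod (sumF n u) (rhs n M e₄ 4) (u-difference⇝ n M e₄) (λ same → modulus∣ (proj₂ (proj₂ divisible) same))
  where
  instance
    n≢0 : ℕ.NonZero n
    n≢0 = ℕ.>-nonZero n>0

  d%4 : ∀ d → d ∣ n → d % 4 ≡ 1
  d%4 = ≡1-mod-4 n n>0 primes≡1

  M e₂ e₃ e₄ : ℕ
  M = (n ∸ 1) / 4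
  e₂ = n ∸ 1
  e₃ = (3 * (n ∸ 1)) / 2
  e₄ = 2 * (n ∸ 1)

  n≡ : n ≡ suc (4 * M)
  n≡ = ≡.trans shape (≡.cong (λ i → suc (4 * i)) (≡.sym (≡.trans (≡.cong (λ i → (i ∸ 1) / 4) shape) (4*-/4 (n / 4)))))
    where shape = 1-mod-4-shape n (d%4 n ℕᵈ.∣-refl)

  n∸1≡ : n ∸ 1 ≡ 4 * M
  n∸1≡ = ≡.cong (_∸ 1) n≡

  e₂≡ : e₂ ≡ 2 * M * 2
  e₂≡ = ≡.trans n∸1≡ (solve 1 (λ M → con 4 :* M := con 2 :* M :* con 2) ≡.refl M)
    where open +-*-Solver

  e₃≡ : e₃ ≡ 2 * M * 3
  -- The integer division by 2 is exact, because `3 (n - 1) = 12 M`.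
  e₃≡ = ≡.trans (≡.cong (λ i → (3 * i) / 2) n∸1≡)
    (≡.trans (≡.cong (_/ 2) (solve 1 (λ M → con 3 :* (con 4 :* M) := con 2 :* M :* con 3 :* con 2) ≡.refl M))
      (DivMod.m*n/n≡m (2 * M * 3) 2))
    where open +-*-Solver

  e₄≡ : e₄ ≡ 2 * M * 4
  e₄≡ = ≡.trans (≡.cong (2 *_) n∸1≡) (solve 1 (λ M → con 2 :* (con 4 :* M) := con 2 :* M :* con 4) ≡.refl M)
    where open +-*-Solver

  divisor-shape : ∀ d → 1 < d → d ∣ n → ∃ λ m → 1 ℕ.≤ m × d ≡ suc (4 * m)
  divisor-shape d 1<d h = d / 4 , positive (d / 4) shape , shape
    where
    shape : d ≡ suc (4 * (d / 4))
    shape = 1-mod-4-shape d (d%4 d h)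
    positive : ∀ m → d ≡ suc (4 * m) → 1 ℕ.≤ m
    positive zero e = ⊥-elim (ℕₚ.<⇒≢ 1<d (≡.sym e))
    positive (suc m) e = ℕ.s≤s ℕ.z≤n

  module CF = CyclotomicFactors n

  modulus′ : Poly
  modulus′ = mulP (qint2P n) (mulP (subP oneP (mulP xP (K₂.pow q₂ (2 * n)))) (subP xP (K₂.pow q₂ (2 * n))))

  divisible : Divides modulus′ (Differences.Δs ring₂ domain₂ q₂ x₂ regK poleK n M e₂)
    × Divides modulus′ (Differences.Δt ring₂ domain₂ q₂ x₂ regK poleK n M e₃)
    × Divides modulus′ (Differences.Δu ring₂ domain₂ q₂ x₂ regK poleK n M e₄)
  divisible = Regularities.Numerators.divisible ring₂ domain₂ q₂ x₂ q₂-nonzero 1-q₂^-nonzero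
    q-linear₁ 1-q^-linear₁ q-linear₂ 1-q^-linear₂ x-q^-nonzero 1-xq^-nonzero I₂.X-nonzero
    regK poleK n M e₂ e₃ e₄ n≡ e₂≡ e₃≡ e₄≡
    (qint2P n) (CF.qint2P-eq n≡) CF.Φ (CF.combine n≡) divisor-shape
    (λ d lt h → CF.Φ∣ d lt (ℕᵈ.∣⇒≤ h)) (λ d lt h → CF.Φ-1-q d lt (ℕᵈ.∣⇒≤ h)) (λ d lt h → CF.Φ-ι d lt (ℕᵈ.∣⇒≤ h))
    (λ d lt h → CF.Φ-q d lt (ℕᵈ.∣⇒≤ h)) (λ d lt h → CF.Φ-x d lt (ℕᵈ.∣⇒≤ h))
    (λ d lt h → CF.Φ-1-xq d lt (ℕᵈ.∣⇒≤ h)) (λ d lt h → CF.Φ-x-q d lt (ℕᵈ.∣⇒≤ h))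

  -- `powP qP k` and `K₂.pow q₂ k` agree only by induction on `k`, so the modulus is transported
  -- along that equality.
  modulus∣ : ∀ {a} → modulus′ D₂.∣ a → modulus n D₂.∣ a
  modulus∣ {a} = ≡.subst (λ P → mulP (qint2P n) (mulP (subP oneP (mulP xP P)) (subP xP P)) D₂.∣ a) (≡.sym (powP≡pow (2 * n)))
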